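{- The set of positive integers that are not numerators of the orbit $\Psi\begin{pmatrix}2\\3\end{pmatrix}$ is equal to \[\{n^2:n\in\mathbb{Z}^+\}\cup\{3,6,7,10,12,15,18,19,27,31,34,55,63,99,115\}.\]
   Context: $\left(\frac{x}{y}\right)$ denotes the Kronecker symbol. $\Gamma_1(4)^{\geq 0}$ is the set of matrices $\begin{pmatrix} a & b\\ c & d\end{pmatrix}\in\mathrm{SL}(2,\mathbb{Z})$ with all entries nonnegative, $a\equiv d\equiv 1\pmod 4$, $c\equiv 0\pmod 4$. $\Psi$ is the semigroup of those $\begin{pmatrix} a & b\\ c & d\end{pmatrix}\in\Gamma_1(4)^{\geq 0}$ such that $\left(\frac{x}{y}\right)=\left(\frac{ax+by}{cx+dy}\right)$ for all nonnegative integers $x,y$ with $y$ odd. A numerator of $\Psi\begin{pmatrix}2\\3\end{pmatrix}$ is the first coordinate of some vector $\gamma\begin{pmatrix}2\\3\end{pmatrix}$ with $\gamma\in\Psi$. -}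

module Defs where

open import Data.Nat using (ℕ; zero; suc; _+_; _*_; _≤ᵇ_; _≡ᵇ_; _<_; _≤_)
open import Data.Nat.DivMod using (_%_; _/_)
open import Data.Bool using (Bool; true; false; if_then_else_)
open import Data.List using (List; []; _∷_; upTo; map; drop)
open import Data.Bool.ListAction using (any)
open import Data.Integer as ℤ using (ℤ; 0ℤ; 1ℤ; -1ℤ)
open import Data.Product using (Σ; _×_; ∃; ∃-syntax)
open import Relation.Binary.PropositionalEquality using (_≡_)

isQRᵇ : ℕ → ℕ → Bool
isQRᵇ a zero    = false
isQRᵇ a (suc q) = any (λ k → ((k * k) % suc q) ≡ᵇ (a % suc q)) (upTo (suc q))

legendre : ℕ → ℕ → ℤ
legendre a zero = 0ℤ
legendre a (suc q) =
  if (a % suc q) ≡ᵇ 0 then 0ℤ else (if isQRᵇ a (suc q) then 1ℤ else -1ℤ)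

firstDivisor : ℕ → ℕ → List ℕ → ℕ
firstDivisor n dflt [] = dflt
firstDivisor n dflt (d ∷ ds) = if (n % suc d) ≡ᵇ 0 then d else firstDivisor n dflt ds

-- smallest prime factor of n = suc (suc m) ≥ 2 is  suc (spfPred m):
-- the least p ∈ {2,…,n} with p ∣ n (searching p = suc d, d ∈ {1,…,n-1})
spfPred : ℕ → ℕ
spfPred m = firstDivisor (suc (suc m)) (suc m) (drop 1 (upTo (suc (suc m))))

-- Jacobi symbol with fuel: (a/n) = ∏ over prime factors p of n (with multiplicity) of (a/p).
-- Fuel n is always sufficient, since n / spf n < n for n ≥ 2.
jacobiF : ℕ → ℕ → ℕ → ℤ
jacobiF zero    a n = 1ℤ
jacobiF (suc f) a zero = 1ℤ
jacobiF (suc f) a (suc zero) = 1ℤ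
jacobiF (suc f) a (suc (suc m)) =
  legendre a (suc (spfPred m)) ℤ.* jacobiF f a ((suc (suc m)) / suc (spfPred m))


-- Kronecker symbol (x/y); only used for y odd and positive, where it
-- coincides with the Jacobi symbol.
kronecker : ℕ → ℕ → ℤ
kronecker x y = jacobiF y x y

Odd : ℕ → Set
Odd y = y % 2 ≡ 1

record InΓ₁4≥0 (a b c d : ℕ) : Set where
  field
    det   : a * d ≡ b * c + 1
    a≡1   : a % 4 ≡ 1
    d≡1   : d % 4 ≡ 1
    c≡0   : c % 4 ≡ 0

record InΨ (a b c d : ℕ) : Set where
  field
    inΓ   : InΓ₁4≥0 a b c d
    kron  : ∀ (x y : ℕ) → Odd y →
              kronecker x y ≡ kronecker (a * x + b * y) (c * x + d * y)

-- m is a numerator of Ψ (2,3)ᵀ: first coordinate 2a + 3b of γ (2,3)ᵀ for some γ ∈ Ψ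
IsNumerator : ℕ → Set
IsNumerator m = ∃[ a ] ∃[ b ] ∃[ c ] ∃[ d ] (InΨ a b c d × 2 * a + 3 * b ≡ m)

IsPerfectSquare : ℕ → Set
IsPerfectSquare m = ∃[ n ] (m ≡ n * n)

exceptional : List ℕ
exceptional = 3 ∷ 6 ∷ 7 ∷ 10 ∷ 12 ∷ 15 ∷ 18 ∷ 19 ∷ 27 ∷ 31 ∷ 34 ∷ 55 ∷ 63 ∷ 99 ∷ 115 ∷ []

{-# OPTIONS --safe #-}

-- For odd n = 2h + 1 the symbol J a n is the product over 1 ≤ k ≤ h of the signs of the absolutely
-- least residues of a k.  It is multiplicative in a because k ↦ |a k| permutes 1, …, h, it satisfies
-- reciprocity by counting lattice points in a rectangle, and reciprocity makes it multiplicative in n;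
-- hence it is the Jacobi symbol.  By reciprocity a matrix (a b; c d) of Γ₁(4)≥0 lies in Ψ exactly
-- when J b a = 1, so m is a numerator iff m = 2 a + 3 b with a ≡ 1 (mod 4) and J b a = 1.  Squares
-- are excluded because (2/3) = -1 and (k²/y) ≠ -1.
--
-- Conversely, let m be no square.  Unless the odd part n of m occurs with an even power of 2, a fixed
-- small b (or b = 2 (1 + 4 n)) works.  Otherwise one needs b in a given class mod 8 with b ≤ n / 3 and
-- J b n of prescribed sign.  Write n = s² t with t squarefree.  If a prime p ≥ 29 divides t, n = p w
-- with p ∤ w, then b ≡ 1 (mod w) turns J b n into J b p for b in a progression of length p / 24, that
-- is, into the symbols of p / 24 consecutive integers mod p.  If Q is a nonresidue with 27 ≤ Q < p / 48,
-- some x and Q x both lie in such a window, so both signs occur; the least nonresidue q satisfies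
-- q (q - 1) < p and supplies Q = q, 4 q or 16 q once p ≥ 5184.  The smaller primes are checked (for the
-- smallest, b ≡ ± 2 ^ k (mod w) is used as well).  If p ∣ s, or if t divides 3·5·…·23 and s ≥ 24, the
-- progression covers all residues; the remaining n are finitely many.

module Submission where

open import Defs
open import Data.Nat using (ℕ; zero; suc; _+_; _*_; _∸_; _^_; _≤_; _<_; _≥_; _≤ᵇ_; _≡ᵇ_; _<ᵇ_; z≤n; s≤s; s≤s⁻¹; NonZero; _≤?_; _<?_; _≟_; >-nonZero; >-nonZero⁻¹; n>1⇒nonTrivial; nonTrivial⇒n>1)
open import Data.Nat.Properties
open import Data.Nat.DivMod
open import Data.Nat.Induction using (<-rec)
open import Data.Nat.Divisibility using (_∣_; divides; _∣?_; ∣-trans; ∣m∣n⇒∣m+n; ∣m+n∣m⇒∣n; 0∣⇒≡0; ∣m⇒∣m*n; ∣n⇒∣m*n; ∣⇒≤; ∣1⇒≡1; m%n≡0⇒n∣m; n∣m⇒m%n≡0; ∣-refl; _∣0; m∣m*n; n∣m*n; ∣-reflexive)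
open import Data.Nat.Coprimality using (Coprime; coprime-divisor; coprime?; coprime-Bézout) renaming (sym to coprime-sym)
open import Data.Nat.GCD using (gcd; gcd[m,n]∣m; gcd[m,n]∣n; gcd-greatest; module Bézout)
open import Data.Nat.Tactic.RingSolver using (solve-∀)
open import Data.Integer as ℤ using (ℤ; 0ℤ; 1ℤ; -1ℤ)
import Data.Integer.Properties as ℤ
open import Data.Integer.Tactic.RingSolver using () renaming (solve-∀ to solve-∀ℤ)
open import Data.Bool using (Bool; true; false; if_then_else_; _∧_; _∨_; _xor_; not; T) renaming (_≟_ to _≟ᵇ_)
open import Data.Maybe using (Maybe; just; nothing)
open import Data.Fin as Fin using (Fin; toℕ; fromℕ<; punchOut; opposite)
open import Data.Fin.Properties using (toℕ<n; toℕ-injective; toℕ-fromℕ<; any?; injective⇒≤; punchOut-injective; opposite-prop) renaming (_≟_ to _≟ᶠ_)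
open import Data.Fin.Permutation using (permutation)
open import Data.Product using (Σ; ∃; ∃₂; _×_; _,_; proj₁; proj₂)
open import Data.Sum using (_⊎_; inj₁; inj₂; [_,_]′)
open import Data.Empty using (⊥)
open import Function using (_∘_; case_of_)
open import Function.Definitions using (Injective)
open import Relation.Nullary using (¬_; Dec; yes; no; contradiction)
open import Relation.Nullary.Decidable using (_×-dec_)
open import Relation.Binary.PropositionalEquality using (_≡_; _≢_; refl; sym; trans; cong; cong₂; subst; subst₂; module ≡-Reasoning)
open import Relation.Binary.Definitions using (tri<; tri≈; tri>)
open import Algebra.Properties.CommutativeMonoid.Sum ℤ.*-1-commutativeMonoid using (sum; sum-permute)
open import Data.Nat.Primality
open import Data.List using (List; []; _∷_; upTo; applyUpTo; map; _++_)
open import Data.Bool.ListAction using (any)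
open import Data.List.Relation.Unary.Any using (here; there)
open import Data.List.Membership.Propositional using (_∈_; _∉_)
open import Data.List.Membership.Propositional.Properties using (∈-upTo⁺; ∈-++⁺ˡ; ∈-++⁺ʳ; ∈-map⁺)
open import Data.List.Membership.DecPropositional _≟_ using (_∈?_)
open import Function.Bundles using (_⇔_; mk⇔)

-- Congruences of natural numbers

-- The product of signs is Gauss's lemma in Schering's form, taken as a definition: it makes sense
-- for composite n from the start, so reciprocity is proved once for all odd pairs, and
-- factorisations enter only in the comparison with `jacobiF`. The obstacle is quantitative. A class
-- modulo 8 and the bound b ≤ n / 3 leave, for a prime p, just p / 24 consecutive residues (24 = 3 ·
-- 8) among which both signs must occur. Without estimates of character sums there remain the bound
-- of order √p for the least nonresidue and dilation: x and Q x, for a nonresidue Q, can be placed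
-- in a common window once its length exceeds roughly both p / Q and 2 Q. The two combine only for p
-- in the thousands, which is the origin of the finite checks. For p < 48 the window is a single
-- integer and cannot contain both signs, whence the second family of candidates near multiples of
-- w, and the separate treatment of small w, for which a power of 2 is no longer small compared with
-- w.

Cong : ℕ → ℕ → ℕ → Set
Cong n x y = ∃₂ λ k l → x + k * n ≡ y + l * n

Cong-refl : ∀ {n x} → Cong n x x
Cong-refl = 0 , 0 , refl

Cong-≡ : ∀ {n x y} → x ≡ y → Cong n x y
Cong-≡ refl = Cong-refl

Cong-sym : ∀ {n x y} → Cong n x y → Cong n y x
Cong-sym (k , l , e) = l , k , sym e

Cong-trans : ∀ {n x y z} → Cong n x y → Cong n y z → Cong n x z
Cong-trans {n} {x} {y} {z} (k , l , e) (k′ , l′ , e′) = k + k′ , l + l′ , (begin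
  x + (k + k′) * n    ≡⟨ lem x k k′ n ⟩
  x + k * n + k′ * n  ≡⟨ cong (_+ k′ * n) e ⟩
  y + l * n + k′ * n  ≡⟨ lem₂ y l k′ n ⟩
  y + k′ * n + l * n  ≡⟨ cong (_+ l * n) e′ ⟩
  z + l′ * n + l * n  ≡⟨ lem₃ z l l′ n ⟩
  z + (l + l′) * n    ∎)
  where
  open ≡-Reasoning
  lem : ∀ x k k′ n → x + (k + k′) * n ≡ x + k * n + k′ * n
  lem = solve-∀
  lem₂ : ∀ y l k′ n → y + l * n + k′ * n ≡ y + k′ * n + l * n
  lem₂ = solve-∀
  lem₃ : ∀ z l l′ n → z + l′ * n + l * n ≡ z + (l + l′) * n
  lem₃ = solve-∀

Cong-+ : ∀ {n x y x′ y′} → Cong n x y → Cong n x′ y′ → Cong n (x + x′) (y + y′)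
Cong-+ {n} {x} {y} {x′} {y′} (k , l , e) (k′ , l′ , e′) = k + k′ , l + l′ ,
  trans (lem x x′ k k′ n) (trans (cong₂ _+_ e e′) (sym (lem y y′ l l′ n)))
  where
  lem : ∀ x x′ k k′ n → x + x′ + (k + k′) * n ≡ x + k * n + (x′ + k′ * n)
  lem = solve-∀

Cong-*ˡ : ∀ {n x y} a → Cong n x y → Cong n (a * x) (a * y)
Cong-*ˡ {n} {x} {y} a (k , l , e) = a * k , a * l ,
  trans (lem a x k n) (trans (cong (a *_) e) (sym (lem a y l n)))
  where
  lem : ∀ a x k n → a * x + a * k * n ≡ a * (x + k * n)
  lem = solve-∀

Cong-* : ∀ {n x y x′ y′} → Cong n x y → Cong n x′ y′ → Cong n (x * x′) (y * y′)
Cong-* {n} {x} {y} {x′} {y′} c c′ =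
  Cong-trans (Cong-*ˡ x c′) (subst₂ (Cong n) (*-comm y′ x) (*-comm y′ y) (Cong-*ˡ y′ c))

Cong-+-cancelʳ : ∀ {n x y} z → Cong n (x + z) (y + z) → Cong n x y
Cong-+-cancelʳ {n} {x} {y} z (k , l , e) = k , l ,
  +-cancelʳ-≡ z (x + k * n) (y + l * n) (trans (lem x z k n) (trans e (sym (lem y z l n))))
  where
  lem : ∀ x z k n → x + k * n + z ≡ x + z + k * n
  lem = solve-∀

Cong-∣ : ∀ {n m x y} → m ∣ n → Cong n x y → Cong m x y
Cong-∣ {n} {m} {x} {y} (divides q refl) (k , l , e) = k * q , l * q ,
  trans (cong (x +_) (*-assoc k q m)) (trans e (cong (y +_) (sym (*-assoc l q m))))

Cong⇒% : ∀ {n x y} .{{_ : NonZero n}} → Cong n x y → x % n ≡ y % n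
Cong⇒% {n} {x} {y} (k , l , e) =
  trans (sym ([m+kn]%n≡m%n x k n)) (trans (cong (_% n) e) ([m+kn]%n≡m%n y l n))

%⇒Cong : ∀ {n x y} .{{_ : NonZero n}} → x % n ≡ y % n → Cong n x y
%⇒Cong {n} {x} {y} e = y / n , x / n , (begin
  x + y / n * n                    ≡⟨ cong (_+ y / n * n) (m≡m%n+[m/n]*n x n) ⟩
  x % n + x / n * n + y / n * n    ≡⟨ cong (λ r → r + x / n * n + y / n * n) e ⟩
  y % n + x / n * n + y / n * n    ≡⟨ lem (y % n) (x / n * n) (y / n * n) ⟩
  y % n + y / n * n + x / n * n    ≡⟨ cong (_+ x / n * n) (m≡m%n+[m/n]*n y n) ⟨
  y + x / n * n                    ∎)
  where
  open ≡-Reasoning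
  lem : ∀ a b c → a + b + c ≡ a + c + b
  lem = solve-∀

Cong-% : ∀ x n .{{_ : NonZero n}} → Cong n (x % n) x
Cong-% x n = %⇒Cong (m%n%n≡m%n x n)

Cong-< : ∀ {n x y} → Cong n x y → x < n → y < n → x ≡ y
Cong-< {n} {x} {y} c x<n y<n =
  trans (sym (m<n⇒m%n≡m x<n)) (trans (Cong⇒% c) (m<n⇒m%n≡m y<n))
  where instance _ = >-nonZero (≤-<-trans z≤n x<n)

Cong0⇒∣ : ∀ {n x} → Cong n x 0 → n ∣ x
Cong0⇒∣ {n} {x} (k , l , e) = ∣m+n∣m⇒∣n (divides l (trans (+-comm (k * n) x) e)) (divides k refl)

∣⇒Cong0 : ∀ {n x} → n ∣ x → Cong n x 0
∣⇒Cong0 {n} {x} (divides q e) = 0 , q , trans (+-identityʳ x) e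

Cong-cancel-≤ : ∀ {n} a x y → Coprime a n → x ≤ y → Cong n (a * y) (a * x) → Cong n y x
Cong-cancel-≤ {n} a x y cop x≤y c =
  subst (λ z → Cong n z x) (m∸n+n≡m x≤y) (Cong-+ (∣⇒Cong0 d) (Cong-refl {n} {x}))
  where
  d : n ∣ y ∸ x
  d = coprime-divisor (coprime-sym cop) (Cong0⇒∣ (Cong-+-cancelʳ (a * x)
        (subst (λ z → Cong n z (a * x)) (trans (cong (a *_) (sym (m∸n+n≡m x≤y))) (*-distribˡ-+ a (y ∸ x) x)) c)))

Cong-cancelˡ : ∀ {n a x y} → Coprime a n → Cong n (a * x) (a * y) → Cong n x y
Cong-cancelˡ {n} {a} {x} {y} cop c with ≤-total x y
... | inj₁ x≤y = Cong-sym (Cong-cancel-≤ a x y cop x≤y (Cong-sym c))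
... | inj₂ y≤x = Cong-cancel-≤ a y x cop y≤x c

-- Products over finite types

-- A missed value could be punched out of the codomain, leaving an injection into a smaller type.
injective⇒surjective : ∀ {n} (f : Fin n → Fin n) → Injective _≡_ _≡_ f → ∀ j → ∃ λ i → f i ≡ j
injective⇒surjective {zero} f inj ()
injective⇒surjective {suc n} f inj j with any? (λ i → f i ≟ᶠ j)
... | yes p = p
... | no ¬p = contradiction (injective⇒≤ {f = λ i → punchOut (λ e → ¬p (i , sym e))}
                (λ {x} {y} e → inj (punchOut-injective (λ q → ¬p (x , sym q)) (λ q → ¬p (y , sym q)) e))) 1+n≰n

∏ : ∀ n → (Fin n → ℤ) → ℤ
∏ zero    f = 1ℤ
∏ (suc n) f = f Fin.zero ℤ.* ∏ n (f ∘ Fin.suc)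

∏-cong : ∀ n {f g : Fin n → ℤ} → (∀ i → f i ≡ g i) → ∏ n f ≡ ∏ n g
∏-cong zero    e = refl
∏-cong (suc n) e = cong₂ ℤ._*_ (e Fin.zero) (∏-cong n (e ∘ Fin.suc))

∏≡sum : ∀ {n} (f : Fin n → ℤ) → ∏ n f ≡ sum f
∏≡sum {zero}  f = refl
∏≡sum {suc n} f = cong (f Fin.zero ℤ.*_) (∏≡sum (f ∘ Fin.suc))

*-interchange : ∀ a b c d → (a ℤ.* b) ℤ.* (c ℤ.* d) ≡ (a ℤ.* c) ℤ.* (b ℤ.* d)
*-interchange = solve-∀ℤ

∏-distrib-* : ∀ n (f g : Fin n → ℤ) → ∏ n (λ i → f i ℤ.* g i) ≡ ∏ n f ℤ.* ∏ n g
∏-distrib-* zero    f g = refl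
∏-distrib-* (suc n) f g = trans (cong (f Fin.zero ℤ.* g Fin.zero ℤ.*_) (∏-distrib-* n (f ∘ Fin.suc) (g ∘ Fin.suc)))
  (*-interchange (f Fin.zero) (g Fin.zero) (∏ n (f ∘ Fin.suc)) (∏ n (g ∘ Fin.suc)))

∏-ones : ∀ {n} (g : Fin n → ℤ) → (∀ i → g i ≡ 1ℤ) → ∏ n g ≡ 1ℤ
∏-ones {zero}  g e = refl
∏-ones {suc n} g e = cong₂ ℤ._*_ (e Fin.zero) (∏-ones (g ∘ Fin.suc) (e ∘ Fin.suc))

∏-comm : ∀ {m n} (f : Fin m → Fin n → ℤ) → ∏ m (λ i → ∏ n (f i)) ≡ ∏ n (λ j → ∏ m (λ i → f i j))
∏-comm {zero}  {n} f = sym (∏-ones {n} _ (λ _ → refl))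
∏-comm {suc m} {n} f = trans (cong (∏ n (f Fin.zero) ℤ.*_) (∏-comm (f ∘ Fin.suc)))
  (sym (∏-distrib-* n (f Fin.zero) (λ j → ∏ m (λ i → f (Fin.suc i) j))))

∏-injective : ∀ {n} (f : Fin n → Fin n) → Injective _≡_ _≡_ f → (g : Fin n → ℤ) → ∏ n (λ i → g (f i)) ≡ ∏ n g
∏-injective f inj g = trans (∏≡sum (g ∘ f)) (trans (sym (sum-permute g π)) (sym (∏≡sum g)))
  where
  sur = injective⇒surjective f inj
  π = permutation f (λ j → proj₁ (sur j)) (λ j → proj₂ (sur j)) (λ i → inj (proj₂ (sur (f i))))

∏-single : ∀ {n} (g : Fin n → ℤ) i → (∀ j → j ≢ i → g j ≡ 1ℤ) → ∏ n g ≡ g i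
∏-single g Fin.zero h = trans (cong (g Fin.zero ℤ.*_) (∏-ones _ (λ i → h (Fin.suc i) (λ ())))) (ℤ.*-identityʳ _)
∏-single g (Fin.suc i) h = trans (cong₂ ℤ._*_ (h Fin.zero (λ ())) (∏-single (g ∘ Fin.suc) i (λ j j≢i → h (Fin.suc j) (λ { refl → j≢i refl })))) (ℤ.*-identityˡ _)

∏-zero : ∀ {n} (g : Fin n → ℤ) i → g i ≡ 0ℤ → ∏ n g ≡ 0ℤ
∏-zero {suc n} g Fin.zero e = trans (cong (ℤ._* ∏ n (g ∘ Fin.suc)) e) (ℤ.*-zeroˡ (∏ n (g ∘ Fin.suc)))
∏-zero {suc n} g (Fin.suc i) e = trans (cong (g Fin.zero ℤ.*_) (∏-zero (g ∘ Fin.suc) i e)) (ℤ.*-zeroʳ (g Fin.zero))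

IsSign : ℤ → Set
IsSign x = x ≡ 1ℤ ⊎ x ≡ -1ℤ

IsSign-* : ∀ {x y} → IsSign x → IsSign y → IsSign (x ℤ.* y)
IsSign-* (inj₁ refl) (inj₁ refl) = inj₁ refl
IsSign-* (inj₁ refl) (inj₂ refl) = inj₂ refl
IsSign-* (inj₂ refl) (inj₁ refl) = inj₂ refl
IsSign-* (inj₂ refl) (inj₂ refl) = inj₁ refl

IsSign-square : ∀ {x} → IsSign x → x ℤ.* x ≡ 1ℤ
IsSign-square (inj₁ refl) = refl
IsSign-square (inj₂ refl) = refl

∏-isSign : ∀ {n} (g : Fin n → ℤ) → (∀ i → IsSign (g i)) → IsSign (∏ n g)
∏-isSign {zero} g h = inj₁ refl
∏-isSign {suc n} g h = IsSign-* (h Fin.zero) (∏-isSign (g ∘ Fin.suc) (h ∘ Fin.suc))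

-- Off-diagonal entries of a symmetric matrix of signs cancel in pairs.
∏-symmetric : ∀ {n} (M : Fin n → Fin n → ℤ) → (∀ i j → IsSign (M i j)) → (∀ i j → M i j ≡ M j i) →
              ∏ n (λ i → ∏ n (M i)) ≡ ∏ n (λ i → M i i)
∏-symmetric {zero} M sg sy = refl
∏-symmetric {suc n} M sg sy = begin
  M o o ℤ.* R ℤ.* ∏ n (λ i → M (Fin.suc i) o ℤ.* ∏ n (λ j → M (Fin.suc i) (Fin.suc j)))
    ≡⟨ cong (M o o ℤ.* R ℤ.*_) (∏-distrib-* n (λ i → M (Fin.suc i) o) _) ⟩
  M o o ℤ.* R ℤ.* (∏ n (λ i → M (Fin.suc i) o) ℤ.* S)
    ≡⟨ cong (λ z → M o o ℤ.* R ℤ.* (z ℤ.* S)) (∏-cong n (λ i → sy (Fin.suc i) o)) ⟩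
  M o o ℤ.* R ℤ.* (R ℤ.* S)
    ≡⟨ lem (M o o) R S ⟩
  R ℤ.* R ℤ.* (M o o ℤ.* S)
    ≡⟨ cong (ℤ._* (M o o ℤ.* S)) (IsSign-square (∏-isSign _ (λ j → sg o (Fin.suc j)))) ⟩
  1ℤ ℤ.* (M o o ℤ.* S)
    ≡⟨ ℤ.*-identityˡ _ ⟩
  M o o ℤ.* S
    ≡⟨ cong (M o o ℤ.*_) (∏-symmetric (λ i j → M (Fin.suc i) (Fin.suc j)) (λ i j → sg _ _) (λ i j → sy _ _)) ⟩
  M o o ℤ.* ∏ n (λ i → M (Fin.suc i) (Fin.suc i)) ∎
  where
  open ≡-Reasoning
  o = Fin.zero
  R = ∏ n (λ j → M o (Fin.suc j))
  S = ∏ n (λ i → ∏ n (λ j → M (Fin.suc i) (Fin.suc j)))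
  lem : ∀ a r s → a ℤ.* r ℤ.* (r ℤ.* s) ≡ r ℤ.* r ℤ.* (a ℤ.* s)
  lem = solve-∀ℤ

-- The symbol J a n = ∏ₖ sgn (a k mod n), 1 ≤ k ≤ h, for n = 2h + 1

odd : ℕ → ℕ
odd h = suc (h + h)

sgn : ℕ → ℕ → ℤ
sgn h zero    = 0ℤ
sgn h (suc r) = if suc r ≤ᵇ h then 1ℤ else -1ℤ

gs : ℕ → ℕ → ℤ
gs h x = sgn h (x % odd h)

♯ : ∀ {h} → Fin h → ℕ
♯ i = suc (toℕ i)

♯≤ : ∀ {h} (i : Fin h) → ♯ i ≤ h
♯≤ i = toℕ<n i

♯< : ∀ {h} (i : Fin h) → ♯ i < odd h
♯< {h} i = s≤s (≤-trans (♯≤ i) (m≤m+n h h))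

♯-injective : ∀ {h} {i j : Fin h} → ♯ i ≡ ♯ j → i ≡ j
♯-injective e = toℕ-injective (suc-injective e)

♭ : ∀ {h} k → 1 ≤ k → k ≤ h → Σ (Fin h) λ i → ♯ i ≡ k
♭ (suc k) _ k≤h = fromℕ< k≤h , cong suc (toℕ-fromℕ< k≤h)

gs-cong : ∀ h {x y} → Cong (odd h) x y → gs h x ≡ gs h y
gs-cong h c = cong (sgn h) (Cong⇒% c)

≤ᵇ-yes : ∀ {m n} → m ≤ n → (m ≤ᵇ n) ≡ true
≤ᵇ-yes {m} {n} p with m ≤ᵇ n | ≤⇒≤ᵇ p
... | true | _ = refl

≤ᵇ-no : ∀ {m n} → n < m → (m ≤ᵇ n) ≡ false
≤ᵇ-no {m} {n} p with m ≤ᵇ n in eq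
... | false = refl
... | true = contradiction (≤ᵇ⇒≤ m n (subst T (sym eq) _)) (<⇒≱ p)

gs-zero : ∀ h {x} → Cong (odd h) x 0 → gs h x ≡ 0ℤ
gs-zero h c = gs-cong h {y = 0} c

gs-pos : ∀ h {x} (i : Fin h) → Cong (odd h) x (♯ i) → gs h x ≡ 1ℤ
gs-pos h {x} i c = trans (cong (sgn h) (trans (Cong⇒% c) (m<n⇒m%n≡m (♯< i))))
  (cong (if_then 1ℤ else -1ℤ) (≤ᵇ-yes (♯≤ i)))

gs-neg : ∀ h {x} (i : Fin h) → Cong (odd h) (x + ♯ i) 0 → gs h x ≡ -1ℤ
gs-neg h {x} i c = trans (cong (sgn h) (trans (Cong⇒% c′) (m<n⇒m%n≡m (s≤s (m∸n≤m (h + h) (toℕ i))))))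
  (trans (sgn-suc (h + h ∸ toℕ i) (m<n⇒0<n∸m (<-≤-trans (toℕ<n i) (m≤m+n h h))) )
         (cong (if_then 1ℤ else -1ℤ) (≤ᵇ-no h<)))
  where
  e : odd h ∸ ♯ i + ♯ i ≡ odd h
  e = m∸n+n≡m (<⇒≤ (♯< i))
  c′ : Cong (odd h) x (h + h ∸ toℕ i)
  c′ = Cong-+-cancelʳ (♯ i) (Cong-trans c (subst (Cong (odd h) 0) (sym e) (1 , 0 , refl)))
  h< : h < h + h ∸ toℕ i
  h< = subst (_< h + h ∸ toℕ i) (m+n∸n≡m h h) (∸-monoʳ-< (toℕ<n i) (m≤n+m h h))
  sgn-suc : ∀ r → 0 < r → sgn h r ≡ (if r ≤ᵇ h then 1ℤ else -1ℤ)
  sgn-suc (suc r) _ = refl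

data Res (h x : ℕ) : Set where
  zer : Cong (odd h) x 0 → Res h x
  pos : (i : Fin h) → Cong (odd h) x (♯ i) → Res h x
  neg : (i : Fin h) → Cong (odd h) (x + ♯ i) 0 → Res h x

res : ∀ h x → Res h x
res h x with x % odd h in eq
... | zero = zer (%⇒Cong eq)
... | suc r with suc r ≤? h
...   | yes p with ♭ (suc r) (s≤s z≤n) p
...     | i , e = pos i (subst (Cong (odd h) x) (trans eq (sym e)) (Cong-sym (Cong-% x (odd h))))
res h x | suc r | no ¬p with ♭ {h} (odd h ∸ suc r) (m<n⇒0<n∸m r<) le
  where
  r< : suc r < odd h
  r< = subst (_< odd h) eq (m%n<n x (odd h))
  le : odd h ∸ suc r ≤ h
  le = ≤-trans (∸-monoʳ-≤ (h + h) (s≤s⁻¹ (≰⇒> ¬p))) (≤-reflexive (m+n∸n≡m h h))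
...     | i , e = neg i (Cong-trans (Cong-+ (Cong-sym (Cong-% x (odd h))) (Cong-≡ e))
                   (subst (λ z → Cong (odd h) z 0) (sym (trans (cong (_+ (odd h ∸ suc r)) eq) (m+[n∸m]≡n (<⇒≤ r<))))
                     (0 , 1 , refl)))
  where
  r< : suc r < odd h
  r< = subst (_< odd h) eq (m%n<n x (odd h))

gs-negate : ∀ h {x y} → Cong (odd h) (x + y) 0 → gs h y ≡ ℤ.- gs h x
gs-negate h {x} {y} c with res h x
... | zer z = trans (gs-zero h (Cong-trans (Cong-+ (Cong-sym z) (Cong-refl {x = y})) c)) (cong ℤ.-_ (sym (gs-zero h z)))
... | pos i z = trans (gs-neg h i (Cong-trans (Cong-≡ (+-comm y (♯ i))) (Cong-trans (Cong-+ (Cong-sym z) Cong-refl) c))) (cong ℤ.-_ (sym (gs-pos h i z)))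
... | neg i z = trans (gs-pos h i (Cong-+-cancelʳ x (Cong-trans (Cong-≡ (+-comm y x)) (Cong-trans c (Cong-trans (Cong-sym z) (Cong-≡ (+-comm x (♯ i)))))))) (cong ℤ.-_ (sym (gs-neg h i z)))

JH : ℕ → ℕ → ℤ
JH h a = ∏ h (λ i → gs h (a * ♯ i))

unit-nz : ∀ h {a} → Coprime a (odd h) → (i : Fin h) → ¬ Cong (odd h) (a * ♯ i) 0
unit-nz h {a} cop i c = <⇒≱ (♯< i) (∣⇒≤ (coprime-divisor (coprime-sym cop) (Cong0⇒∣ c)))

absI : ∀ h {a} → Coprime a (odd h) → Fin h → Fin h
absI h {a} cop i with res h (a * ♯ i)
... | zer c = contradiction c (unit-nz h cop i)
... | pos j _ = j
... | neg j _ = j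

data Abs (h x : ℕ) (j : Fin h) : Set where
  pos : Cong (odd h) x (♯ j) → Abs h x j
  neg : Cong (odd h) (x + ♯ j) 0 → Abs h x j

absI-spec : ∀ h {a} (cop : Coprime a (odd h)) i → Abs h (a * ♯ i) (absI h cop i)
absI-spec h {a} cop i with res h (a * ♯ i)
... | zer c = contradiction c (unit-nz h cop i)
... | pos j c = pos c
... | neg j c = neg c

♯+♯≢0 : ∀ {h} (i j : Fin h) → ¬ Cong (odd h) (♯ i + ♯ j) 0
♯+♯≢0 {h} i j c = <⇒≱ (s≤s (+-mono-≤ (♯≤ i) (♯≤ j))) (∣⇒≤ (Cong0⇒∣ c))

-- Equal signs allow a to be cancelled; opposite signs would give a (i + j) ≡ 0 with 0 < i + j ≤ 2 h
-- < n.
absI-injective : ∀ h {a} (cop : Coprime a (odd h)) → Injective _≡_ _≡_ (absI h cop)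
absI-injective h {a} cop {i} {j} e with absI h cop i | absI-spec h cop i | absI h cop j | absI-spec h cop j
absI-injective h {a} cop {i} {j} refl | k | pos c | k | pos d =
  ♯-injective (Cong-< (Cong-cancelˡ cop (Cong-trans c (Cong-sym d))) (♯< i) (♯< j))
absI-injective h {a} cop {i} {j} refl | k | neg c | k | neg d =
  ♯-injective (Cong-< (Cong-cancelˡ cop (Cong-+-cancelʳ (♯ k) (Cong-trans c (Cong-sym d)))) (♯< i) (♯< j))
absI-injective h {a} cop {i} {j} refl | k | pos c | k | neg d = contradiction
  (Cong-cancelˡ cop (Cong-trans (Cong-≡ (*-distribˡ-+ a (♯ j) (♯ i))) (Cong-trans (Cong-+ (Cong-refl {x = a * ♯ j}) c) (Cong-trans d (Cong-≡ (sym (*-zeroʳ a)))))))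
  (♯+♯≢0 j i)
absI-injective h {a} cop {i} {j} refl | k | neg c | k | pos d = contradiction
  (Cong-cancelˡ cop (Cong-trans (Cong-≡ (*-distribˡ-+ a (♯ i) (♯ j))) (Cong-trans (Cong-+ (Cong-refl {x = a * ♯ i}) d) (Cong-trans c (Cong-≡ (sym (*-zeroʳ a)))))))
  (♯+♯≢0 i j)

JH-cong : ∀ h {a b} → Cong (odd h) a b → JH h a ≡ JH h b
JH-cong h {a} {b} c = ∏-cong h (λ i → gs-cong h (Cong-* c (Cong-refl {x = ♯ i})))

gs-isSign : ∀ h x → ¬ Cong (odd h) x 0 → IsSign (gs h x)
gs-isSign h x nz with res h x
... | zer c = contradiction c nz
... | pos i c = inj₁ (gs-pos h i c)
... | neg i c = inj₂ (gs-neg h i c)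

JH-isSign : ∀ h {a} → Coprime a (odd h) → IsSign (JH h a)
JH-isSign h {a} cop = ∏-isSign _ (λ i → gs-isSign h _ (unit-nz h cop i))

nonzero-divisor : ∀ {d n} → d ∣ suc n → 0 < d
nonzero-divisor {zero} (divides q e) = case trans e (*-zeroʳ q) of λ ()
nonzero-divisor {suc d} _ = s≤s z≤n

-- If d ∣ a, n = d q with d > 1, then k = q satisfies n ∣ a k.
JH-zero : ∀ h {a} → ¬ Coprime a (odd h) → JH h a ≡ 0ℤ
JH-zero h {a} ¬cop = helper (gcd a (odd h)) (gcd[m,n]∣m a (odd h)) (gcd[m,n]∣n a (odd h)) g≢1
  where
  g≢1 : gcd a (odd h) ≢ 1
  g≢1 e = ¬cop (λ {d} (p , q) → ∣1⇒≡1 (subst (d ∣_) e (gcd-greatest p q)))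
  helper : ∀ g → g ∣ a → g ∣ odd h → g ≢ 1 → JH h a ≡ 0ℤ
  helper zero _ g∣n _ = case nonzero-divisor g∣n of λ ()
  helper (suc zero) _ _ ≢1 = contradiction refl ≢1
  -- Only a common factor of at least 3 forces the cofactor q into 1, ..., h; the factor 2 is
  -- excluded by oddness.
  helper (suc (suc zero)) _ (divides q e) _ = contradiction (trans (sym (lem q)) (trans (cong (_% 2) (sym e)) (trans (cong (λ z → suc z % 2) (lem′ h)) (lem″ h)))) λ ()
    where
    lem : ∀ q → (q * 2) % 2 ≡ 0
    lem q = m*n%n≡0 q 2
    lem′ : ∀ h → h + h ≡ h * 2
    lem′ = solve-∀
    lem″ : ∀ h → suc (h * 2) % 2 ≡ 1
    lem″ h = [m+kn]%n≡m%n 1 h 2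
  helper (suc (suc (suc g))) (divides r a≡) (divides zero ()) _
  helper (suc (suc (suc g))) (divides r a≡) (divides (suc q) e) _ with ♭ {h} (suc q) (s≤s z≤n) le
    where
    le : suc q ≤ h
    le with suc q ≤? h
    ... | yes p = p
    ... | no ¬p = contradiction (≤-reflexive (sym e)) (<⇒≱ (begin-strict
      odd h              <⟨ s≤s (≤-reflexive (sym (+-suc h h))) ⟩
      suc h + suc h      ≤⟨ +-mono-≤ (≰⇒> ¬p) (≰⇒> ¬p) ⟩
      suc q + suc q      ≡⟨ lem q ⟩
      suc q * 2          ≤⟨ *-monoʳ-≤ (suc q) (s≤s (s≤s z≤n)) ⟩
      suc q * (3 + g)    ∎))
      where
      open ≤-Reasoning
      lem : ∀ q → suc q + suc q ≡ suc q * 2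
      lem = solve-∀
  ... | i , ei = ∏-zero _ i (gs-zero h (∣⇒Cong0 (divides r (begin
    a * ♯ i                 ≡⟨ cong (a *_) ei ⟩
    a * suc q               ≡⟨ cong (_* suc q) a≡ ⟩
    r * (3 + g) * suc q     ≡⟨ *-assoc r (3 + g) (suc q) ⟩
    r * ((3 + g) * suc q)   ≡⟨ cong (r *_) (trans (*-comm (3 + g) (suc q)) (sym e)) ⟩
    r * odd h               ∎))))
    where open ≡-Reasoning

coprime-*ˡ : ∀ {a b n} → Coprime (a * b) n → Coprime a n
coprime-*ˡ {a} {b} cop (p , q) = cop (∣m⇒∣m*n b p , q)

-- Since `gs` is odd, replacing x by its absolute value costs exactly the factor `gs h x`. This
-- cocycle identity is the source of multiplicativity.
gs-abs : ∀ h {x} {j : Fin h} b → Abs h x j → gs h (b * x) ≡ gs h x ℤ.* gs h (b * ♯ j)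
gs-abs h {x} {j} b (pos c) = trans (gs-cong h (Cong-*ˡ b c)) (sym (trans (cong (ℤ._* gs h (b * ♯ j)) (gs-pos h j c)) (ℤ.*-identityˡ _)))
gs-abs h {x} {j} b (neg c) = trans (gs-negate h {b * ♯ j} (Cong-trans (Cong-≡ (trans (+-comm (b * ♯ j) (b * x)) (sym (*-distribˡ-+ b x (♯ j))))) (Cong-trans (Cong-*ˡ b c) (Cong-≡ (*-zeroʳ b)))))
  (sym (trans (cong (ℤ._* gs h (b * ♯ j)) (gs-neg h j c)) (ℤ.-1*i≡-i _)))

JH-* : ∀ h a b → JH h (a * b) ≡ JH h a ℤ.* JH h b
JH-* h a b with coprime? a (odd h)
... | no ¬cop = trans (JH-zero h (¬cop ∘ coprime-*ˡ)) (sym (trans (cong (ℤ._* JH h b) (JH-zero h ¬cop)) (ℤ.*-zeroˡ (JH h b))))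
... | yes cop = begin
  ∏ h (λ i → gs h (a * b * ♯ i))
    ≡⟨ ∏-cong h (λ i → cong (gs h) (lem a b (♯ i))) ⟩
  ∏ h (λ i → gs h (b * (a * ♯ i)))
    ≡⟨ ∏-cong h (λ i → gs-abs h b (absI-spec h cop i)) ⟩
  ∏ h (λ i → gs h (a * ♯ i) ℤ.* gs h (b * ♯ (absI h cop i)))
    ≡⟨ ∏-distrib-* h (λ i → gs h (a * ♯ i)) _ ⟩
  JH h a ℤ.* ∏ h (λ i → gs h (b * ♯ (absI h cop i)))
    ≡⟨ cong (JH h a ℤ.*_) (∏-injective (absI h cop) (absI-injective h cop) (λ j → gs h (b * ♯ j))) ⟩
  JH h a ℤ.* JH h b ∎
  where
  open ≡-Reasoning
  lem : ∀ a b k → a * b * k ≡ b * (a * k)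
  lem = solve-∀

-- Reciprocity

-ᵇ : Bool → ℤ
-ᵇ p = if p then -1ℤ else 1ℤ

-ᵇ-isSign : ∀ p → IsSign (-ᵇ p)
-ᵇ-isSign true  = inj₂ refl
-ᵇ-isSign false = inj₁ refl

-ᵇ-yes : ∀ {p} → p ≡ true → -ᵇ p ≡ -1ℤ
-ᵇ-yes refl = refl

-ᵇ-no : ∀ {p} → ¬ (p ≡ true) → -ᵇ p ≡ 1ℤ
-ᵇ-no {true}  q = contradiction refl q
-ᵇ-no {false} q = refl

≤ᵇ-sound : ∀ {m n} → (m ≤ᵇ n) ≡ true → m ≤ n
≤ᵇ-sound {m} {n} e = ≤ᵇ⇒≤ m n (subst T (sym e) _)

<ᵇ-sound : ∀ {m n} → (m <ᵇ n) ≡ true → m < n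
<ᵇ-sound {m} {n} e = <ᵇ⇒< m n (subst T (sym e) _)

<ᵇ-yes : ∀ {m n} → m < n → (m <ᵇ n) ≡ true
<ᵇ-yes {m} {n} p with m <ᵇ n | <⇒<ᵇ p
... | true | _ = refl

<ᵇ-no : ∀ {m n} → n ≤ m → (m <ᵇ n) ≡ false
<ᵇ-no {m} {n} p with m <ᵇ n in eq
... | false = refl
... | true = contradiction (<ᵇ-sound eq) (≤⇒≯ p)

<ᵇ-iff : ∀ {a b c d} → (a < b → c < d) → (c < d → a < b) → (a <ᵇ b) ≡ (c <ᵇ d)
<ᵇ-iff {a} {b} {c} {d} f g with a <? b
... | yes p = trans (<ᵇ-yes p) (sym (<ᵇ-yes (f p)))
... | no ¬p = trans (<ᵇ-no (≮⇒≥ ¬p)) (sym (<ᵇ-no (≮⇒≥ (¬p ∘ g))))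

-- The half-open interval X < Y ≤ X + h contains a multiple Y of `odd h` exactly when the absolutely
-- least residue of X is negative.
window : ℕ → ℕ → ℕ → Bool
window h X Y = (X <ᵇ Y) ∧ (Y ≤ᵇ X + h)

window-sound : ∀ {h X Y} → window h X Y ≡ true → Σ (Fin h) λ i → Y ≡ X + ♯ i
window-sound {h} {X} {Y} e with X <ᵇ Y in p | Y ≤ᵇ X + h in q
window-sound {h} {X} {Y} e | true | true with ♭ {h} (Y ∸ X) (m<n⇒0<n∸m (<ᵇ-sound {X} {Y} p)) (subst (Y ∸ X ≤_) (m+n∸m≡n X h) (∸-monoˡ-≤ X (≤ᵇ-sound {Y} {X + h} q)))
... | i , ei = i , sym (trans (cong (X +_) ei) (m+[n∸m]≡n (<⇒≤ (<ᵇ-sound {X} {Y} p))))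

window-yes : ∀ {h X Y} → X < Y → Y ≤ X + h → window h X Y ≡ true
window-yes p q = cong₂ _∧_ (<ᵇ-yes p) (≤ᵇ-yes q)

-- Two multiples of `odd h` never share a window of length h, so at most one factor is -1. The bound
-- on X keeps that multiple among the first l: it is at most (2 l + 1) h + h = 2 h (l + 1) < (2 h +
-- 1) (l + 1).
gs-row : ∀ h l X → ¬ Cong (odd h) X 0 → X ≤ odd l * h →
         gs h X ≡ ∏ l (λ y → -ᵇ (window h X (odd h * ♯ y)))
gs-row h l X nz X≤ with res h X
... | zer c = contradiction c nz
... | pos j c = trans (gs-pos h {X} j c) (sym (∏-ones {l} _ (λ y → -ᵇ-no (bad y))))
  where
  bad : ∀ y → ¬ (window h X (odd h * ♯ y) ≡ true)
  bad y e with window-sound {h} {X} {odd h * ♯ y} e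
  ... | i , ei = ♯+♯≢0 j i (Cong-trans {y = X + ♯ i} (Cong-+ (Cong-sym {x = X} c) (Cong-refl {x = ♯ i}))
                   (subst (λ z → Cong (odd h) z 0) ei (∣⇒Cong0 (m∣m*n (♯ y)))))
... | neg j c with Cong0⇒∣ {x = X + ♯ j} c
...   | divides Y eY with ♭ {l} Y Y>0 Y≤l
  where
  Y>0 : 1 ≤ Y
  Y>0 = n≢0⇒n>0 (λ Y≡0 → contradiction (m+n≡0⇒n≡0 X {♯ j} (trans eY (cong (_* odd h) Y≡0))) λ ())
  Y≤l : Y ≤ l
  Y≤l = s≤s⁻¹ (*-cancelʳ-< (odd h) Y (suc l) (begin-strict
    Y * odd h             ≡⟨ eY ⟨
    X + ♯ j               ≤⟨ +-mono-≤ X≤ (♯≤ j) ⟩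
    odd l * h + h         ≡⟨ lem h l ⟩
    suc l * (h + h)       <⟨ *-monoʳ-< (suc l) (n<1+n (h + h)) ⟩
    suc l * odd h         ∎))
    where
    open ≤-Reasoning
    lem : ∀ h l → suc (l + l) * h + h ≡ suc l * (h + h)
    lem = solve-∀
...     | y , ey = trans (gs-neg h {X} j c) (sym (trans (∏-single {l} _ y others) (-ᵇ-yes (window-yes {h} {X} {odd h * ♯ y} lt le))))
  where
  eq : odd h * ♯ y ≡ X + ♯ j
  eq = trans (cong (odd h *_) ey) (trans (*-comm (odd h) Y) (sym eY))
  lt : X < odd h * ♯ y
  lt = subst (X <_) (sym eq) (m<m+n X (s≤s z≤n))
  le : odd h * ♯ y ≤ X + h
  le = subst (_≤ X + h) (sym eq) (+-monoʳ-≤ X (♯≤ j))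
  others : ∀ y′ → y′ ≢ y → -ᵇ (window h X (odd h * ♯ y′)) ≡ 1ℤ
  others y′ ≢y = -ᵇ-no (λ e → let (i , ei) = window-sound {h} {X} {odd h * ♯ y′} e in
    ≢y (♯-injective (*-cancelˡ-≡ (♯ y′) (♯ y) (odd h) (trans ei (trans (cong (X +_) (same i ei)) (sym eq))))))
    where
    same : ∀ i → odd h * ♯ y′ ≡ X + ♯ i → ♯ i ≡ ♯ j
    same i ei = Cong-< (Cong-+-cancelʳ {odd h} {♯ i} {♯ j} X (subst₂ (Cong (odd h)) (+-comm X (♯ i)) (+-comm X (♯ j))
      (Cong-trans (subst (λ z → Cong (odd h) z 0) ei (∣⇒Cong0 (m∣m*n (♯ y′)))) (Cong-sym {x = X + ♯ j} c)))) (♯< i) (♯< j)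

-- This is (-1) ^ (h l), written as a double product so that it splits off pointwise from the
-- product over the lattice rectangle.
sg : ℕ → ℕ → ℤ
sg h l = ∏ h (λ _ → ∏ l (λ _ → -1ℤ))

-- In the strip exactly one of the two windows holds; in the two corners outside it, neither does.
-- The right side is -1 everywhere, corrected on the corners.
window-pair : ∀ h l X Y → X ≢ Y → -ᵇ (window h X Y) ℤ.* -ᵇ (window l Y X) ≡ -1ℤ ℤ.* (-ᵇ (X + h <ᵇ Y) ℤ.* -ᵇ (Y + l <ᵇ X))
window-pair h l X Y X≢Y with <-cmp X Y
... | tri≈ _ X≡Y _ = contradiction X≡Y X≢Y
... | tri< X<Y _ _ rewrite <ᵇ-yes X<Y | <ᵇ-no (<⇒≤ X<Y) | <ᵇ-no {Y + l} {X} (≤-trans (<⇒≤ X<Y) (m≤m+n Y l)) with Y ≤? X + h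
...   | yes p rewrite ≤ᵇ-yes p | <ᵇ-no p = refl
...   | no ¬p rewrite ≤ᵇ-no (≰⇒> ¬p) | <ᵇ-yes (≰⇒> ¬p) = refl
window-pair h l X Y X≢Y | tri> _ _ Y<X rewrite <ᵇ-yes Y<X | <ᵇ-no (<⇒≤ Y<X) | <ᵇ-no {X + h} {Y} (≤-trans (<⇒≤ Y<X) (m≤m+n X h)) with X ≤? Y + l
...   | yes p rewrite ≤ᵇ-yes p | <ᵇ-no p = refl
...   | no ¬p rewrite ≤ᵇ-no (≰⇒> ¬p) | <ᵇ-yes (≰⇒> ¬p) = refl

♯-opposite : ∀ {h} (i : Fin h) → ♯ (opposite i) + ♯ i ≡ suc h
♯-opposite {h} i = cong suc (trans (cong (_+ ♯ i) (opposite-prop i)) (m∸n+n≡m (♯≤ i)))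

opposite-injective : ∀ {h} → Injective _≡_ _≡_ (opposite {h})
opposite-injective {h} {i} {j} e = ♯-injective (+-cancelˡ-≡ (♯ (opposite i)) (♯ i) (♯ j)
  (trans (♯-opposite i) (trans (sym (♯-opposite j)) (cong (λ k → ♯ k + ♯ j) (sym e)))))

-- Adding K to both sides removes the reflected coordinates, as x + x′ = h + 1 and y + y′ = l + 1.
-- The constants left over agree because (2 h + 1) (l + 1) + l = (2 l + 1) (h + 1) + h.
corner : ∀ h l (x : Fin h) (y : Fin l) →
  (odd h * ♯ (opposite y) + l <ᵇ odd l * ♯ (opposite x)) ≡ (odd l * ♯ x + h <ᵇ odd h * ♯ y)
corner h l x y = <ᵇ-iff
  (λ p → +-cancelʳ-< K₀ (odd l * ♯ x + h) (odd h * ♯ y) (subst₂ _<_ e₁ e₂ (+-monoˡ-< K p)))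
  (λ p → +-cancelʳ-< K (odd h * ♯ (opposite y) + l) (odd l * ♯ (opposite x)) (subst₂ _<_ (sym e₁) (sym e₂) (+-monoˡ-< K₀ p)))
  where
  open ≡-Reasoning
  K = odd h * ♯ y + odd l * ♯ x
  K₀ = odd l * suc h
  e₁ : odd h * ♯ (opposite y) + l + K ≡ odd l * ♯ x + h + K₀
  e₁ = begin
    odd h * ♯ (opposite y) + l + K                   ≡⟨ lem (odd h) (♯ (opposite y)) (♯ y) l (odd l * ♯ x) ⟩
    odd h * (♯ (opposite y) + ♯ y) + l + odd l * ♯ x ≡⟨ cong (λ z → odd h * z + l + odd l * ♯ x) (♯-opposite y) ⟩
    odd h * suc l + l + odd l * ♯ x                  ≡⟨ lem₂ h l (odd l * ♯ x) ⟩
    odd l * ♯ x + h + K₀                             ∎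
    where
    lem : ∀ n y′ y l z → n * y′ + l + (n * y + z) ≡ n * (y′ + y) + l + z
    lem = solve-∀
    lem₂ : ∀ h l z → suc (h + h) * suc l + l + z ≡ z + h + suc (l + l) * suc h
    lem₂ = solve-∀
  e₂ : odd l * ♯ (opposite x) + K ≡ odd h * ♯ y + K₀
  e₂ = begin
    odd l * ♯ (opposite x) + K                       ≡⟨ lem (odd l) (♯ (opposite x)) (♯ x) (odd h * ♯ y) ⟩
    odd h * ♯ y + odd l * (♯ (opposite x) + ♯ x)     ≡⟨ cong (λ z → odd h * ♯ y + odd l * z) (♯-opposite x) ⟩
    odd h * ♯ y + K₀                                 ∎
    where
    lem : ∀ m x′ x z → m * x′ + (z + m * x) ≡ z + m * (x′ + x)
    lem = solve-∀

-- The lattice points of the rectangle outside the strip -l ≤ n y - m x ≤ h come in pairs under the central reflection.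
reciprocity-coprime : ∀ h l → Coprime (odd l) (odd h) → JH h (odd l) ℤ.* JH l (odd h) ≡ sg h l
reciprocity-coprime h l cop = begin
  JH h (odd l) ℤ.* JH l (odd h)
    ≡⟨ cong₂ ℤ._*_ (∏-cong h (λ x → gs-row h l (X x) (unit-nz h cop x) (*-monoʳ-≤ (odd l) (♯≤ x)))) (trans (∏-cong l (λ y → gs-row l h (Y y) (unit-nz l (coprime-sym cop) y) (*-monoʳ-≤ (odd h) (♯≤ y)))) (∏-comm {l} {h} (λ y x → -ᵇ (window l (Y y) (X x))))) ⟩
  ∏ h (λ x → ∏ l (λ y → -ᵇ (window h (X x) (Y y)))) ℤ.* ∏ h (λ x → ∏ l (λ y → -ᵇ (window l (Y y) (X x))))
    ≡⟨ ∏∏-* (λ x y → -ᵇ (window h (X x) (Y y))) _ ⟩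
  ∏ h (λ x → ∏ l (λ y → -ᵇ (window h (X x) (Y y)) ℤ.* -ᵇ (window l (Y y) (X x))))
    ≡⟨ ∏-cong h (λ x → ∏-cong l (λ y → window-pair h l (X x) (Y y) (X≢Y x y))) ⟩
  ∏ h (λ x → ∏ l (λ y → -1ℤ ℤ.* (A x y ℤ.* B x y)))
    ≡⟨ ∏∏-* (λ _ _ → -1ℤ) (λ x y → A x y ℤ.* B x y) ⟨
  sg h l ℤ.* ∏ h (λ x → ∏ l (λ y → A x y ℤ.* B x y))
    ≡⟨ cong (sg h l ℤ.*_) (sym (∏∏-* A B)) ⟩
  sg h l ℤ.* (∏ h (λ x → ∏ l (A x)) ℤ.* ∏ h (λ x → ∏ l (B x)))
    ≡⟨ cong (λ z → sg h l ℤ.* (∏ h (λ x → ∏ l (A x)) ℤ.* z)) B≡A ⟩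
  sg h l ℤ.* (∏ h (λ x → ∏ l (A x)) ℤ.* ∏ h (λ x → ∏ l (A x)))
    ≡⟨ cong (sg h l ℤ.*_) (IsSign-square (∏-isSign {h} _ (λ x → ∏-isSign {l} _ (λ y → -ᵇ-isSign (X x + h <ᵇ Y y))))) ⟩
  sg h l ℤ.* 1ℤ
    ≡⟨ ℤ.*-identityʳ _ ⟩
  sg h l ∎
  where
  open ≡-Reasoning
  X : Fin h → ℕ
  X x = odd l * ♯ x
  Y : Fin l → ℕ
  Y y = odd h * ♯ y
  A B : Fin h → Fin l → ℤ
  A x y = -ᵇ (X x + h <ᵇ Y y)
  B x y = -ᵇ (Y y + l <ᵇ X x)
  ∏∏-* : (f g : Fin h → Fin l → ℤ) → ∏ h (λ x → ∏ l (f x)) ℤ.* ∏ h (λ x → ∏ l (g x)) ≡ ∏ h (λ x → ∏ l (λ y → f x y ℤ.* g x y))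
  ∏∏-* f g = trans (sym (∏-distrib-* h (λ x → ∏ l (f x)) (λ x → ∏ l (g x)))) (∏-cong h (λ x → sym (∏-distrib-* l (f x) (g x))))
  X≢Y : ∀ x y → X x ≢ Y y
  X≢Y x y e = unit-nz h cop x (∣⇒Cong0 (subst (odd h ∣_) (sym e) (m∣m*n (♯ y))))
  B≡A : ∏ h (λ x → ∏ l (B x)) ≡ ∏ h (λ x → ∏ l (A x))
  B≡A = begin
    ∏ h (λ x → ∏ l (B x))
      ≡⟨ ∏-injective {h} opposite opposite-injective (λ x → ∏ l (B x)) ⟨
    ∏ h (λ x → ∏ l (B (opposite x)))
      ≡⟨ ∏-cong h (λ x → sym (∏-injective {l} opposite opposite-injective (B (opposite x)))) ⟩
    ∏ h (λ x → ∏ l (λ y → B (opposite x) (opposite y)))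
      ≡⟨ ∏-cong h (λ x → ∏-cong l (λ y → cong -ᵇ (corner h l x y))) ⟩
    ∏ h (λ x → ∏ l (A x)) ∎

reciprocity : ∀ h l → JH h (odd l) ≡ sg h l ℤ.* JH l (odd h)
reciprocity h l with coprime? (odd l) (odd h)
... | yes cop = begin
  JH h (odd l)                                  ≡⟨ ℤ.*-identityʳ _ ⟨
  JH h (odd l) ℤ.* 1ℤ                           ≡⟨ cong (JH h (odd l) ℤ.*_) (IsSign-square (JH-isSign l (coprime-sym cop))) ⟨
  JH h (odd l) ℤ.* (JH l (odd h) ℤ.* JH l (odd h)) ≡⟨ ℤ.*-assoc (JH h (odd l)) _ _ ⟨
  JH h (odd l) ℤ.* JH l (odd h) ℤ.* JH l (odd h) ≡⟨ cong (ℤ._* JH l (odd h)) (reciprocity-coprime h l cop) ⟩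
  sg h l ℤ.* JH l (odd h)                       ∎
  where open ≡-Reasoning
... | no ¬cop = trans (JH-zero h ¬cop) (sym (trans (cong (sg h l ℤ.*_) (JH-zero l (¬cop ∘ coprime-sym))) (ℤ.*-zeroʳ (sg h l))))

-- The symbols of -1 and 2, and multiplicativity in the modulus

ε : ℕ → ℤ
ε n = ∏ n (λ _ → -1ℤ)

ε-isSign : ∀ n → IsSign (ε n)
ε-isSign n = ∏-isSign {n} _ (λ _ → inj₂ refl)

ε-+ : ∀ m n → ε (m + n) ≡ ε m ℤ.* ε n
ε-+ zero    n = sym (ℤ.*-identityˡ (ε n))
ε-+ (suc m) n = trans (cong (-1ℤ ℤ.*_) (ε-+ m n)) (sym (ℤ.*-assoc -1ℤ (ε m) (ε n)))

ε-double : ∀ n → ε (n + n) ≡ 1ℤ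
ε-double n = trans (ε-+ n n) (IsSign-square (ε-isSign n))

sg-even : ∀ h l → ε l ≡ 1ℤ → sg h l ≡ 1ℤ
sg-even h l e = ∏-ones {h} _ (λ _ → e)

sg-odd : ∀ h l → ε l ≡ -1ℤ → sg h l ≡ ε h
sg-odd h l e = ∏-cong h (λ _ → e)

sg-evenˡ : ∀ h l → ε h ≡ 1ℤ → sg h l ≡ 1ℤ
sg-evenˡ h l e with ε-isSign l
... | inj₁ p = sg-even h l p
... | inj₂ p = trans (sg-odd h l p) e

JH-neg1 : ∀ h {a} → Cong (odd h) (suc a) 0 → JH h a ≡ ε h
JH-neg1 h {a} c = ∏-cong h (λ i → gs-neg h i (Cong-trans (Cong-≡ (+-comm (a * ♯ i) (♯ i))) (Cong-* c (Cong-refl {x = ♯ i}))))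

-- Modulo 2 h + 3 one has -2 ≡ 2 h + 1; reciprocity between the neighbours 2 h + 1 and 2 h + 3 has
-- sign + because h (h + 1) is even; and 2 h + 3 ≡ 2 modulo 2 h + 1. The symbol of 2 thus obeys a
-- recursion in h.
JH-2-suc : ∀ h → JH (suc h) 2 ≡ ε (suc h) ℤ.* JH h 2
JH-2-suc h = begin
  JH (suc h) 2                                  ≡⟨ ℤ.*-identityˡ _ ⟨
  1ℤ ℤ.* JH (suc h) 2                           ≡⟨ cong (ℤ._* JH (suc h) 2) (IsSign-square (ε-isSign (suc h))) ⟨
  ε (suc h) ℤ.* ε (suc h) ℤ.* JH (suc h) 2      ≡⟨ ℤ.*-assoc (ε (suc h)) (ε (suc h)) _ ⟩
  ε (suc h) ℤ.* (ε (suc h) ℤ.* JH (suc h) 2)    ≡⟨ cong (λ z → ε (suc h) ℤ.* (z ℤ.* JH (suc h) 2)) (sym (JH-neg1 (suc h) {suc h + suc h} (0 , 1 , refl))) ⟩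
  ε (suc h) ℤ.* (JH (suc h) (suc h + suc h) ℤ.* JH (suc h) 2) ≡⟨ cong (ε (suc h) ℤ.*_) (JH-* (suc h) (suc h + suc h) 2) ⟨
  ε (suc h) ℤ.* JH (suc h) ((suc h + suc h) * 2) ≡⟨ cong (ε (suc h) ℤ.*_) (JH-cong (suc h) {b = odd h} (0 , 1 , lem h)) ⟩
  ε (suc h) ℤ.* JH (suc h) (odd h)              ≡⟨ cong (ε (suc h) ℤ.*_) (trans (reciprocity (suc h) h) (trans (cong (ℤ._* JH h (odd (suc h))) one) (ℤ.*-identityˡ _))) ⟩
  ε (suc h) ℤ.* JH h (odd (suc h))              ≡⟨ cong (ε (suc h) ℤ.*_) (JH-cong h {b = 2} (0 , 1 , lem₂ h)) ⟩
  ε (suc h) ℤ.* JH h 2                          ∎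
  where
  open ≡-Reasoning
  lem : ∀ h → (suc h + suc h) * 2 + 0 * suc (suc h + suc h) ≡ suc (h + h) + 1 * suc (suc h + suc h)
  lem = solve-∀
  lem₂ : ∀ h → suc (suc h + suc h) + 0 * suc (h + h) ≡ 2 + 1 * suc (h + h)
  lem₂ = solve-∀
  one : sg (suc h) h ≡ 1ℤ
  one with ε-isSign h
  ... | inj₁ p = sg-even (suc h) h p
  ... | inj₂ p = sg-evenˡ (suc h) h (cong (-1ℤ ℤ.*_) p)

JH-2-step : ∀ h → JH (4 + h) 2 ≡ JH h 2
JH-2-step h = begin
  JH (4 + h) 2 ≡⟨ JH-2-suc (3 + h) ⟩
  ε (4 + h) ℤ.* JH (3 + h) 2 ≡⟨ cong (ε (4 + h) ℤ.*_) (JH-2-suc (2 + h)) ⟩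
  ε (4 + h) ℤ.* (ε (3 + h) ℤ.* JH (2 + h) 2) ≡⟨ cong (λ z → ε (4 + h) ℤ.* (ε (3 + h) ℤ.* z)) (JH-2-suc (1 + h)) ⟩
  ε (4 + h) ℤ.* (ε (3 + h) ℤ.* (ε (2 + h) ℤ.* JH (1 + h) 2)) ≡⟨ cong (λ z → ε (4 + h) ℤ.* (ε (3 + h) ℤ.* (ε (2 + h) ℤ.* z))) (JH-2-suc h) ⟩
  ε (4 + h) ℤ.* (ε (3 + h) ℤ.* (ε (2 + h) ℤ.* (ε (1 + h) ℤ.* JH h 2))) ≡⟨ lem (JH h 2) (ε-isSign h) ⟩
  JH h 2 ∎
  where
  open ≡-Reasoning
  lem : ∀ z → IsSign (ε h) → ε (4 + h) ℤ.* (ε (3 + h) ℤ.* (ε (2 + h) ℤ.* (ε (1 + h) ℤ.* z))) ≡ z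
  lem z (inj₁ e) rewrite e = solve z
    where
    solve : ∀ z → 1ℤ ℤ.* (-1ℤ ℤ.* (1ℤ ℤ.* (-1ℤ ℤ.* z))) ≡ z
    solve = solve-∀ℤ
  lem z (inj₂ e) rewrite e = solve z
    where
    solve : ∀ z → -1ℤ ℤ.* (1ℤ ℤ.* (-1ℤ ℤ.* (1ℤ ℤ.* z))) ≡ z
    solve = solve-∀ℤ

infixl 7 _⊗_
_⊗_ : ℕ → ℕ → ℕ
h ⊗ l = h + l + (h * l + h * l)

odd-⊗ : ∀ h l → odd h * odd l ≡ odd (h ⊗ l)
odd-⊗ = lem
  where
  lem : ∀ h l → suc (h + h) * suc (l + l) ≡ suc (h + l + (h * l + h * l) + (h + l + (h * l + h * l)))
  lem = solve-∀

ε-⊗ : ∀ h l → ε (h ⊗ l) ≡ ε h ℤ.* ε l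
ε-⊗ h l = trans (ε-+ (h + l) (h * l + h * l)) (trans (cong (ε (h + l) ℤ.*_) (ε-double (h * l))) (trans (ℤ.*-identityʳ _) (ε-+ h l)))

sg-⊗ : ∀ h l k → sg (h ⊗ l) k ≡ sg h k ℤ.* sg l k
sg-⊗ h l k with ε-isSign k
... | inj₁ p = trans (sg-even (h ⊗ l) k p) (sym (cong₂ ℤ._*_ (sg-even h k p) (sg-even l k p)))
... | inj₂ p = trans (sg-odd (h ⊗ l) k p) (trans (ε-⊗ h l) (sym (cong₂ ℤ._*_ (sg-odd h k p) (sg-odd l k p))))

JH-⊗-odd : ∀ h l k → JH (h ⊗ l) (odd k) ≡ JH h (odd k) ℤ.* JH l (odd k)
JH-⊗-odd h l k = begin
  JH (h ⊗ l) (odd k)                                  ≡⟨ reciprocity (h ⊗ l) k ⟩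
  sg (h ⊗ l) k ℤ.* JH k (odd (h ⊗ l))                 ≡⟨ cong₂ ℤ._*_ (sg-⊗ h l k) (trans (cong (JH k) (sym (odd-⊗ h l))) (JH-* k (odd h) (odd l))) ⟩
  sg h k ℤ.* sg l k ℤ.* (JH k (odd h) ℤ.* JH k (odd l)) ≡⟨ *-interchange (sg h k) (sg l k) (JH k (odd h)) (JH k (odd l)) ⟩
  sg h k ℤ.* JH k (odd h) ℤ.* (sg l k ℤ.* JH k (odd l)) ≡⟨ cong₂ ℤ._*_ (reciprocity h k) (reciprocity l k) ⟨
  JH h (odd k) ℤ.* JH l (odd k)                       ∎
  where open ≡-Reasoning

data Parity : ℕ → Set where
  evenP : ∀ k → Parity (k + k)
  oddP  : ∀ k → Parity (odd k)

parity : ∀ n → Parity n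
parity zero = evenP 0
parity (suc n) with parity n
... | evenP k = oddP k
... | oddP k  = subst Parity (cong suc (+-suc k k)) (evenP (suc k))

-- Reciprocity speaks of odd arguments; adding the odd modulus turns an even a into an odd one.
JH-⊗ : ∀ h l a → JH (h ⊗ l) a ≡ JH h a ℤ.* JH l a
JH-⊗ h l a with parity a
... | oddP k = JH-⊗-odd h l k
... | evenP k = begin
  JH (h ⊗ l) (k + k)                 ≡⟨ JH-cong (h ⊗ l) c ⟩
  JH (h ⊗ l) (odd k′)                ≡⟨ JH-⊗-odd h l k′ ⟩
  JH h (odd k′) ℤ.* JH l (odd k′)    ≡⟨ cong₂ ℤ._*_ (JH-cong h (Cong-∣ d₁ c)) (JH-cong l (Cong-∣ d₂ c)) ⟨
  JH h (k + k) ℤ.* JH l (k + k)      ∎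
  where
  open ≡-Reasoning
  k′ = k + h ⊗ l
  c : Cong (odd (h ⊗ l)) (k + k) (odd k′)
  c = 1 , 0 , lem k (h ⊗ l)
    where
    lem : ∀ k m → k + k + 1 * suc (m + m) ≡ suc (k + m + (k + m)) + 0 * suc (m + m)
    lem = solve-∀
  d₁ : odd h ∣ odd (h ⊗ l)
  d₁ = subst (odd h ∣_) (odd-⊗ h l) (m∣m*n (odd l))
  d₂ : odd l ∣ odd (h ⊗ l)
  d₂ = subst (odd l ∣_) (odd-⊗ h l) (n∣m*n (odd h))

-- The symbol J a n for odd n

-- Meaningful for odd n, where n / 2 recovers h; an even n is silently read as n + 1.
J : ℕ → ℕ → ℤ
J a n = JH (n / 2) a

odd/2 : ∀ h → odd h / 2 ≡ h
odd/2 h = trans (/-congˡ {o = 2} (lem h)) (trans (+-distrib-/-∣ʳ 1 (n∣m*n h {2})) (m*n/n≡m h 2))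
  where
  lem : ∀ k → suc (k + k) ≡ 1 + k * 2
  lem = solve-∀

[k+k]%2 : ∀ k → (k + k) % 2 ≡ 0
[k+k]%2 k = trans (%-congˡ {o = 2} (lem k)) (m*n%n≡0 k 2)
  where
  lem : ∀ k → k + k ≡ k * 2
  lem = solve-∀

odd-Odd : ∀ h → Odd (odd h)
odd-Odd h = trans (%-congˡ {o = 2} (lem h)) ([m+kn]%n≡m%n 1 h 2)
  where
  lem : ∀ k → suc (k + k) ≡ 1 + k * 2
  lem = solve-∀

data IsOdd : ℕ → Set where
  isOdd : ∀ h → IsOdd (odd h)

Odd⇒IsOdd : ∀ n → Odd n → IsOdd n
Odd⇒IsOdd n o with parity n
... | oddP k = isOdd k
... | evenP k = contradiction (trans (sym ([k+k]%2 k)) o) λ ()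

IsOdd⇒Odd : ∀ {n} → IsOdd n → Odd n
IsOdd⇒Odd (isOdd h) = odd-Odd h

IsOdd-nonZero : ∀ {n} → IsOdd n → NonZero n
IsOdd-nonZero (isOdd h) = _

IsOdd-* : ∀ {m n} → IsOdd m → IsOdd n → IsOdd (m * n)
IsOdd-* (isOdd h) (isOdd l) = subst IsOdd (sym (odd-⊗ h l)) (isOdd (h ⊗ l))

¬IsOdd-double : ∀ k → ¬ IsOdd (k + k)
¬IsOdd-double k o = contradiction (trans (sym ([k+k]%2 k)) (IsOdd⇒Odd o)) λ ()

IsOdd-*ˡ : ∀ m n → IsOdd (m * n) → IsOdd m
IsOdd-*ˡ m n o with parity m
... | oddP k = isOdd k
... | evenP k = contradiction (subst IsOdd (lem k n) o) (¬IsOdd-double (k * n))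
  where
  lem : ∀ k n → (k + k) * n ≡ k * n + k * n
  lem = solve-∀

IsOdd-∣ : ∀ {m n} → m ∣ n → IsOdd n → IsOdd m
IsOdd-∣ {m} (divides q refl) o = IsOdd-*ˡ m q (subst IsOdd (*-comm q m) o)

J-odd : ∀ a h → J a (odd h) ≡ JH h a
J-odd a h = cong (λ k → JH k a) (odd/2 h)

J-cong : ∀ {a b n} → IsOdd n → Cong n a b → J a n ≡ J b n
J-cong {a} {b} (isOdd h) c = trans (J-odd a h) (trans (JH-cong h c) (sym (J-odd b h)))

J-*ˡ : ∀ a b n → J (a * b) n ≡ J a n ℤ.* J b n
J-*ˡ a b n = JH-* (n / 2) a b

J-*ʳ : ∀ a {m n} → IsOdd m → IsOdd n → J a (m * n) ≡ J a m ℤ.* J a n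
J-*ʳ a (isOdd h) (isOdd l) = trans (cong (J a) (odd-⊗ h l)) (trans (J-odd a (h ⊗ l)) (trans (JH-⊗ h l a) (sym (cong₂ ℤ._*_ (J-odd a h) (J-odd a l)))))

J-zero : ∀ {a n} → IsOdd n → ¬ Coprime a n → J a n ≡ 0ℤ
J-zero {a} (isOdd h) ¬c = trans (J-odd a h) (JH-zero h ¬c)

J-isSign : ∀ {a n} → IsOdd n → Coprime a n → IsSign (J a n)
J-isSign {a} (isOdd h) c = subst IsSign (sym (J-odd a h)) (JH-isSign h c)

isSign≢0 : ∀ {x} → IsSign x → x ≢ 0ℤ
isSign≢0 (inj₁ refl) ()
isSign≢0 (inj₂ refl) ()

J-coprime : ∀ {a n} → IsOdd n → IsSign (J a n) → Coprime a n
J-coprime {a} {n} o s with coprime? a n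
... | yes c = c
... | no ¬c = contradiction (J-zero o ¬c) (isSign≢0 s)

J-square : ∀ {a n} → IsOdd n → Coprime a n → J (a * a) n ≡ 1ℤ
J-square {a} {n} o c = trans (J-*ˡ a a n) (IsSign-square (J-isSign o c))

J-1 : ∀ {n} → IsOdd n → J 1 n ≡ 1ℤ
J-1 {n} o = J-square {1} o (λ (p , _) → ∣1⇒≡1 p)

%⇒≡ : ∀ n d r .{{_ : NonZero d}} → n % d ≡ r → n ≡ r + n / d * d
%⇒≡ n d r e = trans (m≡m%n+[m/n]*n n d) (cong (_+ n / d * d) e)

odd-inv : ∀ {h} k → odd h ≡ odd k → h ≡ k
odd-inv {h} k e = trans (sym (odd/2 h)) (trans (/-congˡ {o = 2} e) (odd/2 k))

ε-1mod4 : ∀ h → odd h % 4 ≡ 1 → ε h ≡ 1ℤ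
ε-1mod4 h e = trans (cong ε (odd-inv {h} (q + q) (trans (%⇒≡ (odd h) 4 1 e) (lem q)))) (ε-double q)
  where
  q = odd h / 4
  lem : ∀ q → 1 + q * 4 ≡ suc (q + q + (q + q))
  lem = solve-∀

ε-3mod4 : ∀ h → odd h % 4 ≡ 3 → ε h ≡ -1ℤ
ε-3mod4 h e = trans (cong ε (odd-inv {h} (suc (q + q)) (trans (%⇒≡ (odd h) 4 3 e) (lem q)))) (cong (-1ℤ ℤ.*_) (ε-double q))
  where
  q = odd h / 4
  lem : ∀ q → 3 + q * 4 ≡ suc (suc (q + q) + suc (q + q))
  lem = solve-∀

1mod4⇒IsOdd : ∀ {n} → n % 4 ≡ 1 → IsOdd n
1mod4⇒IsOdd {n} e = subst IsOdd (sym (trans (%⇒≡ n 4 1 e) (lem (n / 4)))) (isOdd (n / 4 + n / 4))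
  where
  lem : ∀ q → 1 + q * 4 ≡ suc (q + q + (q + q))
  lem = solve-∀

3mod4⇒IsOdd : ∀ {n} → n % 4 ≡ 3 → IsOdd n
3mod4⇒IsOdd {n} e = subst IsOdd (sym (trans (%⇒≡ n 4 3 e) (lem (n / 4)))) (isOdd (suc (n / 4 + n / 4)))
  where
  lem : ∀ q → 3 + q * 4 ≡ suc (suc (q + q) + suc (q + q))
  lem = solve-∀

J-recip : ∀ {m n} → IsOdd m → IsOdd n → m % 4 ≡ 1 ⊎ n % 4 ≡ 1 → J m n ≡ J n m
J-recip (isOdd l) (isOdd h) p = trans (J-odd (odd l) h) (trans (reciprocity h l) (trans (cong (ℤ._* JH l (odd h)) (one p)) (trans (ℤ.*-identityˡ _) (sym (J-odd (odd h) l)))))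
  where
  one : odd l % 4 ≡ 1 ⊎ odd h % 4 ≡ 1 → sg h l ≡ 1ℤ
  one (inj₁ e) = sg-even h l (ε-1mod4 l e)
  one (inj₂ e) = sg-evenˡ h l (ε-1mod4 h e)

J-recip⁻ : ∀ {m n} → IsOdd m → IsOdd n → m % 4 ≡ 3 → n % 4 ≡ 3 → J m n ≡ ℤ.- J n m
J-recip⁻ (isOdd l) (isOdd h) p q = trans (J-odd (odd l) h) (trans (reciprocity h l) (trans (cong (ℤ._* JH l (odd h)) (trans (sg-odd h l (ε-3mod4 l p)) (ε-3mod4 h q))) (trans (ℤ.-1*i≡-i _) (cong ℤ.-_ (sym (J-odd (odd h) l))))))

JH-neg : ∀ h {a b} → Cong (odd h) (a + b) 0 → JH h b ≡ ε h ℤ.* JH h a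
JH-neg h {a} {b} c = trans (JH-cong h (Cong-+-cancelʳ a c′)) (trans (JH-* h (h + h) a) (cong (ℤ._* JH h a) (JH-neg1 h {h + h} (0 , 1 , refl))))
  where
  c′ : Cong (odd h) (b + a) ((h + h) * a + a)
  c′ = Cong-trans (subst (λ z → Cong (odd h) z 0) (+-comm a b) c) (Cong-sym (∣⇒Cong0 (divides a (lem h a))))
    where
    lem : ∀ h a → (h + h) * a + a ≡ a * suc (h + h)
    lem = solve-∀

J-neg⁺ : ∀ {a b n} → IsOdd n → n % 4 ≡ 1 → Cong n (a + b) 0 → J b n ≡ J a n
J-neg⁺ {a} {b} (isOdd h) e c = trans (J-odd b h) (trans (JH-neg h {a} c) (trans (cong (ℤ._* JH h a) (ε-1mod4 h e)) (trans (ℤ.*-identityˡ _) (sym (J-odd a h)))))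

J-neg⁻ : ∀ {a b n} → IsOdd n → n % 4 ≡ 3 → Cong n (a + b) 0 → J b n ≡ ℤ.- J a n
J-neg⁻ {a} {b} (isOdd h) e c = trans (J-odd b h) (trans (JH-neg h {a} c) (trans (cong (ℤ._* JH h a) (ε-3mod4 h e)) (trans (ℤ.-1*i≡-i _) (cong ℤ.-_ (sym (J-odd a h))))))

J2 : ℕ → ℤ
J2 1 = 1ℤ
J2 7 = 1ℤ
J2 _ = -1ℤ

JH-2-mod : ∀ r q → JH (r + q * 4) 2 ≡ JH r 2
JH-2-mod r zero    = cong (λ k → JH k 2) (+-identityʳ r)
JH-2-mod r (suc q) = trans (cong (λ k → JH k 2) (lem r q)) (trans (JH-2-step (r + q * 4)) (JH-2-mod r q))
  where
  lem : ∀ r q → r + suc q * 4 ≡ 4 + (r + q * 4)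
  lem = solve-∀

J-2 : ∀ {n} → IsOdd n → J 2 n ≡ J2 (n % 8)
J-2 (isOdd h) = trans (J-odd 2 h) (trans (cong (λ k → JH k 2) h≡) (trans (JH-2-mod (h % 4) (h / 4)) (trans (tbl (h % 4) (m%n<n h 4)) (cong J2 (sym o%8)))))
  where
  h≡ : h ≡ h % 4 + h / 4 * 4
  h≡ = m≡m%n+[m/n]*n h 4
  lem : ∀ r q → suc (r + q * 4 + (r + q * 4)) ≡ suc (r + r) + q * 8
  lem = solve-∀
  o%8 : odd h % 8 ≡ odd (h % 4) % 8
  o%8 = trans (%-congˡ {o = 8} (trans (cong odd h≡) (lem (h % 4) (h / 4)))) ([m+kn]%n≡m%n (odd (h % 4)) (h / 4) 8)
  tbl : ∀ r → r < 4 → JH r 2 ≡ J2 (odd r % 8)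
  tbl 0 _ = refl
  tbl 1 _ = refl
  tbl 2 _ = refl
  tbl 3 _ = refl
  tbl (suc (suc (suc (suc r)))) (s≤s (s≤s (s≤s (s≤s ()))))

odd%4 : ∀ {n} → IsOdd n → n % 4 ≡ 1 ⊎ n % 4 ≡ 3
odd%4 (isOdd h) with parity h
... | evenP k = inj₁ (trans (%-congˡ {o = 4} (lem k)) ([m+kn]%n≡m%n 1 k 4))
  where
  lem : ∀ k → suc (k + k + (k + k)) ≡ 1 + k * 4
  lem = solve-∀
... | oddP k = inj₂ (trans (%-congˡ {o = 4} (lem k)) ([m+kn]%n≡m%n 3 k 4))
  where
  lem : ∀ k → suc (suc (k + k) + suc (k + k)) ≡ 3 + k * 4
  lem = solve-∀

ε-mod4 : ∀ h l → odd h % 4 ≡ odd l % 4 → ε h ≡ ε l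
ε-mod4 h l e with odd%4 (isOdd h)
... | inj₁ p = trans (ε-1mod4 h p) (sym (ε-1mod4 l (trans (sym e) p)))
... | inj₂ p = trans (ε-3mod4 h p) (sym (ε-3mod4 l (trans (sym e) p)))

sg-mod4 : ∀ h l k → odd h % 4 ≡ odd l % 4 → sg h k ≡ sg l k
sg-mod4 h l k e with ε-isSign k
... | inj₁ p = trans (sg-even h k p) (sym (sg-even l k p))
... | inj₂ p = trans (sg-odd h k p) (trans (ε-mod4 h l e) (sym (sg-odd l k p)))

-- Strong induction strips factors 2 from x: each is absorbed by the period 8 of the symbol of 2 and
-- halves the modulus. For odd x, reciprocity needs the class modulo 4 for its sign and the class
-- modulo x for the symbol.
J-period : ∀ x {m n} → IsOdd m → IsOdd n → Cong (4 * x) m n → J x m ≡ J x n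
J-period x = <-rec (λ x → ∀ {m n} → IsOdd m → IsOdd n → Cong (4 * x) m n → J x m ≡ J x n) step x
  where
  step : ∀ x → (∀ {y} → y < x → ∀ {m n} → IsOdd m → IsOdd n → Cong (4 * y) m n → J y m ≡ J y n) →
         ∀ {m n} → IsOdd m → IsOdd n → Cong (4 * x) m n → J x m ≡ J x n
  step x rec {m} {n} om on c with parity x
  -- For x = 0 the modulus is 0, and congruence modulo 0 is equality.
  ... | evenP zero = cong (J 0) (trans (sym (+-identityʳ m)) (trans (trans (cong (m +_) (sym (*-zeroʳ (proj₁ c)))) (proj₂ (proj₂ c))) (trans (cong (n +_) (*-zeroʳ (proj₁ (proj₂ c)))) (+-identityʳ n))))
  ... | evenP (suc k) = begin
    J (suc k + suc k) m          ≡⟨ cong (λ z → J z m) (lem (suc k)) ⟩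
    J (2 * suc k) m              ≡⟨ J-*ˡ 2 (suc k) m ⟩
    J 2 m ℤ.* J (suc k) m        ≡⟨ cong₂ ℤ._*_ (trans (J-2 om) (trans (cong J2 (Cong⇒% (Cong-∣ (divides (suc k) (lem₂ (suc k))) c))) (sym (J-2 on)))) (rec (m<m+n (suc k) (s≤s z≤n)) om on (Cong-∣ (divides 2 (lem₃ (suc k))) c)) ⟩
    J 2 n ℤ.* J (suc k) n        ≡⟨ J-*ˡ 2 (suc k) n ⟨
    J (2 * suc k) n              ≡⟨ cong (λ z → J z n) (lem (suc k)) ⟨
    J (suc k + suc k) n          ∎
    where
    open ≡-Reasoning
    lem : ∀ k → k + k ≡ 2 * k
    lem = solve-∀
    lem₂ : ∀ k → 4 * (k + k) ≡ k * 8
    lem₂ = solve-∀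
    lem₃ : ∀ k → 4 * (k + k) ≡ 2 * (4 * k)
    lem₃ = solve-∀
  ... | oddP k = odd-step k om on c
    where
    odd-step : ∀ k {m n} → IsOdd m → IsOdd n → Cong (4 * odd k) m n → J (odd k) m ≡ J (odd k) n
    odd-step k (isOdd h) (isOdd l) c = trans (J-odd (odd k) h) (trans (reciprocity h k)
      (trans (cong₂ ℤ._*_ (sg-mod4 h l k (Cong⇒% (Cong-∣ {m = 4} (m∣m*n (odd k)) c))) (JH-cong k (Cong-∣ (n∣m*n 4) c)))
      (sym (trans (J-odd (odd k) l) (reciprocity l k)))))

-- Comparison with the Legendre and Kronecker symbols

≡ᵇ-sound : ∀ {m n} → (m ≡ᵇ n) ≡ true → m ≡ n
≡ᵇ-sound {m} {n} e = ≡ᵇ⇒≡ m n (subst T (sym e) _)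

≡ᵇ-yes : ∀ {m n} → m ≡ n → (m ≡ᵇ n) ≡ true
≡ᵇ-yes {m} {n} p with m ≡ᵇ n | ≡⇒≡ᵇ m n p
... | true | _ = refl

-ᵇ-iff : ∀ {p q} → (p ≡ true → q ≡ true) → (q ≡ true → p ≡ true) → -ᵇ p ≡ -ᵇ q
-ᵇ-iff {true}  {true}  f g = refl
-ᵇ-iff {true}  {false} f g = contradiction (f refl) λ ()
-ᵇ-iff {false} {true}  f g = contradiction (g refl) λ ()
-ᵇ-iff {false} {false} f g = refl

congᵇ : ℕ → ℕ → ℕ → Bool
congᵇ h x y = (x % odd h) ≡ᵇ (y % odd h)

congᵇ-sound : ∀ h {x y} → congᵇ h x y ≡ true → Cong (odd h) x y
congᵇ-sound h e = %⇒Cong (≡ᵇ-sound e)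

congᵇ-yes : ∀ h {x y} → Cong (odd h) x y → congᵇ h x y ≡ true
congᵇ-yes h c = ≡ᵇ-yes (Cong⇒% c)

congᵇ-iff : ∀ h {x y x′ y′} → (Cong (odd h) x y → Cong (odd h) x′ y′) → (Cong (odd h) x′ y′ → Cong (odd h) x y) →
            -ᵇ (congᵇ h x y) ≡ -ᵇ (congᵇ h x′ y′)
congᵇ-iff h {x} {y} {x′} {y′} f g = -ᵇ-iff (λ e → congᵇ-yes h {x′} {y′} (f (congᵇ-sound h {x} {y} e))) (λ e → congᵇ-yes h {x} {y} (g (congᵇ-sound h {x′} {y′} e)))

coprime-∣ : ∀ {a p} → Prime p → ¬ p ∣ a → Coprime a p
coprime-∣ {a} {p} pr p∤a (d∣a , d∣p) with prime⇒irreducible pr d∣p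
... | inj₁ d≡1 = d≡1
... | inj₂ refl = contradiction d∣a p∤a

-- Parity of the number of square roots modulo a prime

module _ (h : ℕ) (pr : Prime (odd h)) where

  private
    ≈-sym = λ {x} {y} → Cong-sym {odd h} {x} {y}

  ♯-coprime : (i : Fin h) → Coprime (♯ i) (odd h)
  ♯-coprime i = coprime-∣ pr (λ d → <⇒≱ (♯< i) (∣⇒≤ d))

  h≥1 : 1 ≤ h
  h≥1 = n≢0⇒n>0 (λ { refl → ¬prime[1] pr })

  one : Fin h
  one = proj₁ (♭ {h} 1 (s≤s z≤n) h≥1)

  ♯one : ♯ one ≡ 1
  ♯one = proj₂ (♭ {h} 1 (s≤s z≤n) h≥1)

  roots⁻ : ℕ → ℤ
  roots⁻ a = ∏ h (λ k → -ᵇ (congᵇ h (♯ k * ♯ k + a) 0))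

  roots : ℕ → ℤ
  roots a = ∏ h (λ k → -ᵇ (congᵇ h (♯ k * ♯ k) a))

  -- For every l exactly one k in the half system satisfies k l ≡ ± 1.
  inverse-pm : (l : Fin h) → ∏ h (λ k → -ᵇ (congᵇ h (♯ k * ♯ l) 1)) ≡ -1ℤ ℤ.* ∏ h (λ k → -ᵇ (congᵇ h (♯ k * ♯ l + 1) 0))
  inverse-pm l = trans (sym (ℤ.*-identityʳ P)) (trans (cong (P ℤ.*_) (sym (IsSign-square (∏-isSign {h} _ (λ k → -ᵇ-isSign (congᵇ h (♯ k * ♯ l + 1) 0))))))
    (trans (sym (ℤ.*-assoc P N N)) (cong (ℤ._* N) PN)))
    where
    P = ∏ h (λ k → -ᵇ (congᵇ h (♯ k * ♯ l) 1))
    N = ∏ h (λ k → -ᵇ (congᵇ h (♯ k * ♯ l + 1) 0))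
    cop = ♯-coprime l
    +1≢0 : (j : Fin h) → ¬ Cong (odd h) (♯ j + 1) 0
    +1≢0 j c = ♯+♯≢0 j one (subst (λ z → Cong (odd h) (♯ j + z) 0) (sym ♯one) c)
    ≡1 : (j : Fin h) → Cong (odd h) (♯ j) 1 → ♯ j ≡ 1
    ≡1 j c = Cong-< c (♯< j) (subst (_< odd h) ♯one (♯< one))
    pt : ∀ k → -ᵇ (congᵇ h (♯ k * ♯ l) 1) ℤ.* -ᵇ (congᵇ h (♯ k * ♯ l + 1) 0) ≡ -ᵇ (♯ (absI h cop k) ≡ᵇ 1)
    pt k with absI h cop k | absI-spec h cop k
    ... | j | pos c = trans (cong₂ ℤ._*_ (-ᵇ-iff {q = ♯ j ≡ᵇ 1}
              (λ e → ≡ᵇ-yes (≡1 j (Cong-trans (≈-sym c) (Cong-trans (Cong-≡ (*-comm (♯ l) (♯ k))) (congᵇ-sound h {♯ k * ♯ l} {1} e)))))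
              (λ e → congᵇ-yes h {♯ k * ♯ l} {1} (Cong-trans (Cong-≡ (*-comm (♯ k) (♯ l))) (Cong-trans c (Cong-≡ (≡ᵇ-sound e))))))
            (-ᵇ-no (λ e → +1≢0 j (Cong-trans (Cong-+ (≈-sym c) (Cong-refl {x = 1})) (Cong-trans (Cong-≡ (cong (_+ 1) (*-comm (♯ l) (♯ k)))) (congᵇ-sound h {♯ k * ♯ l + 1} {0} e))))))
            (ℤ.*-identityʳ _)
    ... | j | neg c = trans (cong₂ ℤ._*_
            (-ᵇ-no (λ e → +1≢0 j (Cong-trans (Cong-≡ (+-comm (♯ j) 1)) (Cong-trans (Cong-+ (≈-sym (Cong-trans (Cong-≡ (*-comm (♯ l) (♯ k))) (congᵇ-sound h {♯ k * ♯ l} {1} e))) (Cong-refl {x = ♯ j})) c))))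
            (-ᵇ-iff {q = ♯ j ≡ᵇ 1}
              (λ e → ≡ᵇ-yes (≡1 j (Cong-+-cancelʳ (♯ l * ♯ k) (Cong-trans (Cong-≡ (+-comm (♯ j) (♯ l * ♯ k))) (Cong-trans c (≈-sym (Cong-trans (Cong-≡ (trans (+-comm 1 (♯ l * ♯ k)) (cong (_+ 1) (*-comm (♯ l) (♯ k))))) (congᵇ-sound h {♯ k * ♯ l + 1} {0} e))))))))
              (λ e → congᵇ-yes h {♯ k * ♯ l + 1} {0} (Cong-trans (Cong-≡ (cong₂ _+_ (*-comm (♯ k) (♯ l)) (sym (≡ᵇ-sound {♯ j} {1} e)))) c))))
            (ℤ.*-identityˡ _)
    PN : P ℤ.* N ≡ -1ℤ
    PN = trans (sym (∏-distrib-* h (λ k → -ᵇ (congᵇ h (♯ k * ♯ l) 1)) (λ k → -ᵇ (congᵇ h (♯ k * ♯ l + 1) 0)))) (trans (∏-cong h pt)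
      (trans (∏-injective (absI h cop) (absI-injective h cop) (λ j → -ᵇ (♯ j ≡ᵇ 1)))
      (trans (∏-single {h} (λ j → -ᵇ (♯ j ≡ᵇ 1)) one (λ j j≢ → -ᵇ-no (λ e → j≢ (♯-injective (trans (≡ᵇ-sound {♯ j} {1} e) (sym ♯one)))))) (-ᵇ-yes (≡ᵇ-yes ♯one)))))

  -- The matrix of the relation k l ≡ -a is symmetric, so the parity of its entries is that of its
  -- diagonal, the square roots of -a. Substituting |a l| for l turns column l into k l ≡ -1 or,
  -- when a l has negative sign, into k l ≡ 1; by `inverse-pm` each negative sign costs a factor -1,
  -- and these factors multiply to `JH h a`.
  roots⁻-J : ∀ {a} → Coprime a (odd h) → roots⁻ a ≡ JH h a ℤ.* roots⁻ 1
  roots⁻-J {a} cop = begin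
    roots⁻ a
      ≡⟨ ∏-symmetric (t a) (λ k l → -ᵇ-isSign (congᵇ h (♯ k * ♯ l + a) 0)) (t-sym a) ⟨
    ∏ h (λ k → ∏ h (t a k))
      ≡⟨ ∏-cong h (λ k → sym (∏-injective (absI h cop) (absI-injective h cop) (t a k))) ⟩
    ∏ h (λ k → ∏ h (λ l → t a k (absI h cop l)))
      ≡⟨ ∏-comm {h} {h} (λ k l → t a k (absI h cop l)) ⟩
    ∏ h (λ l → ∏ h (λ k → t a k (absI h cop l)))
      ≡⟨ ∏-cong h col ⟩
    ∏ h (λ l → gs h (a * ♯ l) ℤ.* ∏ h (λ k → t 1 k l))
      ≡⟨ ∏-distrib-* h (λ l → gs h (a * ♯ l)) (λ l → ∏ h (λ k → t 1 k l)) ⟩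
    JH h a ℤ.* ∏ h (λ l → ∏ h (λ k → t 1 k l))
      ≡⟨ cong (JH h a ℤ.*_) (∏-symmetric (λ l k → t 1 k l) (λ l k → -ᵇ-isSign (congᵇ h (♯ k * ♯ l + 1) 0)) (λ l k → t-sym 1 k l)) ⟩
    JH h a ℤ.* roots⁻ 1 ∎
    where
    open ≡-Reasoning
    t : ℕ → Fin h → Fin h → ℤ
    t a k l = -ᵇ (congᵇ h (♯ k * ♯ l + a) 0)
    t-sym : ∀ a k l → t a k l ≡ t a l k
    t-sym a k l = cong (λ z → -ᵇ (congᵇ h (z + a) 0)) (*-comm (♯ k) (♯ l))
    a0 : ∀ {x} → Cong (odd h) x 0 → Cong (odd h) x (a * 0)
    a0 {x} = subst (Cong (odd h) x) (sym (*-zeroʳ a))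
    lem : ∀ a k l → a * (k * l + 1) ≡ k * (a * l) + a
    lem = solve-∀
    lem₂ : ∀ a k l → a * (k * l) ≡ k * (a * l)
    lem₂ = solve-∀
    col : ∀ l → ∏ h (λ k → t a k (absI h cop l)) ≡ gs h (a * ♯ l) ℤ.* ∏ h (λ k → t 1 k l)
    col l with absI h cop l | absI-spec h cop l
    ... | j | pos c = trans (∏-cong h (λ k → congᵇ-iff h {♯ k * ♯ j + a} {0} {♯ k * ♯ l + 1} {0}
                 (λ e → Cong-cancelˡ cop (a0 (Cong-trans (Cong-≡ (lem a (♯ k) (♯ l))) (Cong-trans (Cong-+ (Cong-*ˡ (♯ k) c) (Cong-refl {x = a})) e))))
                 (λ e → Cong-trans (Cong-+ (Cong-*ˡ (♯ k) (≈-sym c)) (Cong-refl {x = a})) (Cong-trans (Cong-≡ (sym (lem a (♯ k) (♯ l)))) (Cong-trans (Cong-*ˡ a e) (Cong-≡ (*-zeroʳ a)))))))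
               (sym (trans (cong (ℤ._* ∏ h (λ k → t 1 k l)) (gs-pos h {a * ♯ l} j c)) (ℤ.*-identityˡ _)))
    ... | j | neg c = trans (∏-cong h (λ k → congᵇ-iff h {♯ k * ♯ j + a} {0} {♯ k * ♯ l} {1} (f k) (g k)))
               (trans (inverse-pm l) (sym (cong (ℤ._* ∏ h (λ k → t 1 k l)) (gs-neg h {a * ♯ l} j c))))
      where
      kc : ∀ k → Cong (odd h) (♯ k * ♯ j + a * (♯ k * ♯ l)) 0
      kc k = Cong-trans (Cong-≡ (lem₃ (♯ k) (♯ j) a (♯ l))) (Cong-trans (Cong-*ˡ (♯ k) c) (Cong-≡ (*-zeroʳ (♯ k))))
        where
        lem₃ : ∀ k j a l → k * j + a * (k * l) ≡ k * (a * l + j)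
        lem₃ = solve-∀
      f : ∀ k → Cong (odd h) (♯ k * ♯ j + a) 0 → Cong (odd h) (♯ k * ♯ l) 1
      f k e = Cong-cancelˡ cop (Cong-+-cancelʳ (♯ k * ♯ j) (Cong-trans (Cong-≡ (+-comm (a * (♯ k * ♯ l)) (♯ k * ♯ j))) (Cong-trans (kc k)
                (Cong-trans (≈-sym e) (Cong-≡ (trans (+-comm (♯ k * ♯ j) a) (cong (_+ ♯ k * ♯ j) (sym (*-identityʳ a)))))))))
      g : ∀ k → Cong (odd h) (♯ k * ♯ l) 1 → Cong (odd h) (♯ k * ♯ j + a) 0
      g k e = Cong-trans (Cong-+ (Cong-refl {x = ♯ k * ♯ j}) (Cong-trans (Cong-≡ (sym (*-identityʳ a))) (Cong-*ˡ a (≈-sym e)))) (kc k)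

  roots⁻-roots : ∀ {a b} → Cong (odd h) (a + b) 0 → roots⁻ b ≡ roots a
  roots⁻-roots {a} {b} c = ∏-cong h (λ k → congᵇ-iff h {♯ k * ♯ k + b} {0} {♯ k * ♯ k} {a}
    (λ e → Cong-+-cancelʳ b (Cong-trans e (≈-sym c)))
    (λ e → Cong-trans (Cong-+ e (Cong-refl {x = b})) c))

  square-root-of-1 : ∀ t → suc t ≤ h → Cong (odd h) (suc t * suc t) 1 → t ≡ 0
  square-root-of-1 t t<h c = [ (λ d → ∣⇒≡0 t (≤-trans t<h (≤-trans (m≤m+n h h) (n≤1+n _))) d)
                             , (λ d → contradiction (∣⇒≤ d) (<⇒≱ (s≤s (≤-trans (s≤s t<h) (+-monoˡ-≤ h h≥1))))) ]′
                             (euclidsLemma t (2 + t) pr (Cong0⇒∣ c′))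
    where
    lem : ∀ t → t * (2 + t) + 1 ≡ suc t * suc t
    lem = solve-∀
    c′ : Cong (odd h) (t * (2 + t)) 0
    c′ = Cong-+-cancelʳ {odd h} {t * (2 + t)} {0} 1 (Cong-trans (Cong-≡ (lem t)) c)
    ∣⇒≡0 : ∀ t → t < odd h → odd h ∣ t → t ≡ 0
    ∣⇒≡0 zero    _ _ = refl
    ∣⇒≡0 (suc t) p d = contradiction (∣⇒≤ d) (<⇒≱ p)

  roots-1 : roots 1 ≡ -1ℤ
  roots-1 = trans (∏-single {h} root one others) (-ᵇ-yes (congᵇ-yes h {♯ one * ♯ one} {1} (Cong-≡ (trans (cong (_* ♯ one) ♯one) (trans (*-identityˡ (♯ one)) ♯one)))))
    where
    root : Fin h → ℤ
    root k = -ᵇ (congᵇ h (♯ k * ♯ k) 1)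
    others : ∀ j → j ≢ one → root j ≡ 1ℤ
    others j j≢ = -ᵇ-no (λ e → j≢ (♯-injective (trans (cong suc (square-root-of-1 (toℕ j) (♯≤ j) (congᵇ-sound h {♯ j * ♯ j} {1} e))) (sym ♯one))))

  -- This takes the place of Euler's criterion. The unknown `roots⁻ 1` is eliminated by applying
  -- `roots⁻-J` to -a and to -1: the symbol of -1 times `roots⁻ 1` is `roots 1`, which is -1 because
  -- 1 has a single square root in the half system.
  JH-roots : ∀ {a} → Coprime a (odd h) → roots a ≡ ℤ.- JH h a
  JH-roots {a} cop = begin
    roots a                                        ≡⟨ roots⁻-roots {a} {m1 * a} (∣⇒Cong0 (m∣m*n a)) ⟨
    roots⁻ (m1 * a)                                ≡⟨ roots⁻-J (cop-neg cop) ⟩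
    JH h (m1 * a) ℤ.* roots⁻ 1                     ≡⟨ cong (ℤ._* roots⁻ 1) (JH-* h m1 a) ⟩
    JH h m1 ℤ.* JH h a ℤ.* roots⁻ 1                ≡⟨ lem (JH h m1) (JH h a) (roots⁻ 1) ⟩
    JH h a ℤ.* (JH h m1 ℤ.* roots⁻ 1)              ≡⟨ cong (JH h a ℤ.*_) (roots⁻-J m1-cop) ⟨
    JH h a ℤ.* roots⁻ m1                           ≡⟨ cong (JH h a ℤ.*_) (trans (roots⁻-roots {1} {m1} (0 , 1 , refl)) roots-1) ⟩
    JH h a ℤ.* -1ℤ                                 ≡⟨ trans (ℤ.*-comm (JH h a) -1ℤ) (ℤ.-1*i≡-i _) ⟩
    ℤ.- JH h a                                     ∎
    where
    open ≡-Reasoning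
    m1 = h + h
    lem : ∀ x y z → x ℤ.* y ℤ.* z ≡ y ℤ.* (x ℤ.* z)
    lem = solve-∀ℤ
    m1-cop : Coprime m1 (odd h)
    m1-cop = coprime-∣ pr (λ d → <⇒≱ ≤-refl (∣⇒≤ {{>-nonZero (≤-trans h≥1 (m≤m+n h h))}} d))
    cop-neg : ∀ {a} → Coprime a (odd h) → Coprime (m1 * a) (odd h)
    cop-neg {a} c = coprime-∣ pr (λ d → case euclidsLemma m1 a pr d of λ where
      (inj₁ d) → ¬prime[1] (subst Prime (m1-cop (d , ∣-refl)) pr)
      (inj₂ d) → ¬prime[1] (subst Prime (c (d , ∣-refl)) pr))

any-true : ∀ {A : Set} {f : A → Bool} xs → any f xs ≡ true → ∃ λ x → x ∈ xs × f x ≡ true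
any-true {f = f} (x ∷ xs) e with f x in eq
... | true = x , here refl , eq
... | false = let (y , y∈ , ey) = any-true xs e in y , there y∈ , ey

any-false : ∀ {A : Set} {f : A → Bool} {x} xs → any f xs ≡ false → x ∈ xs → f x ≡ false
any-false {f = f} (x ∷ xs) e (here refl) with f x
... | false = refl
any-false {f = f} (x ∷ xs) e (there m) with f x
... | false = any-false xs e m

JH-legendre : ∀ h → Prime (odd h) → ∀ a → legendre a (odd h) ≡ JH h a
JH-legendre h pr a with (a % odd h) ≡ᵇ 0 in e₀
... | true = sym (JH-zero h (λ c → ¬prime[1] (subst Prime (c (m%n≡0⇒n∣m a (odd h) (≡ᵇ-sound e₀) , ∣-refl)) pr)))
... | false with isQRᵇ a (odd h) in e₁
...   | true with any-true (upTo (odd h)) e₁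
...     | k , _ , ek = sym (trans (JH-cong h {a} {k * k} (Cong-sym (%⇒Cong {odd h} {k * k} {a} (≡ᵇ-sound ek)))) (trans (JH-* h k k) (IsSign-square (JH-isSign h k-cop))))
  where
  a-cop : ¬ odd h ∣ a
  a-cop d = contradiction (trans (sym e₀) (≡ᵇ-yes {a % odd h} {0} (n∣m⇒m%n≡0 a (odd h) d))) λ ()
  k-cop : Coprime k (odd h)
  k-cop = coprime-∣ pr (λ d → a-cop (m%n≡0⇒n∣m a (odd h) (trans (sym (≡ᵇ-sound ek)) (n∣m⇒m%n≡0 (k * k) (odd h) (∣m⇒∣m*n k d)))))
JH-legendre h pr a | false | false = sym (trans (sym (ℤ.neg-involutive (JH h a))) (cong ℤ.-_ (trans (sym (JH-roots h pr a-cop)) (∏-ones {h} _ none))))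
  where
  a-cop : Coprime a (odd h)
  a-cop = coprime-∣ pr (λ d → contradiction (trans (sym e₀) (≡ᵇ-yes {a % odd h} {0} (n∣m⇒m%n≡0 a (odd h) d))) λ ())
  none : ∀ k → -ᵇ (congᵇ h (♯ k * ♯ k) a) ≡ 1ℤ
  none k = cong -ᵇ (any-false (upTo (odd h)) e₁ (∈-upTo⁺ (♯< k)))

record PrimeDivisor (n p : ℕ) : Set where
  constructor primeDivisor
  field
    isPrime : Prime p
    isDivisor : p ∣ n

-- Roughness records that 2, ..., k have failed, so the first hit is prime. The candidates end with
-- the number itself, hence the list cannot run out.
firstDivisor-prime : ∀ m len k (f : ℕ → ℕ) → (∀ x → f x ≡ k + x) → 1 ≤ k → k + len ≡ suc (suc m) → suc k Rough (suc (suc m)) →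
                     PrimeDivisor (suc (suc m)) (suc (firstDivisor (suc (suc m)) (suc m) (applyUpTo f len)))
firstDivisor-prime m zero k f fe 1≤k e r = contradiction (subst (_≤ suc (suc m)) (cong suc (trans (sym (+-identityʳ k)) e)) (rough⇒≤ r)) 1+n≰n
firstDivisor-prime m (suc len) k f fe 1≤k e r with (suc (suc m) % suc (f 0)) ≡ᵇ 0 in eq
... | true rewrite trans (fe 0) (+-identityʳ k) = primeDivisor (rough∧∣⇒prime {{n>1⇒nonTrivial (s≤s 1≤k)}} r d) d
  where
  d : suc k ∣ suc (suc m)
  d = m%n≡0⇒n∣m (suc (suc m)) (suc k) (≡ᵇ-sound eq)
... | false = firstDivisor-prime m len (suc k) (f ∘ suc) (λ x → trans (fe (suc x)) (+-suc k x)) (m≤n⇒m≤1+n 1≤k) (trans (sym (+-suc k len)) e)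
  (∤⇒rough-suc (λ d → contradiction (trans (sym eq) (≡ᵇ-yes {suc (suc m) % suc (f 0)} {0} (n∣m⇒m%n≡0 (suc (suc m)) (suc (f 0)) (subst (λ z → suc z ∣ suc (suc m)) (sym (trans (fe 0) (+-identityʳ k))) d)))) λ ()) r)

spf-prime : ∀ m → PrimeDivisor (suc (suc m)) (suc (spfPred m))
spf-prime m = firstDivisor-prime m (suc m) 1 suc (λ x → refl) (s≤s z≤n) refl 2-rough

J-legendre : ∀ {p} → IsOdd p → Prime p → ∀ a → legendre a p ≡ J a p
J-legendre (isOdd h) pr a = trans (JH-legendre h pr a) (sym (J-odd a h))

jacobiF-J : ∀ f a {n} → IsOdd n → n ≤ f → jacobiF f a n ≡ J a n
jacobiF-J zero a (isOdd h) ()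
jacobiF-J (suc f) a {suc zero} o le = refl
jacobiF-J (suc f) a {suc (suc m)} o le with spf-prime m
... | primeDivisor pr d = trans (cong₂ ℤ._*_ (J-legendre op pr a) (jacobiF-J f a oq (≤-trans (s≤s⁻¹ (m/n<m (suc (suc m)) p {{_}} {{_}} p>1)) (s≤s⁻¹ le))))
  (trans (sym (J-*ʳ a op oq)) (cong (J a) pq))
  where
  p = suc (spfPred m)
  pq : p * (suc (suc m) / p) ≡ suc (suc m)
  pq = m*[n/m]≡n d
  op : IsOdd p
  op = IsOdd-∣ d o
  oq : IsOdd (suc (suc m) / p)
  oq = IsOdd-∣ (divides p (sym pq)) o
  p>1 : 1 < p
  p>1 = nonTrivial⇒n>1 p {{prime⇒nonTrivial pr}}

kronecker-J : ∀ x {y} → IsOdd y → kronecker x y ≡ J x y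
kronecker-J x o = jacobiF-J _ x o ≤-refl

-- Membership in Ψ

prime-divisor : ∀ n → 2 ≤ n → ∃ λ p → Prime p × p ∣ n
prime-divisor (suc (suc m)) _ with spf-prime m
... | primeDivisor pr d = _ , pr , d
prime-divisor (suc zero) (s≤s ())

coprime-by-primes : ∀ {a b} → 0 < b → (∀ p → Prime p → p ∣ a → ¬ p ∣ b) → Coprime a b
coprime-by-primes {a} {b} b>0 h {zero} (_ , d∣b) = contradiction (0∣⇒≡0 d∣b) (>⇒≢ b>0)
coprime-by-primes {a} {b} b>0 h {suc zero} _ = refl
coprime-by-primes {a} {b} b>0 h {suc (suc d)} (d∣a , d∣b) with prime-divisor (suc (suc d)) (s≤s (s≤s z≤n))
... | p , pr , p∣ = contradiction (∣-trans p∣ d∣b) (h p pr (∣-trans p∣ d∣a))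

prime∤1 : ∀ {p} → Prime p → ¬ p ∣ 1
prime∤1 pr d = ¬prime[1] (subst Prime (∣1⇒≡1 d) pr)

-- Division by the gcd with d is repeated until it is 1. Besides `coprime-translate`, this supplies
-- the modulus A of `hyp-window` when s shares primes with t or p.
coprime-part : ∀ d x → 0 < x → ∃ λ j → Coprime j d × j ∣ x × (∀ p → Prime p → p ∣ x → p ∣ j ⊎ p ∣ d)
coprime-part d = <-rec (λ x → 0 < x → ∃ λ j → Coprime j d × j ∣ x × (∀ p → Prime p → p ∣ x → p ∣ j ⊎ p ∣ d)) step
  where
  step : ∀ x → (∀ {y} → y < x → 0 < y → ∃ λ j → Coprime j d × j ∣ y × (∀ p → Prime p → p ∣ y → p ∣ j ⊎ p ∣ d)) →
         0 < x → ∃ λ j → Coprime j d × j ∣ x × (∀ p → Prime p → p ∣ x → p ∣ j ⊎ p ∣ d)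
  step x rec x>0 with coprime? x d
  ... | yes c = x , c , ∣-refl , λ p _ p∣x → inj₁ p∣x
  ... | no ¬c with gcd[m,n]∣m x d
  ...   | divides q e = let (j , cj , j∣q , pj) = rec q<x q>0 in j , cj , ∣-trans j∣q (divides (gcd x d) (trans e (*-comm q (gcd x d)))) , λ p pr p∣x →
            case euclidsLemma q (gcd x d) pr (subst (p ∣_) e p∣x) of λ where
              (inj₁ p∣q) → pj p pr p∣q
              (inj₂ p∣g) → inj₂ (∣-trans p∣g (gcd[m,n]∣n x d))
    where
    q>0 : 0 < q
    q>0 = n≢0⇒n>0 (λ { refl → contradiction e (>⇒≢ x>0) })
    g≥2 : 2 ≤ gcd x d
    g≥2 with gcd x d in eg
    ... | zero = contradiction (trans e (*-zeroʳ q)) (>⇒≢ x>0)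
    ... | suc zero = contradiction (λ {i} (p , r) → ∣1⇒≡1 (subst (i ∣_) eg (gcd-greatest p r))) ¬c
    ... | suc (suc _) = s≤s (s≤s z≤n)
    q<x : q < x
    q<x = subst (q <_) (sym e) (m<m*n q (gcd x d) {{>-nonZero q>0}} g≥2)

-- Take for j the part of x prime to d: a prime of x dividing j does not divide d, and a prime of x
-- dividing d divides neither e nor j.
coprime-translate : ∀ d e x → Coprime d e → 0 < x → ∃ λ j → Coprime (d + e * j) x
coprime-translate d e x cde x>0 with coprime-part d x x>0
... | j , cj , _ , pj = j , coprime-by-primes x>0 λ p pr p∣s p∣x → case pj p pr p∣x of λ where
  (inj₁ p∣j) → prime∤1 pr (subst (p ∣_) (cj (p∣j , ∣m+n∣m⇒∣n (subst (p ∣_) (+-comm d (e * j)) p∣s) (∣n⇒∣m*n e p∣j))) ∣-refl)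
  (inj₂ p∣d) → case euclidsLemma e j pr (∣m+n∣m⇒∣n p∣s p∣d) of λ where
    (inj₁ p∣e) → prime∤1 pr (subst (p ∣_) (cde (p∣d , p∣e)) ∣-refl)
    (inj₂ p∣j) → prime∤1 pr (subst (p ∣_) (cj (p∣j , p∣d)) ∣-refl)

*-cancelˡ-sign : ∀ {s x y} → IsSign s → s ℤ.* x ≡ s ℤ.* y → x ≡ y
*-cancelˡ-sign {x = x} {y} (inj₁ refl) e = trans (sym (ℤ.*-identityˡ x)) (trans e (ℤ.*-identityˡ y))
*-cancelˡ-sign {x = x} {y} (inj₂ refl) e = ℤ.neg-injective (trans (sym (ℤ.-1*i≡-i x)) (trans e (ℤ.-1*i≡-i y)))

IsOdd-+even : ∀ {n} k → IsOdd n → IsOdd (n + (k + k))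
IsOdd-+even k (isOdd h) = subst IsOdd (lem h k) (isOdd (h + k))
  where
  lem : ∀ h k → suc (h + k + (h + k)) ≡ suc (h + h) + (k + k)
  lem = solve-∀

record Γ (a b c d : ℕ) : Set where
  field
    c₄  : ℕ
    c≡  : c ≡ 4 * c₄
    d≡1 : d % 4 ≡ 1
    det : a * d ≡ b * c + 1

  d-odd : IsOdd d
  d-odd = 1mod4⇒IsOdd d≡1

  coprime-d-4b : Coprime d (4 * b)
  coprime-d-4b {i} (i∣d , i∣4b) = ∣1⇒≡1 (∣m+n∣m⇒∣n (subst (i ∣_) det (∣n⇒∣m*n a i∣d)) (subst (i ∣_) (trans (lem b c₄) (cong (b *_) (sym c≡))) (∣m⇒∣m*n c₄ i∣4b)))
    where
    lem : ∀ b c → 4 * b * c ≡ b * (4 * c)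
    lem = solve-∀

  Y-odd : ∀ x {y} → IsOdd y → IsOdd (c * x + d * y)
  Y-odd x {y} oy = subst IsOdd (trans (lem (d * y) c₄ x) (cong (λ c → c * x + d * y) (sym c≡))) (IsOdd-+even (c₄ * x + c₄ * x) (IsOdd-* d-odd oy))
    where
    lem : ∀ z c x → z + ((c * x + c * x) + (c * x + c * x)) ≡ 4 * c * x + z
    lem = solve-∀

  -- Since 4 divides c, the determinant gives a d ≡ 1 (mod 4 b). Hence J b a and J b d agree, and
  -- the condition can be moved between a and d.
  J-b-ad : J b (a * d) ≡ 1ℤ
  J-b-ad = J-period b (subst IsOdd (sym det) (subst IsOdd (trans (lem b c₄) (cong (λ c → b * c + 1) (sym c≡))) (IsOdd-+even (b * c₄ + b * c₄) (isOdd 0)))) (isOdd 0)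
    (0 , c₄ , trans (+-identityʳ (a * d)) (trans det (trans (cong (λ c → b * c + 1) c≡) (lem₂ b c₄))))
    where
    lem : ∀ b c → 1 + ((b * c + b * c) + (b * c + b * c)) ≡ b * (4 * c) + 1
    lem = solve-∀
    lem₂ : ∀ b c → b * (4 * c) + 1 ≡ 1 + c * (4 * b)
    lem₂ = solve-∀

  -- d X = x + b Y and Y ≡ d y (mod 4 x) turn both symbols into products over d.
  equivariant-coprime : J b d ≡ 1ℤ → ∀ x {y} → IsOdd y → Coprime d x → J x y ≡ J (a * x + b * y) (c * x + d * y)
  equivariant-coprime Jbd x {y} oy cop = *-cancelˡ-sign (J-isSign d-odd (coprime-sym cop)) (begin
    J x d ℤ.* J x y         ≡⟨ J-*ʳ x d-odd oy ⟨
    J x (d * y)             ≡⟨ J-period x oY (IsOdd-* d-odd oy) (0 , c₄ , trans (+-identityʳ Y) (trans (cong (λ c → c * x + d * y) c≡) (lem (d * y) c₄ x))) ⟨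
    J x Y                   ≡⟨ J-cong oY (0 , b , trans (+-identityʳ (d * X)) dX) ⟨
    J (d * X) Y             ≡⟨ J-*ˡ d X Y ⟩
    J d Y ℤ.* J X Y         ≡⟨ cong (ℤ._* J X Y) (trans (J-recip d-odd oY (inj₁ d≡1)) JYd) ⟩
    J x d ℤ.* J X Y         ∎)
    where
    open ≡-Reasoning
    X = a * x + b * y
    Y = c * x + d * y
    oY = Y-odd x oy
    lem : ∀ z c x → 4 * c * x + z ≡ z + c * (4 * x)
    lem = solve-∀
    dX : d * X ≡ x + b * Y
    dX = trans (lem₁ a b d x y) (trans (cong (λ z → z * x + d * b * y) det) (lem₂ b c d x y))
      where
      lem₁ : ∀ a b d x y → d * (a * x + b * y) ≡ a * d * x + d * b * y
      lem₁ = solve-∀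
      lem₂ : ∀ b c d x y → (b * c + 1) * x + d * b * y ≡ x + b * (c * x + d * y)
      lem₂ = solve-∀
    -- Here b Y ≡ -x modulo d, and the sign is harmless because d ≡ 1 (mod 4).
    JYd : J Y d ≡ J x d
    JYd = begin
      J Y d             ≡⟨ ℤ.*-identityˡ _ ⟨
      1ℤ ℤ.* J Y d      ≡⟨ cong (ℤ._* J Y d) Jbd ⟨
      J b d ℤ.* J Y d   ≡⟨ J-*ˡ b Y d ⟨
      J (b * Y) d       ≡⟨ J-neg⁺ {x} {b * Y} d-odd d≡1 (∣⇒Cong0 (subst (d ∣_) dX (m∣m*n X))) ⟩
      J x d             ∎

  J-b-d : IsOdd a → J b a ≡ 1ℤ → J b d ≡ 1ℤ
  J-b-d oa Jba = trans (sym (ℤ.*-identityˡ (J b d))) (trans (cong (ℤ._* J b d) (sym Jba)) (trans (sym (J-*ʳ b oa d-odd)) J-b-ad))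

-- Left multiplication by a lower triangular matrix with entry 4 j: X is kept and Y grows by 4 j X,
-- a period of `J X`.
Γ-translate : ∀ {a b c d} j → Γ a b c d → Γ a b (c + 4 * a * j) (d + 4 * b * j)
Γ-translate {a} {b} {c} {d} j γ = record
  { c₄  = c₄ + a * j
  ; c≡  = trans (cong (_+ 4 * a * j) c≡) (lem₁ c₄ a j)
  ; d≡1 = trans (Cong⇒% {4} {d + 4 * b * j} {d} (0 , b * j , lem₂ d b j)) d≡1
  ; det = trans (*-distribˡ-+ a d (4 * b * j)) (trans (cong (_+ a * (4 * b * j)) det) (lem₃ a b c j))
  }
  where
  open Γ γ
  lem₁ : ∀ c a j → 4 * c + 4 * a * j ≡ 4 * (c + a * j)
  lem₁ = solve-∀
  lem₂ : ∀ d b j → d + 4 * b * j + 0 ≡ d + b * j * 4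
  lem₂ = solve-∀
  lem₃ : ∀ a b c j → b * c + 1 + a * (4 * b * j) ≡ b * (c + 4 * a * j) + 1
  lem₃ = solve-∀

-- For x > 0 a translation makes d prime to x, as `equivariant-coprime` demands. For x = 0 no
-- translation helps: y = 1 amounts to J b d = 1, and a larger y divides both coordinates on either
-- side, so both symbols vanish.
equivariant : ∀ {a b c d} → IsOdd a → Γ a b c d → J b a ≡ 1ℤ → ∀ x y → IsOdd y → J x y ≡ J (a * x + b * y) (c * x + d * y)
equivariant {a} {b} {c} {d} oa γ Jba zero (suc zero) oy = sym (trans (cong₂ J (lem a b) (lem c d)) (Γ.J-b-d γ oa Jba))
  where
  lem : ∀ a b → a * 0 + b * 1 ≡ b
  lem = solve-∀
equivariant {a} {b} {c} {d} oa γ Jba zero y@(suc (suc _)) oy = trans (J-zero oy (λ cop → contradiction (cop (y ∣0 , ∣-refl)) λ ()))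
  (sym (J-zero (Γ.Y-odd γ 0 oy) (λ cop → contradiction (cop (∣m∣n⇒∣m+n (∣n⇒∣m*n a (y ∣0)) (n∣m*n b) , ∣m∣n⇒∣m+n (∣n⇒∣m*n c (y ∣0)) (n∣m*n d))) λ ())))
equivariant {a} {b} {c} {d} oa γ Jba x@(suc _) y oy with coprime-translate d (4 * b) x (Γ.coprime-d-4b γ) (s≤s z≤n)
... | j , cop = trans (Γ.equivariant-coprime γ′ (Γ.J-b-d γ′ oa Jba) x oy cop)
    (J-period X (Γ.Y-odd γ′ x oy) (Γ.Y-odd γ x oy) (0 , j , lem a b c d j x y))
  where
  γ′ = Γ-translate j γ
  X = a * x + b * y
  lem : ∀ a b c d j x y → (c + 4 * a * j) * x + (d + 4 * b * j) * y + 0 ≡ c * x + d * y + j * (4 * (a * x + b * y))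
  lem = solve-∀

Γ⇒Ψ : ∀ {a b c d} → a % 4 ≡ 1 → Γ a b c d → J b a ≡ 1ℤ → InΨ a b c d
Γ⇒Ψ {a} {b} {c} {d} a≡1 γ Jba = record
  { inΓ  = record { det = det ; a≡1 = a≡1 ; d≡1 = d≡1 ; c≡0 = trans (%-congˡ {o = 4} (trans c≡ (*-comm 4 c₄))) (m*n%n≡0 c₄ 4) }
  ; kron = λ x y oy → let oy′ = Odd⇒IsOdd y oy in
      trans (kronecker-J x oy′) (trans (equivariant (1mod4⇒IsOdd a≡1) γ Jba x y oy′) (sym (kronecker-J (a * x + b * y) (Y-odd x oy′))))
  }
  where open Γ γ

inverse-mod : ∀ a n → 2 ≤ n → Coprime a n → ∃₂ λ d c → a * d ≡ n * c + 1
inverse-mod a n 2≤n cop with coprime-Bézout cop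
... | Bézout.+- x y e = x , y , trans (*-comm a x) (trans (sym e) (lem y n))
  where
  lem : ∀ y n → 1 + y * n ≡ n * y + 1
  lem = solve-∀
... | Bézout.-+ x y e with x * a in eq
...   | zero = contradiction (∣1⇒≡1 (divides y e)) (>⇒≢ 2≤n)
-- Here x a ≡ -1, so x (x a) is the inverse.
...   | suc t = x * suc t , y * t , trans (lem₀ a x (suc t)) (trans (cong (_* suc t) eq) (trans (lem t) (trans (cong (λ z → z * t + 1) e) (cong (_+ 1) (lem₂ y n t)))))
  where
  lem₀ : ∀ a x t → a * (x * t) ≡ x * a * t
  lem₀ = solve-∀
  lem : ∀ t → suc t * suc t ≡ (1 + suc t) * t + 1
  lem = solve-∀
  lem₂ : ∀ y n t → y * n * t ≡ n * (y * t)
  lem₂ = solve-∀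

coprime-4* : ∀ {a b} → IsOdd a → Coprime a b → 0 < b → Coprime a (4 * b)
coprime-4* {a} {b} oa cop b>0 = coprime-by-primes (≤-trans b>0 (m≤n*m b 4)) λ p pr p∣a p∣4b →
  case euclidsLemma 4 b pr p∣4b of λ where
    (inj₂ p∣b) → prime∤1 pr (subst (p ∣_) (cop (p∣a , p∣b)) ∣-refl)
    (inj₁ p∣4) → case euclidsLemma 2 2 pr p∣4 of λ where
      (inj₁ p∣2) → two p pr p∣a p∣2
      (inj₂ p∣2) → two p pr p∣a p∣2
  where
  two : ∀ p → Prime p → p ∣ a → p ∣ 2 → ⊥
  two p pr p∣a p∣2 with prime⇒irreducible prime[2] p∣2
  ... | inj₁ refl = ¬prime[1] pr
  ... | inj₂ refl = contradiction (IsOdd-∣ p∣a oa) (¬IsOdd-double 1)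

-- An inverse d of a modulo 4 b completes the row (a, b), and d ≡ 1 (mod 4) is inherited from a. For
-- b = 0 the value J 0 a = 1 forces a = 1, leaving the identity matrix.
numerator : ∀ a b → a % 4 ≡ 1 → J b a ≡ 1ℤ → IsNumerator (2 * a + 3 * b)
numerator a zero a≡1 Jba = a , 0 , 0 , 1 , Γ⇒Ψ a≡1 (record { c₄ = 0 ; c≡ = refl ; d≡1 = refl ; det = trans (*-identityʳ a) a1 }) Jba , refl
  where
  a1 : a ≡ 1
  a1 = J-coprime {0} (1mod4⇒IsOdd a≡1) (inj₁ Jba) (a ∣0 , ∣-refl)
numerator a b@(suc _) a≡1 Jba with inverse-mod a (4 * b) (≤-trans (s≤s (s≤s z≤n)) (*-monoʳ-≤ 4 (s≤s {0} z≤n))) (coprime-4* oa (coprime-sym (J-coprime oa (inj₁ Jba))) (s≤s z≤n))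
  where oa = 1mod4⇒IsOdd a≡1
... | d , c , e = a , b , 4 * c , d , Γ⇒Ψ a≡1 (record { c₄ = c ; c≡ = refl ; d≡1 = Cong⇒% d≡1 ; det = trans e (cong (_+ 1) (lem b c)) }) Jba , refl
  where
  lem : ∀ b c → 4 * b * c ≡ b * (4 * c)
  lem = solve-∀
  lem₂ : ∀ b c → 4 * b * c + 1 + 0 ≡ 1 + b * c * 4
  lem₂ = solve-∀
  d≡1 : Cong 4 d 1
  d≡1 = Cong-trans (Cong-≡ (sym (*-identityˡ d))) (Cong-trans (Cong-* (Cong-sym (%⇒Cong {4} {a} {1} a≡1)) (Cong-refl {x = d})) (Cong-trans (Cong-≡ e) (0 , b * c , lem₂ b c)))

Ψ⇒Γ : ∀ {a b c d} → InΨ a b c d → Γ a b c d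
Ψ⇒Γ {a} {b} {c} {d} ψ = record { c₄ = c / 4 ; c≡ = trans (%⇒≡ c 4 0 c≡0) (*-comm (c / 4) 4) ; d≡1 = d≡1 ; det = det }
  where
  open InΨ ψ
  open InΓ₁4≥0 inΓ

-- The vector (0, 1) decides: there equivariance reads 1 = J b d, and `J-b-ad` carries this over to
-- a.
Ψ⇒J : ∀ {a b c d} → InΨ a b c d → J b a ≡ 1ℤ
Ψ⇒J {a} {b} {c} {d} ψ = trans (sym (ℤ.*-identityʳ (J b a))) (trans (cong (J b a ℤ.*_) (sym Jbd)) (trans (sym (J-*ʳ b (1mod4⇒IsOdd {a} a≡1) (Γ.d-odd γ))) (Γ.J-b-ad γ)))
  where
  open InΨ ψ
  open InΓ₁4≥0 inΓ
  γ = Ψ⇒Γ ψ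
  lem : ∀ a b → a * 0 + b * 1 ≡ b
  lem = solve-∀
  Jbd : J b d ≡ 1ℤ
  Jbd = trans (sym (kronecker-J b (Γ.d-odd γ))) (trans (cong₂ kronecker (sym (lem a b)) (sym (lem c d))) (sym (kron 0 1 refl)))

square-not-numerator : ∀ m → IsPerfectSquare m → ¬ IsNumerator m
square-not-numerator m (k , m≡) (a , b , c , d , ψ , e) = square≢-1 (J k Y) (trans (sym (J-*ˡ k k Y)) (trans (sym (kronecker-J (k * k) oY)) (trans (cong (λ z → kronecker z Y) (trans (sym m≡) (trans (sym e) (lem a b)))) (sym (InΨ.kron ψ 2 3 refl)))))
  where
  Y = c * 2 + d * 3
  oY : IsOdd Y
  oY = Γ.Y-odd (Ψ⇒Γ ψ) 2 (isOdd 1)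
  lem : ∀ a b → 2 * a + 3 * b ≡ a * 2 + b * 3
  lem = solve-∀
  square≢-1 : ∀ z → z ℤ.* z ≢ -1ℤ
  square≢-1 (ℤ.+ zero) ()
  square≢-1 (ℤ.+ suc n) ()
  square≢-1 (ℤ.-[1+ n ]) ()

-- A fast certificate check for values of J

-- The binary Jacobi algorithm with fuel; s is the sign still expected, `true` standing for -1.
-- Exhausted fuel and a common factor both answer `false`, so a positive answer is always a
-- certificate.
isJ : ℕ → Bool → ℕ → ℕ → Bool
isJ-step : ℕ → Bool → ℕ → ℕ → ℕ → Bool
isJ zero    s a       n = false
isJ (suc f) s zero    n = (n ≡ᵇ 1) ∧ not s
isJ (suc f) s (suc a) n = isJ-step f s (suc a % 2) a n
isJ-step f s zero    a n = isJ f (s xor ((n % 8 ≡ᵇ 3) ∨ (n % 8 ≡ᵇ 5))) (suc a / 2) n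
isJ-step f s (suc _) a n = isJ f (s xor ((n % 4 ≡ᵇ 3) ∧ (suc a % 4 ≡ᵇ 3))) (n % suc a) (suc a)

-ᵇ-xor : ∀ p q → -ᵇ q ℤ.* -ᵇ (p xor q) ≡ -ᵇ p
-ᵇ-xor true  true  = refl
-ᵇ-xor true  false = refl
-ᵇ-xor false true  = refl
-ᵇ-xor false false = refl

data Mod8 : ℕ → Set where
  mod1 : Mod8 1
  mod3 : Mod8 3
  mod5 : Mod8 5
  mod7 : Mod8 7

odd-%8 : ∀ r q → IsOdd (r + q * 8) → IsOdd r
odd-%8 r q o with parity r
... | oddP k = isOdd k
... | evenP k = contradiction (subst IsOdd (lem k q) o) (¬IsOdd-double (k + q * 4))
  where
  lem : ∀ k q → k + k + q * 8 ≡ k + q * 4 + (k + q * 4)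
  lem = solve-∀

mod8 : ∀ {n} → IsOdd n → Mod8 (n % 8)
mod8 {n} o with n % 8 | m%n<n n 8 | odd-%8 (n % 8) (n / 8) (subst IsOdd (m≡m%n+[m/n]*n n 8) o)
... | 0 | _ | o′ = contradiction o′ (¬IsOdd-double 0)
... | 1 | _ | _ = mod1
... | 2 | _ | o′ = contradiction o′ (¬IsOdd-double 1)
... | 3 | _ | _ = mod3
... | 4 | _ | o′ = contradiction o′ (¬IsOdd-double 2)
... | 5 | _ | _ = mod5
... | 6 | _ | o′ = contradiction o′ (¬IsOdd-double 3)
... | 7 | _ | _ = mod7
... | suc (suc (suc (suc (suc (suc (suc (suc r))))))) | s≤s (s≤s (s≤s (s≤s (s≤s (s≤s (s≤s (s≤s ()))))))) | _

J-2-ᵇ : ∀ {n} → IsOdd n → J 2 n ≡ -ᵇ ((n % 8 ≡ᵇ 3) ∨ (n % 8 ≡ᵇ 5))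
J-2-ᵇ {n} o = trans (J-2 o) (tbl (mod8 o))
  where
  tbl : ∀ {r} → Mod8 r → J2 r ≡ -ᵇ ((r ≡ᵇ 3) ∨ (r ≡ᵇ 5))
  tbl mod1 = refl
  tbl mod3 = refl
  tbl mod5 = refl
  tbl mod7 = refl

J-recip-ᵇ : ∀ {m n} → IsOdd m → IsOdd n → J m n ≡ -ᵇ ((n % 4 ≡ᵇ 3) ∧ (m % 4 ≡ᵇ 3)) ℤ.* J n m
J-recip-ᵇ {m} {n} om on with odd%4 om | odd%4 on
... | inj₁ p | inj₁ q rewrite p | q = trans (J-recip om on (inj₁ p)) (sym (ℤ.*-identityˡ _))
... | inj₁ p | inj₂ q rewrite p | q = trans (J-recip om on (inj₁ p)) (sym (ℤ.*-identityˡ _))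
... | inj₂ p | inj₁ q rewrite p | q = trans (J-recip om on (inj₂ q)) (sym (ℤ.*-identityˡ _))
... | inj₂ p | inj₂ q rewrite p | q = trans (J-recip⁻ om on p q) (sym (ℤ.-1*i≡-i _))

∧-true : ∀ {p q} → (p ∧ q) ≡ true → p ≡ true × q ≡ true
∧-true {true} {true} _ = refl , refl

isJ-sound : ∀ f s a {n} → IsOdd n → isJ f s a n ≡ true → J a n ≡ -ᵇ s
isJ-step-sound : ∀ f s r a {n} → suc a % 2 ≡ r → IsOdd n → isJ-step f s r a n ≡ true → J (suc a) n ≡ -ᵇ s
isJ-sound (suc f) s zero {n} o e with ∧-true {n ≡ᵇ 1} e
isJ-sound (suc f) false zero {n} o e | p , q with ≡ᵇ-sound {n} {1} p
... | refl = refl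
isJ-sound (suc f) s (suc a) o e = isJ-step-sound f s (suc a % 2) a refl o e
isJ-step-sound f s zero a {n} r o e = begin
  J (suc a) n                    ≡⟨ cong (λ z → J z n) (trans (%⇒≡ (suc a) 2 0 r) (*-comm (suc a / 2) 2)) ⟩
  J (2 * (suc a / 2)) n          ≡⟨ J-*ˡ 2 (suc a / 2) n ⟩
  J 2 n ℤ.* J (suc a / 2) n      ≡⟨ cong₂ ℤ._*_ (J-2-ᵇ o) (isJ-sound f (s xor t) (suc a / 2) o e) ⟩
  -ᵇ t ℤ.* -ᵇ (s xor t)          ≡⟨ -ᵇ-xor s t ⟩
  -ᵇ s                           ∎
  where
  open ≡-Reasoning
  t = (n % 8 ≡ᵇ 3) ∨ (n % 8 ≡ᵇ 5)
isJ-step-sound f s (suc zero) a {n} r o e = begin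
  J (suc a) n                    ≡⟨ J-recip-ᵇ oa o ⟩
  -ᵇ t ℤ.* J n (suc a)           ≡⟨ cong (-ᵇ t ℤ.*_) (J-cong oa (Cong-sym (Cong-% n (suc a)))) ⟩
  -ᵇ t ℤ.* J (n % suc a) (suc a) ≡⟨ cong (-ᵇ t ℤ.*_) (isJ-sound f (s xor t) (n % suc a) oa e) ⟩
  -ᵇ t ℤ.* -ᵇ (s xor t)          ≡⟨ -ᵇ-xor s t ⟩
  -ᵇ s                           ∎
  where
  open ≡-Reasoning
  oa : IsOdd (suc a)
  oa = Odd⇒IsOdd (suc a) r
  t = (n % 4 ≡ᵇ 3) ∧ (suc a % 4 ≡ᵇ 3)
isJ-step-sound f s (suc (suc r)) a {n} e o _ = contradiction (m%n<n (suc a) 2) (≤⇒≯ (subst (2 ≤_) (sym e) (s≤s (s≤s z≤n))))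

-- The exceptional integers

isOne : ℤ → Bool
isOne (ℤ.+ 1) = true
isOne _       = false

-- Here b determines a = (m - 3 b) / 2, and the first test rejects rounding and truncation. The
-- search range 40 comes from 3 b ≤ 115 < 3 · 40.
hasPair : ℕ → ℕ → Bool
hasPair m b = (2 * ((m ∸ 3 * b) / 2) + 3 * b ≡ᵇ m) ∧ (((m ∸ 3 * b) / 2) % 4 ≡ᵇ 1) ∧ isOne (J b ((m ∸ 3 * b) / 2))

no-pair : ∀ m → any (hasPair m) (upTo 40) ≡ false → m ≤ 115 → ¬ IsNumerator m
no-pair m chk m≤ (a , b , c , d , ψ , e) = contradiction (trans (sym pair) (any-false {f = hasPair m} (upTo 40) chk (∈-upTo⁺ b<40))) λ ()
  where
  3b≤m : 3 * b ≤ m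
  3b≤m = subst (3 * b ≤_) e (m≤n+m (3 * b) (2 * a))
  b<40 : b < 40
  b<40 = s≤s (*-cancelˡ-≤ 3 (≤-trans 3b≤m (≤-trans m≤ (m≤m+n 115 2))))
  a≡ : (m ∸ 3 * b) / 2 ≡ a
  a≡ = trans (/-congˡ {o = 2} (trans (cong (_∸ 3 * b) (sym e)) (trans (m+n∸n≡m (2 * a) (3 * b)) (*-comm 2 a)))) (m*n/n≡m a 2)
  pair : hasPair m b ≡ true
  pair rewrite a≡ = cong₂ _∧_ (≡ᵇ-yes e) (cong₂ _∧_ (≡ᵇ-yes {a % 4} {1} (InΓ₁4≥0.a≡1 (InΨ.inΓ ψ))) (cong isOne (Ψ⇒J ψ)))

exceptional-not-numerator : ∀ m → m ∈ exceptional → ¬ IsNumerator m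
exceptional-not-numerator m (here refl) = no-pair 3 refl (≤ᵇ⇒≤ 3 115 _)
exceptional-not-numerator m (there (here refl)) = no-pair 6 refl (≤ᵇ⇒≤ 6 115 _)
exceptional-not-numerator m (there (there (here refl))) = no-pair 7 refl (≤ᵇ⇒≤ 7 115 _)
exceptional-not-numerator m (there (there (there (here refl)))) = no-pair 10 refl (≤ᵇ⇒≤ 10 115 _)
exceptional-not-numerator m (there (there (there (there (here refl))))) = no-pair 12 refl (≤ᵇ⇒≤ 12 115 _)
exceptional-not-numerator m (there (there (there (there (there (here refl)))))) = no-pair 15 refl (≤ᵇ⇒≤ 15 115 _)
exceptional-not-numerator m (there (there (there (there (there (there (here refl))))))) = no-pair 18 refl (≤ᵇ⇒≤ 18 115 _)
exceptional-not-numerator m (there (there (there (there (there (there (there (here refl)))))))) = no-pair 19 refl (≤ᵇ⇒≤ 19 115 _)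
exceptional-not-numerator m (there (there (there (there (there (there (there (there (here refl))))))))) = no-pair 27 refl (≤ᵇ⇒≤ 27 115 _)
exceptional-not-numerator m (there (there (there (there (there (there (there (there (there (here refl)))))))))) = no-pair 31 refl (≤ᵇ⇒≤ 31 115 _)
exceptional-not-numerator m (there (there (there (there (there (there (there (there (there (there (here refl))))))))))) = no-pair 34 refl (≤ᵇ⇒≤ 34 115 _)
exceptional-not-numerator m (there (there (there (there (there (there (there (there (there (there (there (here refl)))))))))))) = no-pair 55 refl (≤ᵇ⇒≤ 55 115 _)
exceptional-not-numerator m (there (there (there (there (there (there (there (there (there (there (there (there (here refl))))))))))))) = no-pair 63 refl (≤ᵇ⇒≤ 63 115 _)
exceptional-not-numerator m (there (there (there (there (there (there (there (there (there (there (there (there (there (here refl)))))))))))))) = no-pair 99 refl (≤ᵇ⇒≤ 99 115 _)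
exceptional-not-numerator m (there (there (there (there (there (there (there (there (there (there (there (there (there (there (here refl))))))))))))))) = no-pair 115 refl (≤ᵇ⇒≤ 115 115 _)

-- Reduction to small solutions of J b n = ± 1

-- From n ≡ 2 a (mod b) and reciprocity, J b a = J 2 b · J n b. With b ≡ 3 n + 2 (mod 8), both J 2 b
-- and the sign between J n b and J b n depend on n mod 8 alone; together they ask for J b n = 1
-- when n ≡ 3 and for -1 when n ≡ 1 or 7. The class 5 is settled by b = 1.
PSign : ℕ → ℤ
PSign 3 = 1ℤ
PSign _ = -1ℤ

-- A solution b gives a pair with 2 a + 3 b′ = n, 4 n and 16 · 4 ^ f · n respectively (b′ = b in the first case, b′ = 2 b in the others).
PSol QSol RSol : ℕ → Set
PSol n = ∃ λ b → b % 8 ≡ (3 * n + 2) % 8 × 3 * b ≤ n × J b n ≡ PSign (n % 8)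
QSol n = ∃ λ b → b % 4 ≡ 3 × 3 * b ≤ 2 * n × J b n ≡ -1ℤ
RSol n = ∃ λ b → b % 4 ≡ 1 × 3 * b ≤ 8 * n × J b n ≡ -1ℤ

numerator′ : ∀ {m} a b → a % 4 ≡ 1 → J b a ≡ 1ℤ → 2 * a + 3 * b ≡ m → IsNumerator m
numerator′ a b a≡1 Jba refl = numerator a b a≡1 Jba

[1+4q]%4 : ∀ q → (1 + q * 4) % 4 ≡ 1
[1+4q]%4 q = [m+kn]%n≡m%n 1 q 4

J-4 : ∀ {n} → IsOdd n → J 4 n ≡ 1ℤ
J-4 {n} o = trans (J-*ˡ 2 2 n) (trans (cong₂ ℤ._*_ (J-2-ᵇ o) (J-2-ᵇ o)) (IsSign-square (-ᵇ-isSign ((n % 8 ≡ᵇ 3) ∨ (n % 8 ≡ᵇ 5)))))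

J-4^ : ∀ f x {n} → IsOdd n → J (4 ^ f * x) n ≡ J x n
J-4^ zero    x {n} o = cong (λ z → J z n) (+-identityʳ x)
J-4^ (suc f) x {n} o = begin
  J (4 * 4 ^ f * x) n         ≡⟨ cong (λ z → J z n) (*-assoc 4 (4 ^ f) x) ⟩
  J (4 * (4 ^ f * x)) n       ≡⟨ J-*ˡ 4 (4 ^ f * x) n ⟩
  J 4 n ℤ.* J (4 ^ f * x) n   ≡⟨ cong₂ ℤ._*_ (J-4 o) (J-4^ f x o) ⟩
  1ℤ ℤ.* J x n                ≡⟨ ℤ.*-identityˡ _ ⟩
  J x n                       ∎
  where open ≡-Reasoning

-- A power of 4 has symbol 1 for every odd a, so b = 1, 4, 16 settle the classes 5, 6, 2 modulo 8.
-- For m ≡ 8 (mod 16), b = 2 forces a ≡ 1 (mod 8), where 2 has symbol 1.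
numerator-5mod8 : ∀ q → IsNumerator (5 + q * 8)
numerator-5mod8 q = numerator′ (1 + q * 4) 1 ([1+4q]%4 q) (J-1 (1mod4⇒IsOdd {1 + q * 4} ([1+4q]%4 q))) (lem q)
  where
  lem : ∀ q → 2 * (1 + q * 4) + 3 * 1 ≡ 5 + q * 8
  lem = solve-∀

numerator-6mod8 : ∀ q → IsNumerator (14 + q * 8)
numerator-6mod8 q = numerator′ (1 + q * 4) 4 ([1+4q]%4 q) (J-4 (1mod4⇒IsOdd {1 + q * 4} ([1+4q]%4 q))) (lem q)
  where
  lem : ∀ q → 2 * (1 + q * 4) + 3 * 4 ≡ 14 + q * 8
  lem = solve-∀

numerator-2mod8 : ∀ q → IsNumerator (50 + q * 8)
numerator-2mod8 q = numerator′ (1 + q * 4) 16 ([1+4q]%4 q) (trans (J-4^ 2 1 o) (J-1 o)) (lem q)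
  where
  o = 1mod4⇒IsOdd {1 + q * 4} ([1+4q]%4 q)
  lem : ∀ q → 2 * (1 + q * 4) + 3 * 16 ≡ 50 + q * 8
  lem = solve-∀

numerator-8mod16 : ∀ q → IsNumerator (8 + q * 16)
numerator-8mod16 q = numerator′ (1 + q * 8) 2 (trans (%-congˡ {o = 4} (lem₁ q)) ([1+4q]%4 (q * 2))) (trans (J-2 (subst IsOdd (lem₂ q) (isOdd (q * 4)))) (cong J2 ([m+kn]%n≡m%n 1 q 8))) (lem q)
  where
  lem : ∀ q → 2 * (1 + q * 8) + 3 * 2 ≡ 8 + q * 16
  lem = solve-∀
  lem₁ : ∀ q → 1 + q * 8 ≡ 1 + q * 2 * 4
  lem₁ = solve-∀
  lem₂ : ∀ q → suc (q * 4 + q * 4) ≡ 1 + q * 8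
  lem₂ = solve-∀

%8⇒%4 : ∀ {n r} → n % 8 ≡ r → n % 4 ≡ r % 4
%8⇒%4 {n} {r} e = trans (sym (m∣n⇒o%n%m≡o%m 4 8 n (divides 2 refl))) (cong (_% 4) e)

-- a ≡ 5 s + t (mod 8) because 3 s + 5 s ≡ 0
solve-mod8 : ∀ {a b t s} → Cong 8 (a + 3 * b) t → b % 8 ≡ s → a % 8 ≡ (t + 5 * s) % 8
solve-mod8 {a} {b} {t} {s} c e = Cong⇒% (Cong-trans {y = a + 3 * b + 5 * b} (b , 0 , lem a b) (Cong-+ c (Cong-*ˡ 5 cb)))
  where
  lem : ∀ a b → a + b * 8 ≡ a + 3 * b + 5 * b + 0
  lem = solve-∀
  cb : Cong 8 b s
  cb = Cong-sym (subst (λ z → Cong 8 z b) e (Cong-% b 8))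

numerator-odd : ∀ {n} → IsOdd n → n % 8 ≢ 5 → PSol n → IsNumerator n
numerator-odd {n} on n≢5 (b , b≡ , 3b≤n , Jb) = numerator′ a b a≡1 Jba (trans (cong (_+ 3 * b) 2a) (m∸n+n≡m 3b≤n))
  where
  b≡n : Cong 8 b (3 * n + 2)
  b≡n = %⇒Cong b≡
  d : ℕ
  d = n ∸ 3 * b
  -- The class of b is chosen so that n - 3 b ≡ -8 n - 6 ≡ 2 (mod 8), which is 2 a with a ≡ 1 (mod
  -- 4).
  d≡ : Cong 8 d 2
  d≡ = Cong-+-cancelʳ (3 * b) (Cong-trans (Cong-≡ (m∸n+n≡m 3b≤n)) (Cong-sym (Cong-trans (Cong-+ (Cong-refl {x = 2}) (Cong-*ˡ 3 b≡n)) (0 , n + 1 , lem n))))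
    where
    lem : ∀ n → 2 + 3 * (3 * n + 2) + 0 ≡ n + (n + 1) * 8
    lem = solve-∀
  d%8 : d % 8 ≡ 2
  d%8 = Cong⇒% d≡
  a : ℕ
  a = 1 + d / 8 * 4
  a≡1 : a % 4 ≡ 1
  a≡1 = [1+4q]%4 (d / 8)
  2a : 2 * a ≡ d
  2a = sym (trans (%⇒≡ d 8 2 d%8) (lem (d / 8)))
    where
    lem : ∀ q → 2 + q * 8 ≡ 2 * (1 + q * 4)
    lem = solve-∀
  oa = 1mod4⇒IsOdd {a} a≡1
  ob : IsOdd b
  ob = odd-b (parity b)
    where
    odd-b : Parity b → IsOdd b
    odd-b (oddP k) = isOdd k
    odd-b (evenP k) = contradiction (subst IsOdd (trans (sym (m∸n+n≡m 3b≤n)) (trans (cong (_+ 3 * (k + k)) (sym 2a)) (lem a k))) on) (¬IsOdd-double (a + 3 * k))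
      where
      lem : ∀ a k → 2 * a + 3 * (k + k) ≡ a + 3 * k + (a + 3 * k)
      lem = solve-∀
  Jnb : J 2 b ℤ.* J a b ≡ J n b
  Jnb = trans (sym (J-*ˡ 2 a b)) (J-cong {2 * a} {n} ob (3 , 0 , trans (cong (_+ 3 * b) 2a) (trans (m∸n+n≡m 3b≤n) (sym (+-identityʳ n)))))
  Jba : J b a ≡ 1ℤ
  Jba = trans (J-recip ob oa (inj₂ a≡1)) (final (mod8 on) refl)
    where
    neg-one : ∀ {x} → -1ℤ ℤ.* x ≡ -1ℤ → x ≡ 1ℤ
    neg-one {x} e = *-cancelˡ-sign {s = -1ℤ} {x} {1ℤ} (inj₂ refl) e
    bmod : ∀ {r} → n % 8 ≡ r → b % 8 ≡ (3 * r + 2) % 8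
    bmod {r} e = trans b≡ (Cong⇒% {8} {3 * n + 2} {3 * r + 2} (Cong-+ (Cong-*ˡ 3 (Cong-sym (subst (λ z → Cong 8 z n) e (Cong-% n 8)))) (Cong-refl {x = 2})))
    final : ∀ {r} → Mod8 r → n % 8 ≡ r → J a b ≡ 1ℤ
    final mod1 e = neg-one (trans (cong (ℤ._* J a b) (sym (trans (J-2 ob) (cong J2 (bmod e))))) (trans Jnb
      (trans (J-recip on ob (inj₁ (%8⇒%4 {n} e))) (trans Jb (cong PSign e)))))
    final mod3 e = neg-one (trans (cong (ℤ._* J a b) (sym (trans (J-2 ob) (cong J2 (bmod e))))) (trans Jnb
      (trans (J-recip⁻ on ob (%8⇒%4 {n} e) (%8⇒%4 {b} (bmod e))) (cong ℤ.-_ (trans Jb (cong PSign e))))))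
    final mod5 e = contradiction e n≢5
    final mod7 e = trans (sym (ℤ.*-identityˡ (J a b))) (trans (cong (ℤ._* J a b) (sym (trans (J-2 ob) (cong J2 (bmod e))))) (trans Jnb
      (trans (J-recip⁻ on ob (%8⇒%4 {n} e) (%8⇒%4 {b} (bmod e))) (cong ℤ.-_ (trans Jb (cong PSign e))))))

-- For m = 4 N the pair is (2 N - 3 b, 2 b).
numerator-4N : ∀ N b → IsOdd b → 3 * b ≤ 2 * N → (2 * N ∸ 3 * b) % 4 ≡ 1 →
  J 2 (2 * N ∸ 3 * b) ℤ.* (J 2 b ℤ.* J N b) ≡ 1ℤ → IsNumerator (4 * N)
numerator-4N N b ob le a≡1 e = numerator′ a (2 * b) a≡1 Jba eq
  where
  a = 2 * N ∸ 3 * b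
  oa = 1mod4⇒IsOdd {a} a≡1
  a+ : a + 3 * b ≡ 2 * N
  a+ = m∸n+n≡m le
  eq : 2 * a + 3 * (2 * b) ≡ 4 * N
  eq = trans (lem a b) (trans (cong (2 *_) a+) (lem₂ N))
    where
    lem : ∀ a b → 2 * a + 3 * (2 * b) ≡ 2 * (a + 3 * b)
    lem = solve-∀
    lem₂ : ∀ N → 2 * (2 * N) ≡ 4 * N
    lem₂ = solve-∀
  Jba : J (2 * b) a ≡ 1ℤ
  Jba = trans (J-*ˡ 2 b a) (trans (cong (J 2 a ℤ.*_) (trans (J-recip ob oa (inj₂ a≡1)) (trans (J-cong {a} {2 * N} ob (3 , 0 , trans a+ (sym (+-identityʳ (2 * N))))) (J-*ˡ 2 N b)))) e)

data 3mod4 : ℕ → Set where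
  mod3 : 3mod4 3
  mod7 : 3mod4 7

data 1mod4 : ℕ → Set where
  mod1 : 1mod4 1
  mod5 : 1mod4 5

as-3mod4 : ∀ {b} → b % 4 ≡ 3 → 3mod4 (b % 8)
as-3mod4 {b} e with b % 8 | mod8 (3mod4⇒IsOdd {b} e) | trans (m∣n⇒o%n%m≡o%m 4 8 b (divides 2 refl)) e
... | _ | mod3 | _ = mod3
... | _ | mod7 | _ = mod7

as-1mod4 : ∀ {b} → b % 4 ≡ 1 → 1mod4 (b % 8)
as-1mod4 {b} e with b % 8 | mod8 (1mod4⇒IsOdd {b} e) | trans (m∣n⇒o%n%m≡o%m 4 8 b (divides 2 refl)) e
... | _ | mod1 | _ = mod1
... | _ | mod5 | _ = mod5

-- The class b ≡ 3 (mod 4) gives a = 2 n - 3 b ≡ 1 (mod 4). Then J 2 a · J 2 b is -1 or 1 as n ≡ 1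
-- or 3 (mod 4), which matches the reciprocity sign between n and b, so J b n = -1 is wanted in both
-- cases.
numerator-4n : ∀ {n} → IsOdd n → QSol n → IsNumerator (4 * n)
numerator-4n {n} on (b , b≡3 , le , Jb) = go (as-3mod4 {b} b≡3) refl (odd%4 on)
  where
  ob = 3mod4⇒IsOdd {b} b≡3
  a = 2 * n ∸ 3 * b
  a%8 : ∀ {s t} → b % 8 ≡ s → n % 4 ≡ t → a % 8 ≡ (2 * t + 5 * s) % 8
  a%8 {s} {t} eb en = solve-mod8 {a} {b} (Cong-trans (Cong-≡ (m∸n+n≡m le)) (0 , n / 4 , trans (cong (λ z → 2 * z + 0) (%⇒≡ n 4 t en)) (lem t (n / 4)))) eb
    where
    lem : ∀ t q → 2 * (t + q * 4) + 0 ≡ 2 * t + q * 8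
    lem = solve-∀
  fin : ∀ {s t x} → b % 8 ≡ s → n % 4 ≡ t → (2 * t + 5 * s) % 8 % 4 ≡ 1 → J n b ≡ x → J2 ((2 * t + 5 * s) % 8) ℤ.* (J2 s ℤ.* x) ≡ 1ℤ → IsNumerator (4 * n)
  fin {s} {t} {x} eb en r ex e = numerator-4N n b ob le a≡1 (trans (cong₂ ℤ._*_ (trans (J-2 (1mod4⇒IsOdd {a} a≡1)) (cong J2 (a%8 eb en))) (cong₂ ℤ._*_ (trans (J-2 ob) (cong J2 eb)) ex)) e)
    where
    a≡1 : a % 4 ≡ 1
    a≡1 = trans (%8⇒%4 {a} (a%8 eb en)) r
  J⁺ : n % 4 ≡ 1 → J n b ≡ -1ℤ
  J⁺ en = trans (J-recip on ob (inj₁ en)) Jb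
  J⁻ : n % 4 ≡ 3 → J n b ≡ 1ℤ
  J⁻ en = trans (J-recip⁻ on ob en b≡3) (cong ℤ.-_ Jb)
  go : ∀ {s} → 3mod4 s → b % 8 ≡ s → n % 4 ≡ 1 ⊎ n % 4 ≡ 3 → IsNumerator (4 * n)
  go mod3 eb (inj₁ en) = fin eb en refl (J⁺ en) refl
  go mod7 eb (inj₁ en) = fin eb en refl (J⁺ en) refl
  go mod3 eb (inj₂ en) = fin eb en refl (J⁻ en) refl
  go mod7 eb (inj₂ en) = fin eb en refl (J⁻ en) refl

-- Now a ≡ 5 b (mod 8), and multiplication by 5 exchanges the classes 1 and 5; hence J 2 a · J 2 b =
-- -1 and J b n has to be -1. The bound in `RSol` is the one for f = 0, the tightest.
numerator-16 : ∀ f {n} → IsOdd n → RSol n → IsNumerator (4 * (4 * (4 ^ f * n)))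
numerator-16 f {n} on (b , b≡1 , le₀ , Jb) = go (as-1mod4 {b} b≡1) refl
  where
  K = 4 ^ f * n
  ob = 1mod4⇒IsOdd {b} b≡1
  le : 3 * b ≤ 2 * (4 * K)
  le = ≤-trans le₀ (≤-trans (*-monoʳ-≤ 8 (m≤n*m n (4 ^ f) {{m^n≢0 4 f}})) (≤-reflexive (lem K)))
    where
    lem : ∀ K → 8 * K ≡ 2 * (4 * K)
    lem = solve-∀
  a = 2 * (4 * K) ∸ 3 * b
  a%8 : ∀ {s} → b % 8 ≡ s → a % 8 ≡ (5 * s) % 8
  a%8 {s} eb = solve-mod8 {a} {b} {0} (Cong-trans (Cong-≡ (m∸n+n≡m le)) (0 , K , lem K)) eb
    where
    lem : ∀ K → 2 * (4 * K) + 0 ≡ K * 8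
    lem = solve-∀
  JK : J (4 * K) b ≡ -1ℤ
  JK = trans (cong (λ z → J z b) (sym (*-assoc 4 (4 ^ f) n))) (trans (J-4^ (suc f) n ob) (trans (J-recip on ob (inj₂ b≡1)) Jb))
  fin : ∀ {s} → b % 8 ≡ s → (5 * s) % 8 % 4 ≡ 1 → J2 ((5 * s) % 8) ℤ.* (J2 s ℤ.* -1ℤ) ≡ 1ℤ → IsNumerator (4 * (4 * K))
  fin {s} eb r e = numerator-4N (4 * K) b ob le a≡1 (trans (cong₂ ℤ._*_ (trans (J-2 (1mod4⇒IsOdd {a} a≡1)) (cong J2 (a%8 eb))) (cong₂ ℤ._*_ (trans (J-2 ob) (cong J2 eb)) JK)) e)
    where
    a≡1 : a % 4 ≡ 1
    a≡1 = trans (%8⇒%4 {a} (a%8 eb)) r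
  go : ∀ {s} → 1mod4 s → b % 8 ≡ s → IsNumerator (4 * (4 * K))
  go mod1 eb = fin eb refl refl
  go mod5 eb = fin eb refl refl

-- The choice b = 1 + 4 n gives J n b = 1 by periodicity, and b ≡ 5 (mod 8) gives J 2 b = -1, which
-- the odd power of 2 passes on to J (8 M) b. With a ≡ 1 (mod 8) the signs cancel, for square n as
-- well.
numerator-32 : ∀ f {n} → IsOdd n → IsNumerator (4 * (8 * (4 ^ f * n)))
numerator-32 f {n} on = numerator-4N (8 * M) b ob le a≡1
  (trans (cong₂ ℤ._*_ (trans (J-2 (1mod4⇒IsOdd {a} a≡1)) (cong J2 a%8)) (cong₂ ℤ._*_ Jb2 JM)) refl)
  where
  M = 4 ^ f * n
  b = 1 + 4 * n
  b%8 : b % 8 ≡ 5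
  b%8 = helper on
    where
    helper : ∀ {n} → IsOdd n → (1 + 4 * n) % 8 ≡ 5
    helper (isOdd h) = trans (%-congˡ {o = 8} (lem h)) ([m+kn]%n≡m%n 5 h 8)
      where
      lem : ∀ h → 1 + 4 * suc (h + h) ≡ 5 + h * 8
      lem = solve-∀
  ob : IsOdd b
  ob = 1mod4⇒IsOdd {b} (%8⇒%4 {b} b%8)
  le : 3 * b ≤ 2 * (8 * M)
  le = begin
    3 * (1 + 4 * n)      ≡⟨ lem n ⟩
    3 + 12 * n           ≤⟨ +-monoˡ-≤ (12 * n) (*-monoʳ-≤ 3 (n>0 on)) ⟩
    3 * n + 12 * n       ≡⟨ lem₂ n ⟩
    15 * n               ≤⟨ *-monoˡ-≤ n (n≤1+n 15) ⟩
    16 * n               ≤⟨ *-monoʳ-≤ 16 (m≤n*m n (4 ^ f) {{m^n≢0 4 f}}) ⟩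
    16 * M               ≡⟨ *-assoc 2 8 M ⟩
    2 * (8 * M)          ∎
    where
    open ≤-Reasoning
    n>0 : ∀ {n} → IsOdd n → 1 ≤ n
    n>0 (isOdd h) = s≤s z≤n
    lem : ∀ n → 3 * (1 + 4 * n) ≡ 3 + 12 * n
    lem = solve-∀
    lem₂ : ∀ n → 3 * n + 12 * n ≡ 15 * n
    lem₂ = solve-∀
  a = 2 * (8 * M) ∸ 3 * b
  a%8 : a % 8 ≡ 1
  a%8 = solve-mod8 {a} {b} {0} (Cong-trans (Cong-≡ (m∸n+n≡m le)) (0 , 2 * M , lem M)) b%8
    where
    lem : ∀ M → 2 * (8 * M) + 0 ≡ 2 * M * 8
    lem = solve-∀
  a≡1 : a % 4 ≡ 1
  a≡1 = %8⇒%4 {a} a%8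
  Jb2 : J 2 b ≡ -1ℤ
  Jb2 = trans (J-2 ob) (cong J2 b%8)
  JM : J (8 * M) b ≡ -1ℤ
  JM = begin
    J (8 * M) b                    ≡⟨ J-*ˡ 8 M b ⟩
    J 8 b ℤ.* J M b                ≡⟨ cong₂ ℤ._*_ (trans (J-4^ 1 2 ob) Jb2) (trans (J-4^ f n ob) (J-period n ob (isOdd 0) (0 , 1 , lem n))) ⟩
    -1ℤ ℤ.* 1ℤ                     ≡⟨⟩
    -1ℤ                            ∎
    where
    open ≡-Reasoning
    lem : ∀ n → 1 + 4 * n + 0 ≡ 1 + 1 * (4 * n)
    lem = solve-∀

-- Windows containing both signs

Win : ℕ → ℕ → Set
Win T N = ∀ s x → ∃ λ i → i < N × J (x + i) T ≡ -ᵇ s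

Hyp : ℕ → ℕ → Bool → Set
Hyp n c s = ∃ λ b → b % 8 ≡ c × 3 * b ≤ n × J b n ≡ -ᵇ s

Win-reduce : ∀ {T N} → IsOdd T → (∀ s x → x < T → ∃ λ i → i < N × J (x + i) T ≡ -ᵇ s) → Win T N
Win-reduce {T} oT w s x with w s (x % T) (m%n<n x T)
  where instance _ = IsOdd-nonZero oT
... | i , i<N , e = i , i<N , trans (J-cong {x + i} {x % T + i} oT (Cong-+ (Cong-sym (Cong-% x T)) (Cong-refl {x = i}))) e
  where instance _ = IsOdd-nonZero oT

Win-full : ∀ {T} → IsOdd T → (∀ s → ∃ λ y → J y T ≡ -ᵇ s) → Win T T
Win-full {suc T} oT w s x with w s
... | y , e = i , m%n<n (y + x * T) (suc T) , trans (J-cong {x + i} {y} oT c) e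
  where
  i = (y + x * T) % suc T
  c : Cong (suc T) (x + i) y
  c = Cong-trans (Cong-+ (Cong-refl {x = x}) (Cong-% (y + x * T) (suc T))) (0 , x , lem x y T)
    where
    lem : ∀ x y T → x + (y + x * T) + 0 ≡ y + x * suc T
    lem = solve-∀
Win-full {zero} ()

-- Representatives b ≡ c (mod 8), b ≡ 1 (mod A) run through an arithmetic progression, rescaled to consecutive integers mod T.
hyp-window : ∀ {n T A N} → IsOdd T → 2 ≤ T → IsOdd A → Coprime A T →
  (∀ b → Cong A b 1 → IsSign (J b T) → J b n ≡ J b T) → Win T N → 24 * (A * N) ≤ n → ∀ c s → c < 8 → Hyp n c s
hyp-window {n} {T} {A} {N} oT 2≤T oA cop red win le c s c<8 with inverse-mod (8 * A) T 2≤T cop8A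
  where
  two : ∀ d → d ∣ T → d ∣ 2 → d ≡ 1
  cop8A : Coprime (8 * A) T
  cop8A = coprime-by-primes (≤-trans (s≤s z≤n) 2≤T) λ p pr p∣8A p∣T → case euclidsLemma 8 A pr p∣8A of λ where
    (inj₂ p∣A) → prime∤1 pr (subst (p ∣_) (cop (p∣A , p∣T)) ∣-refl)
    (inj₁ p∣8) → prime∤1 pr (subst (p ∣_) (coprime-4* {T} {2} oT (λ {d} (d∣T , d∣2) → two d d∣T d∣2) (s≤s z≤n) (p∣T , p∣8)) ∣-refl)
  two d d∣T d∣2 with prime⇒irreducible prime[2] d∣2
  ... | inj₁ e = e
  ... | inj₂ refl = contradiction (IsOdd-∣ d∣T oT) (¬IsOdd-double 1)
... | d , q , e = found
  where
  D = 8 * A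
  -- A is its own inverse modulo 8, so 1 + A j₀ ≡ 1 + (c + 7) ≡ c.
  j₀ = (A * (c + 7)) % 8
  b₀ = 1 + A * j₀
  -- The quotient of b₀ by D modulo T: b₀ + D i ≡ D (α + i). If D has symbol -1, the opposite sign
  -- is sought in the window at α.
  α = d * b₀
  Dα : Cong T (D * α) b₀
  Dα = Cong-trans (Cong-≡ (sym (*-assoc D d b₀))) (Cong-trans (Cong-≡ (cong (_* b₀) e)) (0 , q * b₀ , lem T q b₀))
    where
    lem : ∀ T q b → (T * q + 1) * b + 0 ≡ b + q * b * T
    lem = solve-∀
  JD : IsSign (J D T)
  JD = J-isSign {D} oT (λ {i} (i∣D , i∣T) → ∣1⇒≡1 (∣m+n∣m⇒∣n (subst (i ∣_) e (∣m⇒∣m*n d i∣D)) (∣m⇒∣m*n q i∣T)))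
  JDα : ∀ i → J (b₀ + D * i) T ≡ J D T ℤ.* J (α + i) T
  JDα i = trans (J-cong {b₀ + D * i} {D * (α + i)} oT (Cong-trans (Cong-+ (Cong-sym Dα) (Cong-refl {x = D * i})) (Cong-≡ (sym (*-distribˡ-+ D α i))))) (J-*ˡ D (α + i) T)
  Win-D : IsSign (J D T) → ∃ λ i → i < N × J (b₀ + D * i) T ≡ -ᵇ s
  Win-D (inj₁ e) with win s α
  ... | i , i<N , ei = i , i<N , trans (JDα i) (trans (cong₂ ℤ._*_ e ei) (ℤ.*-identityˡ _))
  Win-D (inj₂ e) with win (not s) α
  ... | i , i<N , ei = i , i<N , trans (JDα i) (trans (cong₂ ℤ._*_ e ei) (negate s))
    where
    negate : ∀ s → -1ℤ ℤ.* -ᵇ (not s) ≡ -ᵇ s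
    negate true = refl
    negate false = refl
  A² : Cong 8 (A * A) 1
  A² = helper oA
    where
    helper : ∀ {A} → IsOdd A → Cong 8 (A * A) 1
    helper (isOdd h) with parity h
    ... | evenP k = 0 , k * (2 * k + 1) , lem k
      where
      lem : ∀ k → suc (k + k + (k + k)) * suc (k + k + (k + k)) + 0 ≡ 1 + k * (2 * k + 1) * 8
      lem = solve-∀
    ... | oddP k = 0 , (k + 1) * (2 * k + 1) , lem k
      where
      lem : ∀ k → suc (suc (k + k) + suc (k + k)) * suc (suc (k + k) + suc (k + k)) + 0 ≡ 1 + (k + 1) * (2 * k + 1) * 8
      lem = solve-∀
  b₀%8 : Cong 8 b₀ c
  b₀%8 = Cong-trans (Cong-+ (Cong-refl {x = 1}) (Cong-*ˡ A (Cong-% (A * (c + 7)) 8)))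
    (Cong-trans (Cong-+ (Cong-refl {x = 1}) (Cong-trans (Cong-≡ (sym (*-assoc A A (c + 7)))) (Cong-* A² (Cong-refl {x = c + 7})))) (0 , 1 , lem c))
    where
    lem : ∀ c → 1 + 1 * (c + 7) + 0 ≡ c + 8
    lem = solve-∀
  found : Hyp n c s
  found with Win-D JD
  ... | i , i<N , ei = b , trans (Cong⇒% (Cong-trans {y = b₀} (0 , A * i , lem₁ b₀ A i) b₀%8)) (m<n⇒m%n≡m c<8) , 3b≤ ,
        trans (red b (0 , j₀ + 8 * i , lem₂ A j₀ i) (subst IsSign (sym ei) (-ᵇ-isSign s))) ei
    where
    b = b₀ + D * i
    lem₁ : ∀ b A i → b + 8 * A * i + 0 ≡ b + A * i * 8
    lem₁ = solve-∀
    lem₂ : ∀ A j i → 1 + A * j + 8 * A * i + 0 ≡ 1 + (j + 8 * i) * A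
    lem₂ = solve-∀
    A>0 : 1 ≤ A
    A>0 = >-nonZero⁻¹ A {{IsOdd-nonZero oA}}
    -- From j₀ ≤ 7 and i < N follows b ≤ 8 A N, whence the factor 24 in the hypothesis.
    3b≤ : 3 * b ≤ n
    3b≤ = ≤-trans (*-monoʳ-≤ 3 (begin
      1 + A * j₀ + 8 * A * i       ≤⟨ +-monoˡ-≤ (8 * A * i) (+-mono-≤ A>0 (*-monoʳ-≤ A (s≤s⁻¹ (m%n<n (A * (c + 7)) 8)))) ⟩
      A + A * 7 + 8 * A * i        ≡⟨ lem₃ A i ⟩
      8 * (A * suc i)              ≤⟨ *-monoʳ-≤ 8 (*-monoʳ-≤ A i<N) ⟩
      8 * (A * N)                  ∎)) (≤-trans (≤-reflexive (sym (*-assoc 3 8 (A * N)))) le)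
      where
      open ≤-Reasoning
      lem₃ : ∀ A i → A + A * 7 + 8 * A * i ≡ 8 * (A * suc i)
      lem₃ = solve-∀

-- If every unit were a square, square roots would inject the 2h units into the half system.
nonresidue : ∀ {p} → IsOdd p → Prime p → ∃ λ y → y < p × J y p ≡ -1ℤ
nonresidue (isOdd h) pr with any? {h + h} (λ i → J (♯ i) (odd h) ℤ.≟ -1ℤ)
... | yes (i , e) = ♯ i , s≤s (♯≤ i) , e
... | no none = contradiction (injective⇒≤ {f = λ i → proj₁ (root i)} inj) (<⇒≱ (m<m+n h (h≥1 h pr)))
  where
  root : (i : Fin (h + h)) → ∃ λ (k : Fin h) → Cong (odd h) (♯ k * ♯ k) (♯ i)
  root i with any? (λ k → congᵇ h (♯ k * ♯ k) (♯ i) ≟ᵇ true)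
  ... | yes (k , e) = k , congᵇ-sound h {♯ k * ♯ k} {♯ i} e
  ... | no ¬k = contradiction (trans (J-odd (♯ i) h) (trans (sym (ℤ.neg-involutive (JH h (♯ i)))) (cong ℤ.-_ (trans (sym (JH-roots h pr cop)) (∏-ones {h} _ (λ k → -ᵇ-no (λ e → ¬k (k , e)))))))) (λ e → none (i , e))
    where
    cop : Coprime (♯ i) (odd h)
    cop = coprime-∣ pr (λ d → <⇒≱ (s≤s (♯≤ i)) (∣⇒≤ d))
  inj : Injective _≡_ _≡_ (λ i → proj₁ (root i))
  inj {i} {j} e = ♯-injective (Cong-< (Cong-trans (Cong-sym (proj₂ (root i))) (Cong-trans (Cong-≡ (cong (λ k → ♯ k * ♯ k) e)) (proj₂ (root j)))) (s≤s (♯≤ i)) (s≤s (♯≤ j)))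

Win-prime : ∀ {p} → IsOdd p → Prime p → Win p p
Win-prime {p} o pr = Win-full o λ where
  false → 1 , J-1 o
  true  → let (y , _ , e) = nonresidue o pr in y , e

least : ∀ {P : ℕ → Set} → (∀ n → Dec (P n)) → ∀ n → P n → ∃ λ q → P q × q ≤ n × (∀ r → r < q → ¬ P r)
least {P} P? = <-rec (λ n → P n → ∃ λ q → P q × q ≤ n × (∀ r → r < q → ¬ P r)) step
  where
  step : ∀ n → (∀ {m} → m < n → P m → ∃ λ q → P q × q ≤ m × (∀ r → r < q → ¬ P r)) → P n → ∃ λ q → P q × q ≤ n × (∀ r → r < q → ¬ P r)
  step n rec pn with anyUpTo? P? n
  ... | no none = n , pn , ≤-refl , λ r r<n pr → none (r , r<n , pr)
  ... | yes (m , m<n , pm) = let (q , pq , q≤m , min) = rec m<n pm in q , pq , ≤-trans q≤m (<⇒≤ m<n) , min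

prime-coprime : ∀ {p x} → Prime p → 0 < x → x < p → Coprime x p
prime-coprime pr x>0 x<p = coprime-∣ pr (λ d → <⇒≱ x<p (∣⇒≤ {{>-nonZero x>0}} d))

-- With k q ≡ r (mod p), k = ⌊p / q⌋ + 1 and r < q, minimality makes r a residue, hence k a nonresidue.
least-nonresidue : ∀ {p} → IsOdd p → Prime p → ∃ λ q → J q p ≡ -1ℤ × 2 ≤ q × (q ∸ 1) * q ≤ p
least-nonresidue {p} o pr with nonresidue o pr
... | y , y<p , Jy with least {λ q → J q p ≡ -1ℤ} (λ q → J q p ℤ.≟ -1ℤ) y Jy
...   | zero , J0 , _ = contradiction (J-zero {0} o λ cop → ¬prime[1] (subst Prime (cop (p ∣0 , ∣-refl)) pr)) (λ e → contradiction (trans (sym e) J0) λ ())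
...   | suc zero , J1 , _ = contradiction (trans (sym (J-1 o)) J1) λ ()
...   | q@(suc (suc _)) , Jq , q≤y , min = q , Jq , s≤s (s≤s z≤n) , bound
  where
  k = suc (p / q)
  r = q ∸ p % q
  q<p = ≤-<-trans q≤y y<p
  p%q>0 : 0 < p % q
  p%q>0 = n≢0⇒n>0 (λ e → case prime⇒irreducible pr (m%n≡0⇒n∣m p q e) of λ where
    (inj₁ ())
    (inj₂ q≡p) → <⇒≢ q<p q≡p)
  r<q : r < q
  r<q = ∸-monoʳ-< {q} p%q>0 (<⇒≤ (m%n<n p q))
  kq : k * q ≡ r + p
  kq = begin
    q + p / q * q                     ≡⟨ cong (_+ p / q * q) (m∸n+n≡m (<⇒≤ (m%n<n p q))) ⟨
    r + p % q + p / q * q             ≡⟨ +-assoc r (p % q) (p / q * q) ⟩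
    r + (p % q + p / q * q)           ≡⟨ cong (r +_) (m≡m%n+[m/n]*n p q) ⟨
    r + p                             ∎
    where open ≡-Reasoning
  Jr : J r p ≡ 1ℤ
  Jr with J-isSign {r} o (prime-coprime pr (m<n⇒0<n∸m (m%n<n p q)) (<-trans r<q q<p))
  ... | inj₁ e = e
  ... | inj₂ e = contradiction e (min r r<q)
  Jk : J k p ≡ -1ℤ
  Jk = *-cancelˡ-sign {s = -1ℤ} (inj₂ refl) (trans (cong (ℤ._* J k p) (sym Jq)) (trans (ℤ.*-comm (J q p) (J k p)) (trans (sym (J-*ˡ k q p)) (trans (cong (λ z → J z p) kq) (trans (J-cong {r + p} {r} o (0 , 1 , lem r p)) Jr)))))
    where
    lem : ∀ r p → r + p + 0 ≡ r + 1 * p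
    lem = solve-∀
  q≤k : q ≤ k
  q≤k = ≮⇒≥ (λ k<q → min k k<q Jk)
  bound : (q ∸ 1) * q ≤ p
  bound = ≤-trans (*-monoˡ-≤ q (∸-monoˡ-≤ 1 q≤k)) (m/n*n≤m p q)

-- Q (x + i) ≡ x + k (mod p) with both i, k < N, and the two symbols differ.
Win-dilate : ∀ {p N} → IsOdd p → Prime p → ∀ Q → J Q p ≡ -1ℤ → p ≤ Q * (N ∸ 2) → 2 * Q < N → Win p N
Win-dilate {p} {N} o pr zero JQ p≤ 2Q<N = contradiction (subst (_≥ 1) (n≤0⇒n≡0 p≤) (>-nonZero⁻¹ p {{IsOdd-nonZero o}})) λ ()
Win-dilate {suc p} {N} o pr Q@(suc _) JQ p≤ 2Q<N s x = choose (coprime? (x + i) (suc p))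
  where
  -- The modulus is `suc p`, so p acts as -1 and β is the residue of x - Q x. Rounding β up to a
  -- multiple Q i leaves the remainder k with 1 ≤ k ≤ Q.
  β = (x + p * (Q * x)) % suc p
  i = suc (β / Q)
  k = Q ∸ β % Q
  β-eq : Cong (suc p) (Q * x + β) x
  β-eq = Cong-trans (Cong-+ (Cong-refl {x = Q * x}) (Cong-% (x + p * (Q * x)) (suc p))) (0 , Q * x , lem (Q * x) x p)
    where
    lem : ∀ y x p → y + (x + p * y) + 0 ≡ x + y * suc p
    lem = solve-∀
  Qi : Q * i ≡ β + k
  Qi = begin
    Q * suc (β / Q)              ≡⟨ *-comm Q (suc (β / Q)) ⟩
    Q + β / Q * Q                ≡⟨ cong (_+ β / Q * Q) (m+[n∸m]≡n (<⇒≤ (m%n<n β Q))) ⟨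
    β % Q + k + β / Q * Q        ≡⟨ lem (β % Q) k (β / Q * Q) ⟩
    β % Q + β / Q * Q + k        ≡⟨ cong (_+ k) (m≡m%n+[m/n]*n β Q) ⟨
    β + k                        ∎
    where
    open ≡-Reasoning
    lem : ∀ a b c → a + b + c ≡ a + c + b
    lem = solve-∀
  c : ∀ i k → Q * i ≡ β + k → Cong (suc p) (Q * (x + i)) (x + k)
  c i k e = Cong-trans (Cong-≡ (trans (*-distribˡ-+ Q x i) (trans (cong (Q * x +_) e) (sym (+-assoc (Q * x) β k))))) (Cong-+ β-eq (Cong-refl {x = k}))
  i≤ : i ≤ N ∸ 2
  i≤ = m<n*o⇒m/o<n {β} {N ∸ 2} {Q} (<-≤-trans (m%n<n (x + p * (Q * x)) (suc p)) (≤-trans p≤ (≤-reflexive (*-comm Q (N ∸ 2)))))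
  2≤N : 2 ≤ N
  2≤N = ≤-trans (*-monoʳ-≤ 2 (s≤s {0} z≤n)) (<⇒≤ 2Q<N)
  si<N : suc i < N
  si<N = ≤-trans (s≤s (s≤s i≤)) (≤-reflexive (m+[n∸m]≡n 2≤N))
  k≤Q : k ≤ Q
  k≤Q = m∸n≤m Q (β % Q)
  use : ∀ i k → i < N → k < N → Q * i ≡ β + k → Coprime (x + i) (suc p) → ∃ λ i → i < N × J (x + i) (suc p) ≡ -ᵇ s
  use i k i<N k<N e cop = pick (J-isSign o cop) s
    where
    flip : J (x + k) (suc p) ≡ -1ℤ ℤ.* J (x + i) (suc p)
    flip = trans (sym (J-cong o (c i k e))) (trans (J-*ˡ Q (x + i) (suc p)) (cong (ℤ._* J (x + i) (suc p)) JQ))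
    pick : IsSign (J (x + i) (suc p)) → ∀ s → ∃ λ i → i < N × J (x + i) (suc p) ≡ -ᵇ s
    pick (inj₁ e) false = i , i<N , e
    pick (inj₁ e) true  = k , k<N , trans flip (cong (-1ℤ ℤ.*_) e)
    pick (inj₂ e) true  = i , i<N , e
    pick (inj₂ e) false = k , k<N , trans flip (cong (-1ℤ ℤ.*_) e)
  choose : Dec (Coprime (x + i) (suc p)) → ∃ λ i → i < N × J (x + i) (suc p) ≡ -ᵇ s
  choose (yes cop) = use i k (<-trans (n<1+n i) si<N) (≤-<-trans (≤-trans k≤Q (m≤n*m Q 2)) 2Q<N) Qi cop
  -- If the modulus divides x + i, it does not divide x + i + 1; the next multiple of Q replaces k
  -- by k + Q ≤ 2 Q. This shift explains N - 2 and 2 Q in the hypotheses.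
  choose (no ¬cop) = use (suc i) (k + Q) si<N (≤-<-trans (≤-trans (+-monoˡ-≤ Q k≤Q) (≤-reflexive (lem Q))) 2Q<N)
    (trans (*-suc Q i) (trans (cong (Q +_) Qi) (lem₂ Q β k))) (coprime-∣ pr (λ d → ¬cop (coprime-∣ pr (λ d′ → prime∤1 pr (∣m+n∣m⇒∣n (subst (suc p ∣_) (lem₃ x i) d) d′)))))
    where
    lem : ∀ Q → Q + Q ≡ 2 * Q
    lem = solve-∀
    lem₂ : ∀ Q β k → Q + (β + k) ≡ β + (k + Q)
    lem₂ = solve-∀
    lem₃ : ∀ x i → x + suc i ≡ x + i + 1
    lem₃ = solve-∀

p<24[N+1] : ∀ p → p < 24 * suc (p / 24)
p<24[N+1] p = begin-strict
  p                          ≡⟨ m≡m%n+[m/n]*n p 24 ⟩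
  p % 24 + p / 24 * 24       <⟨ +-monoˡ-< (p / 24 * 24) (m%n<n p 24) ⟩
  24 + p / 24 * 24           ≡⟨ *-comm (suc (p / 24)) 24 ⟩
  24 * suc (p / 24)          ∎
  where open ≤-Reasoning

-- With N = p / 24, dilation asks for p ≤ Q (N - 2) and 2 Q < N. The first holds for Q ≥ 27, just
-- above 24; the second, as N ≥ 216 = 5184 / 24, for Q ≤ 107. A square factor 4 or 16 lifts every q
-- ≤ 26 into this range. For q ≥ 108 the bound (q - 1) q ≤ p gives 96 q ≤ p, hence 4 q ≤ N.
Win-large : ∀ {p} → IsOdd p → Prime p → 5184 ≤ p → Win p (p / 24)
Win-large {p} o pr 5184≤p with least-nonresidue o pr
... | q , Jq , 2≤q , bound = pick (q ≤? 6) (q ≤? 26) (q ≤? 107)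
  where
  N = p / 24
  216≤N : 216 ≤ N
  216≤N = /-monoˡ-≤ 24 5184≤p
  p≤ : ∀ Q → 27 ≤ Q → p ≤ Q * (N ∸ 2)
  p≤ Q 27≤Q = begin
    p                           ≤⟨ <⇒≤ (p<24[N+1] p) ⟩
    24 * suc N                  ≡⟨ cong (λ z → 24 * suc z) N≡ ⟩
    24 * suc (214 + e + 2)      ≤⟨ m≤m+n _ (3 * e + 570) ⟩
    24 * suc (214 + e + 2) + (3 * e + 570)      ≡⟨ lem e ⟩
    27 * (214 + e)              ≡⟨ cong (27 *_) (trans (cong (_∸ 2) (trans N≡ (+-comm (214 + e) 2))) (m+n∸m≡n 2 (214 + e))) ⟨
    27 * (N ∸ 2)                ≤⟨ *-monoˡ-≤ (N ∸ 2) 27≤Q ⟩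
    Q * (N ∸ 2)                 ∎
    where
    open ≤-Reasoning
    e = N ∸ 216
    N≡ : N ≡ 214 + e + 2
    N≡ = trans (sym (m+[n∸m]≡n 216≤N)) (lem′ e)
      where
      lem′ : ∀ e → 216 + e ≡ 214 + e + 2
      lem′ = solve-∀
    lem : ∀ e → 24 * suc (214 + e + 2) + (3 * e + 570) ≡ 27 * (214 + e)
    lem = solve-∀
  small : ∀ Q → J Q p ≡ -1ℤ → 27 ≤ Q → Q ≤ 107 → Win p N
  small Q JQ 27≤Q Q≤ = Win-dilate o pr Q JQ (p≤ Q 27≤Q) (≤-trans (s≤s (*-monoʳ-≤ 2 Q≤)) (≤-trans (n≤1+n 215) 216≤N))
  pick : Dec (q ≤ 6) → Dec (q ≤ 26) → Dec (q ≤ 107) → Win p N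
  pick (yes q≤6) _ _ = small (16 * q) (trans (J-4^ 2 q o) Jq) (≤-trans (m≤n+m 27 5) (*-monoʳ-≤ 16 2≤q)) (≤-trans (*-monoʳ-≤ 16 q≤6) (m≤n+m 96 11))
  pick (no q>6) (yes q≤26) _ = small (4 * q) (trans (J-4^ 1 q o) Jq) (≤-trans (n≤1+n 27) (*-monoʳ-≤ 4 (≰⇒> q>6))) (≤-trans (*-monoʳ-≤ 4 q≤26) (m≤n+m 104 3))
  pick (no _) (no q>26) (yes q≤107) = small q Jq (≰⇒> q>26) q≤107
  pick (no _) (no q>26) (no q>107) = Win-dilate o pr q Jq (p≤ q (≰⇒> q>26)) (begin-strict
    2 * q                <⟨ *-monoˡ-< q {{>-nonZero (≤-trans (s≤s z≤n) 2≤q)}} {2} {4} (s≤s (s≤s (s≤s z≤n))) ⟩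
    4 * q                ≡⟨ m*n/n≡m (4 * q) 24 ⟨
    4 * q * 24 / 24      ≤⟨ /-monoˡ-≤ 24 (begin
      4 * q * 24           ≡⟨ lem q ⟩
      96 * q               ≤⟨ *-monoˡ-≤ q (≤-trans (m≤n+m 96 11) (∸-monoˡ-≤ 1 (≰⇒> q>107))) ⟩
      (q ∸ 1) * q          ≤⟨ bound ⟩
      p                    ∎) ⟩
    N                    ∎)
    where
    open ≤-Reasoning
    lem : ∀ q → 4 * q * 24 ≡ 96 * q
    lem = solve-∀

-- Finite checks for primes below 5184

allFrom : (ℕ → Bool) → ℕ → ℕ → Bool
allFrom f lo zero    = true
allFrom f lo (suc k) = f lo ∧ allFrom f (suc lo) k

allFrom-sound : ∀ f lo k → allFrom f lo k ≡ true → ∀ x → lo ≤ x → x < lo + k → f x ≡ true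
allFrom-sound f lo zero e x lo≤x x< = contradiction lo≤x (<⇒≱ (subst (x <_) (+-identityʳ lo) x<))
allFrom-sound f lo (suc k) e x lo≤x x< with ∧-true {f lo} e | m≤n⇒m<n∨m≡n lo≤x
... | _ , e₂ | inj₁ lo<x = allFrom-sound f (suc lo) k e₂ x lo<x (subst (x <_) (+-suc lo k) x<)
... | e₁ , _ | inj₂ refl = e₁

∨-true : ∀ {p q} → (p ∨ q) ≡ true → p ≡ true ⊎ q ≡ true
∨-true {true}  _ = inj₁ refl
∨-true {false} e = inj₂ e

findDown : Bool → ℕ → ℕ → ℕ → Maybe ℕ
findDown s p x zero    = nothing
findDown s p x (suc d) = if isJ 60 s (x + d) p then just (x + d) else findDown s p x d

-- A greedy certificate: the last hit y in the window at x also serves every window starting between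
-- x and y, so the search resumes at y + 1. The fuel f bounds the number of jumps.
covers : Bool → ℕ → ℕ → ℕ → ℕ → Bool
covers-next : Bool → ℕ → ℕ → ℕ → Maybe ℕ → Bool
covers s p N zero    x = false
covers s p N (suc f) x = if p ≤ᵇ x then true else covers-next s p N f (findDown s p x N)
covers-next s p N f nothing  = false
covers-next s p N f (just y) = covers s p N f (suc y)

findDown-sound : ∀ s {p} x d {y} → IsOdd p → findDown s p x d ≡ just y → y < x + d × J y p ≡ -ᵇ s
findDown-sound s {p} x (suc d) o e with isJ 60 s (x + d) p in eq
findDown-sound s {p} x (suc d) o refl | true = subst (x + d <_) (sym (+-suc x d)) (n<1+n (x + d)) , isJ-sound 60 s (x + d) o eq
... | false = let (y< , ey) = findDown-sound s x d o e in <-≤-trans y< (+-monoʳ-≤ x (n≤1+n d)) , ey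

covers-sound : ∀ s {p} N f x → IsOdd p → covers s p N f x ≡ true → ∀ z → x ≤ z → z < p → ∃ λ i → i < N × J (z + i) p ≡ -ᵇ s
covers-sound s {p} N (suc f) x o e z x≤z z<p with p ≤ᵇ x in eq
... | true = contradiction (≤-<-trans x≤z z<p) (≤⇒≯ (≤ᵇ-sound eq))
... | false with findDown s p x N in fd
...   | just y with findDown-sound s x N o fd | z ≤? y
...     | y< , ey | yes z≤y = y ∸ z , +-cancelˡ-< z (y ∸ z) N (subst (_< z + N) (sym (m+[n∸m]≡n z≤y)) (<-≤-trans y< (+-monoˡ-≤ N x≤z))) , trans (cong (λ w → J w p) (m+[n∸m]≡n z≤y)) ey
...     | _ | no z≰y = covers-sound s N f (suc y) o e z (≰⇒> z≰y) z<p

-- The predecessors of the primes up to 71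
divisors-1 : List ℕ
divisors-1 = 1 ∷ 2 ∷ 4 ∷ 6 ∷ 10 ∷ 12 ∷ 16 ∷ 18 ∷ 22 ∷ 28 ∷ 30 ∷ 36 ∷ 40 ∷ 42 ∷ 46 ∷ 52 ∷ 58 ∷ 60 ∷ 66 ∷ 70 ∷ []

properDivisor : ℕ → ℕ → Bool
properDivisor p d = (0 <ᵇ d) ∧ (suc d <ᵇ p) ∧ (p % suc d ≡ᵇ 0)

properDivisor-sound : ∀ {p} d → properDivisor p d ≡ true → ¬ Prime p
properDivisor-sound {p} d e pr with ∧-true {0 <ᵇ d} e
... | d>0 , e′ with ∧-true {suc d <ᵇ p} e′
...   | d<p , d∣p with prime⇒irreducible pr (m%n≡0⇒n∣m p (suc d) (≡ᵇ-sound d∣p))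
...     | inj₁ refl = contradiction d>0 λ ()
...     | inj₂ refl = contradiction (<ᵇ-sound {suc d} {suc d} d<p) (<-irrefl refl)

-- A composite number below 5184 = 72² has a prime factor of at most 71, so this test sieves the
-- whole checked range.
smallDivisor : ℕ → Bool
smallDivisor p = any (properDivisor p) divisors-1

smallDivisor-sound : ∀ {p} → smallDivisor p ≡ true → ¬ Prime p
smallDivisor-sound {p} e = let (d , _ , ed) = any-true {f = properDivisor p} divisors-1 e in properDivisor-sound d ed

-- The primes for which some window of length p / 24 misses a sign
sparse : List ℕ
sparse = 29 ∷ 31 ∷ 37 ∷ 41 ∷ 43 ∷ 47 ∷ 53 ∷ 59 ∷ 61 ∷ 67 ∷ 71 ∷ 73 ∷ 79 ∷ 83 ∷ 89 ∷ 97 ∷ 101 ∷ 103 ∷ 107 ∷ 109 ∷ 113 ∷ 127 ∷ 131 ∷ 137 ∷ 139 ∷ 149 ∷ 151 ∷ 157 ∷ 163 ∷ 167 ∷ 191 ∷ 193 ∷ 241 ∷ []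

gap-test : ℕ → Bool
gap-test p = covers false p (p / 24) 300 0 ∧ covers true p (p / 24) 300 0

gap-test-sound : ∀ {p} → IsOdd p → gap-test p ≡ true → Win p (p / 24)
gap-test-sound {p} o e = Win-reduce o window-sign
  where
  both = ∧-true {covers false p (p / 24) 300 0} e
  window-sign : ∀ s x → x < p → ∃ λ i → i < p / 24 × J (x + i) p ≡ -ᵇ s
  window-sign false x x<p = covers-sound false (p / 24) 300 0 o (proj₁ both) x z≤n x<p
  window-sign true  x x<p = covers-sound true (p / 24) 300 0 o (proj₂ both) x z≤n x<p

dilation-test : ℕ → ℕ → Bool
dilation-test p Q = (p ≤ᵇ Q * (p / 24 ∸ 2)) ∧ (2 * Q <ᵇ p / 24) ∧ isJ 60 true Q p

dilation-test-sound : ∀ {p} Q → IsOdd p → Prime p → dilation-test p Q ≡ true → Win p (p / 24)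
dilation-test-sound {p} Q o pr e with ∧-true {p ≤ᵇ Q * (p / 24 ∸ 2)} e
... | e₁ , e₂ with ∧-true {2 * Q <ᵇ p / 24} e₂
...   | e₃ , e₄ = Win-dilate o pr Q (isJ-sound 60 true Q o e₄) (≤ᵇ-sound e₁) (<ᵇ-sound {2 * Q} e₃)

-- Dilation needs a single nonresidue Q, but at its lower end the choice is narrow: for 1309 ≤ p and
-- p / 24 = 54 only Q = 26 meets both inequalities. Smaller primes are therefore covered window by
-- window.
gap-check dilation-check : ℕ → Bool
gap-check p = smallDivisor p ∨ any (p ≡ᵇ_) sparse ∨ gap-test p
dilation-check p = smallDivisor p ∨ any (dilation-test p) (upTo 108)

abstract
  gap-checked : ∀ {p} → IsOdd p → Prime p → 29 ≤ p → p < 1309 → p ∈ sparse ⊎ Win p (p / 24)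
  gap-checked {p} o pr 29≤p p< =
    [ (λ e → contradiction pr (smallDivisor-sound e))
    , [ (λ e → let (x , x∈ , ex) = any-true {f = p ≡ᵇ_} sparse e in inj₁ (subst (_∈ sparse) (sym (≡ᵇ-sound {p} {x} ex)) x∈))
      , (λ e → inj₂ (gap-test-sound o e)) ]′ ∘ ∨-true {any (p ≡ᵇ_) sparse} ]′
    (∨-true {smallDivisor p} (allFrom-sound gap-check 29 1280 refl p 29≤p p<))

  dilation-checked : ∀ {p} → IsOdd p → Prime p → 1309 ≤ p → p < 5184 → Win p (p / 24)
  dilation-checked {p} o pr 1309≤p p< =
    [ (λ e → contradiction pr (smallDivisor-sound e))
    , (λ e → let (Q , _ , eQ) = any-true {f = dilation-test p} (upTo 108) e in dilation-test-sound Q o pr eQ) ]′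
    (∨-true {smallDivisor p} (allFrom-sound dilation-check 1309 3875 refl p 1309≤p p<))

Win-dense : ∀ {p} → IsOdd p → Prime p → 29 ≤ p → p ∈ sparse ⊎ Win p (p / 24)
Win-dense {p} o pr 29≤p with p <? 1309 | p <? 5184
... | yes p<1309 | _          = gap-checked o pr 29≤p p<1309
... | no p≥1309  | yes p<5184 = inj₂ (dilation-checked o pr (≮⇒≥ p≥1309) p<5184)
... | no _       | no p≥5184  = inj₂ (Win-large o pr (≮⇒≥ p≥5184))

-- A common strengthening of `PSol`, `QSol` and `RSol`: the classes 3 and 5 modulo 8 refine those
-- modulo 4, and 3 b ≤ n is the strictest of the three bounds.
Needed : ℕ → Set
Needed n = Hyp n ((3 * n + 2) % 8) (not (n % 8 ≡ᵇ 3)) × Hyp n 3 true × Hyp n 5 true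

-- Sparse primes: candidates congruent to ± a power of 2 modulo the cofactor

power : ℕ → Bool → ℕ
power f o = 4 ^ f * (if o then 2 else 1)

two-sign : ℕ → Bool
two-sign w = (w % 8 ≡ᵇ 3) ∨ (w % 8 ≡ᵇ 5)

J-power : ∀ f o {w} → IsOdd w → J (power f o) w ≡ -ᵇ (o ∧ two-sign w)
J-power f true  ow = trans (J-4^ f 2 ow) (J-2-ᵇ ow)
J-power f false ow = trans (J-4^ f 1 ow) (J-1 ow)

-- For r a power of 2 the symbol of ± r modulo w depends on w mod 8 alone, and b = w j ± r enters
-- otherwise only modulo 8 p; so W = w mod 8 p decides everything. As W² ≡ 1 (mod 8), j starts in
-- the class that gives b ≡ c. With r ≤ 32 < w, the test 3 (j + 1) ≤ p ensures 3 b ≤ p w. In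
-- `below`, -r is represented by r (8 p - 1).
above below : ℕ → ℕ → ℕ → Bool → ℕ → Bool → ℕ → Bool
above p W c s f o i = (power f o ≤ᵇ 32) ∧ (3 * suc j ≤ᵇ p) ∧ (b % 8 ≡ᵇ c) ∧ isJ 60 (s xor (o ∧ two-sign W)) b p
  where
  j = (W * (c + 7 * power f o)) % 8 + 8 * i
  b = power f o + W * j
below p W c s f o i = (power f o ≤ᵇ 32) ∧ (3 * suc j ≤ᵇ p) ∧ (0 <ᵇ j) ∧ (b % 8 ≡ᵇ c) ∧ isJ 60 ((s xor (W % 4 ≡ᵇ 3)) xor (o ∧ two-sign W)) b p
  where
  j = (W * (c + power f o)) % 8 + 8 * i
  b = W * j + power f o * (8 * p ∸ 1)

near-power : ℕ → ℕ → ℕ → Bool → ℕ × Bool → Bool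
near-power p W c s (f , o) = any (λ i → above p W c s f o i ∨ below p W c s f o i) (upTo (suc (p / 24)))

powers : List (ℕ × Bool)
powers = (0 , false) ∷ (0 , true) ∷ (1 , false) ∷ (1 , true) ∷ (2 , false) ∷ (2 , true) ∷ []

find-near : ℕ → ℕ → ℕ → Bool → Bool
find-near p W c s = any (near-power p W c s) powers

needed-near : ℕ → ℕ → Bool
needed-near p W = find-near p W ((3 * n₈ + 2) % 8) (not (n₈ ≡ᵇ 3)) ∧ find-near p W 3 true ∧ find-near p W 5 true
  where n₈ = (p * W) % 8

not-false : ∀ {x} → not x ≡ false → x ≡ true
not-false {true} _ = refl

class-check : (p : ℕ) .{{_ : NonZero p}} → ℕ → Bool
class-check p W = (W % 2 ≡ᵇ 0) ∨ (W % p ≡ᵇ 0) ∨ needed-near p W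

sparse-check : ℕ → Bool
sparse-check zero      = false
sparse-check p@(suc _) = allFrom (class-check p) 0 (8 * p)

abstract
  sparse-checked : ∀ {p} .{{_ : NonZero p}} → p ∈ sparse → ∀ W → W < 8 * p → class-check p W ≡ true
  sparse-checked {p@(suc _)} p∈ W W< =
    allFrom-sound (class-check p) 0 (8 * p) (not-false (any-false {f = not ∘ sparse-check} sparse refl p∈)) W z≤n W<

module _ {p w : ℕ} (op : IsOdd p) (ow : IsOdd w) (33≤w : 33 ≤ w) where

  private
    instance
      _ : NonZero p
      _ = IsOdd-nonZero op
      _ : NonZero (8 * p)
      _ = m*n≢0 8 p
    W = w % (8 * p)
    wW : Cong (8 * p) w W
    wW = Cong-sym (Cong-% w (8 * p))
    W%8 : w % 8 ≡ W % 8
    W%8 = Cong⇒% (Cong-∣ {m = 8} (m∣m*n p) wW)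
    W%4 : w % 4 ≡ W % 4
    W%4 = Cong⇒% (Cong-∣ {m = 4} (divides (2 * p) (lem p)) wW)
      where
      lem : ∀ p → 8 * p ≡ 2 * p * 4
      lem = solve-∀

  above-sound : ∀ c s f o i → above p W c s f o i ≡ true → Hyp (p * w) c s
  above-sound c s f o i e = b , trans (Cong⇒% (Cong-∣ {m = 8} (m∣m*n p) bB)) (≡ᵇ-sound b≡) , 3b≤ , Jbn
    where
    r = power f o
    j = (W * (c + 7 * r)) % 8 + 8 * i
    b = r + w * j
    B = r + W * j
    e₁ = ∧-true {r ≤ᵇ 32} e
    e₂ = ∧-true {3 * suc j ≤ᵇ p} (proj₂ e₁)
    e₃ = ∧-true {B % 8 ≡ᵇ c} (proj₂ e₂)
    r≤ = proj₁ e₁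
    j≤ = proj₁ e₂
    b≡ = proj₁ e₃
    Jb = proj₂ e₃
    bB : Cong (8 * p) b B
    bB = Cong-+ (Cong-refl {x = r}) (Cong-* wW (Cong-refl {x = j}))
    3b≤ : 3 * b ≤ p * w
    3b≤ = begin
      3 * (r + w * j)   ≤⟨ *-monoʳ-≤ 3 (+-monoˡ-≤ (w * j) (≤-trans (≤ᵇ-sound {r} {32} r≤) (≤-trans (n≤1+n 32) 33≤w))) ⟩
      3 * (w + w * j)   ≡⟨ lem w j ⟩
      3 * suc j * w     ≤⟨ *-monoˡ-≤ w (≤ᵇ-sound {3 * suc j} {p} j≤) ⟩
      p * w             ∎
      where
      open ≤-Reasoning
      lem : ∀ w j → 3 * (w + w * j) ≡ 3 * suc j * w
      lem = solve-∀
    t = o ∧ two-sign W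
    Jbn : J b (p * w) ≡ -ᵇ s
    Jbn = begin
      J b (p * w)                  ≡⟨ J-*ʳ b op ow ⟩
      J b p ℤ.* J b w              ≡⟨ cong₂ ℤ._*_ (trans (J-cong op (Cong-∣ (n∣m*n 8) bB)) (isJ-sound 60 (s xor t) B op Jb)) (trans (J-cong {b} {r} ow (0 , j , lem r w j)) (trans (J-power f o ow) (cong (λ z → -ᵇ (o ∧ ((z ≡ᵇ 3) ∨ (z ≡ᵇ 5)))) W%8))) ⟩
      -ᵇ (s xor t) ℤ.* -ᵇ t        ≡⟨ trans (ℤ.*-comm (-ᵇ (s xor t)) (-ᵇ t)) (-ᵇ-xor s t) ⟩
      -ᵇ s                         ∎
      where
      open ≡-Reasoning
      lem : ∀ r w j → r + w * j + 0 ≡ r + j * w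
      lem = solve-∀

  below-sound : ∀ c s f o i → below p W c s f o i ≡ true → Hyp (p * w) c s
  below-sound c s f o i e = b , trans (Cong⇒% (Cong-∣ {m = 8} (m∣m*n p) bB)) (≡ᵇ-sound b≡) , 3b≤ , Jbn
    where
    r = power f o
    j = (W * (c + r)) % 8 + 8 * i
    b = w * j ∸ r
    B = W * j + r * (8 * p ∸ 1)
    e₁ = ∧-true {r ≤ᵇ 32} e
    e₂ = ∧-true {3 * suc j ≤ᵇ p} (proj₂ e₁)
    e₃ = ∧-true {0 <ᵇ j} (proj₂ e₂)
    e₄ = ∧-true {B % 8 ≡ᵇ c} (proj₂ e₃)
    r≤ = proj₁ e₁
    j≤ = proj₁ e₂
    j>0 = proj₁ e₃
    b≡ = proj₁ e₄
    Jb = proj₂ e₄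
    r≤wj : r ≤ w * j
    r≤wj = ≤-trans (≤ᵇ-sound {r} {32} r≤) (≤-trans (n≤1+n 32) (≤-trans 33≤w (m≤m*n w j {{>-nonZero (<ᵇ-sound {0} {j} j>0)}})))
    b+r : b + r ≡ w * j
    b+r = m∸n+n≡m r≤wj
    bB : Cong (8 * p) b B
    bB = Cong-+-cancelʳ r (Cong-trans (Cong-≡ b+r) (Cong-trans (Cong-* wW (Cong-refl {x = j})) (Cong-sym (0 , r , lem))))
      where
      open ≡-Reasoning
      lem : W * j + r * (8 * p ∸ 1) + r + 0 ≡ W * j + r * (8 * p)
      lem = begin
        W * j + r * (8 * p ∸ 1) + r + 0    ≡⟨ lem₁ (W * j) r (8 * p ∸ 1) ⟩
        W * j + r * (8 * p ∸ 1 + 1)        ≡⟨ cong (λ z → W * j + r * z) (m∸n+n≡m (>-nonZero⁻¹ (8 * p))) ⟩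
        W * j + r * (8 * p)                ∎
        where
        lem₁ : ∀ x r q → x + r * q + r + 0 ≡ x + r * (q + 1)
        lem₁ = solve-∀
    3b≤ : 3 * b ≤ p * w
    3b≤ = begin
      3 * (w * j ∸ r)   ≤⟨ *-monoʳ-≤ 3 (≤-trans (m∸n≤m (w * j) r) (m≤n+m (w * j) w)) ⟩
      3 * (w + w * j)   ≡⟨ lem w j ⟩
      3 * suc j * w     ≤⟨ *-monoˡ-≤ w (≤ᵇ-sound {3 * suc j} {p} j≤) ⟩
      p * w             ∎
      where
      open ≤-Reasoning
      lem : ∀ w j → 3 * (w + w * j) ≡ 3 * suc j * w
      lem = solve-∀
    t = o ∧ two-sign W
    u = W % 4 ≡ᵇ 3
    Jneg : J b w ≡ -ᵇ u ℤ.* J r w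
    Jneg with odd%4 ow
    ... | inj₁ e = trans (J-neg⁺ {r} {b} ow e (∣⇒Cong0 (subst (w ∣_) (trans (sym b+r) (+-comm b r)) (m∣m*n j)))) (sym (trans (cong (λ z → -ᵇ (z ≡ᵇ 3) ℤ.* J r w) (trans (sym W%4) e)) (ℤ.*-identityˡ _)))
    ... | inj₂ e = trans (J-neg⁻ {r} {b} ow e (∣⇒Cong0 (subst (w ∣_) (trans (sym b+r) (+-comm b r)) (m∣m*n j)))) (sym (trans (cong (λ z → -ᵇ (z ≡ᵇ 3) ℤ.* J r w) (trans (sym W%4) e)) (ℤ.-1*i≡-i _)))
    Jbn : J b (p * w) ≡ -ᵇ s
    Jbn = begin
      J b (p * w)                           ≡⟨ J-*ʳ b op ow ⟩
      J b p ℤ.* J b w                       ≡⟨ cong₂ ℤ._*_ (trans (J-cong op (Cong-∣ (n∣m*n 8) bB)) (isJ-sound 60 ((s xor u) xor t) B op Jb)) (trans Jneg (cong (-ᵇ u ℤ.*_) (trans (J-power f o ow) (cong (λ z → -ᵇ (o ∧ ((z ≡ᵇ 3) ∨ (z ≡ᵇ 5)))) W%8)))) ⟩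
      -ᵇ ((s xor u) xor t) ℤ.* (-ᵇ u ℤ.* -ᵇ t) ≡⟨ lem (-ᵇ ((s xor u) xor t)) (-ᵇ u) (-ᵇ t) ⟩
      -ᵇ u ℤ.* (-ᵇ t ℤ.* -ᵇ ((s xor u) xor t)) ≡⟨ cong (-ᵇ u ℤ.*_) (-ᵇ-xor (s xor u) t) ⟩
      -ᵇ u ℤ.* -ᵇ (s xor u)                 ≡⟨ -ᵇ-xor s u ⟩
      -ᵇ s                                  ∎
      where
      open ≡-Reasoning
      lem : ∀ x y z → x ℤ.* (y ℤ.* z) ≡ y ℤ.* (z ℤ.* x)
      lem = solve-∀ℤ

  find-near-sound : ∀ c s → find-near p W c s ≡ true → Hyp (p * w) c s
  find-near-sound c s e =
    let ((f , o) , _ , e′) = any-true {f = near-power p W c s} powers e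
        (i , _ , ei) = any-true {f = λ i → above p W c s f o i ∨ below p W c s f o i} (upTo (suc (p / 24))) e′
    in [ above-sound c s f o i , below-sound c s f o i ]′ (∨-true {above p W c s f o i} ei)

  needed-sparse : p ∈ sparse → ¬ p ∣ w → Needed (p * w)
  needed-sparse p∈ p∤w = subst₂ (Hyp (p * w)) ce se (find-near-sound _ _ f₁) , find-near-sound 3 true f₂ , find-near-sound 5 true f₃
    where
    near : needed-near p W ≡ true
    near = [ (λ e → contradiction (trans (sym (IsOdd⇒Odd ow)) (trans (Cong⇒% (Cong-∣ {m = 2} (divides (4 * p) (lem p)) wW)) (≡ᵇ-sound e))) λ ())
           , [ (λ e → contradiction (m%n≡0⇒n∣m w p (trans (Cong⇒% (Cong-∣ (n∣m*n 8) wW)) (≡ᵇ-sound e))) p∤w) , (λ e → e) ]′ ∘ ∨-true {W % p ≡ᵇ 0} ]′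
           (∨-true {W % 2 ≡ᵇ 0} (sparse-checked p∈ W (m%n<n w (8 * p))))
      where
      lem : ∀ p → 8 * p ≡ 4 * p * 2
      lem = solve-∀
    n₈ : (p * W) % 8 ≡ (p * w) % 8
    n₈ = Cong⇒% {8} {p * W} {p * w} (Cong-*ˡ p (Cong-sym (Cong-∣ {m = 8} (m∣m*n p) wW)))
    ce : (3 * ((p * W) % 8) + 2) % 8 ≡ (3 * (p * w) + 2) % 8
    ce = Cong⇒% {8} {3 * ((p * W) % 8) + 2} {3 * (p * w) + 2} (Cong-+ (Cong-*ˡ 3 (Cong-trans (Cong-≡ n₈) (Cong-% (p * w) 8))) (Cong-refl {x = 2}))
    se : not ((p * W) % 8 ≡ᵇ 3) ≡ not ((p * w) % 8 ≡ᵇ 3)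
    se = cong (λ z → not (z ≡ᵇ 3)) n₈
    split = ∧-true {find-near p W ((3 * ((p * W) % 8) + 2) % 8) (not ((p * W) % 8 ≡ᵇ 3))} near
    f₁ = proj₁ split
    f₂ = proj₁ (∧-true {find-near p W 3 true} (proj₂ split))
    f₃ = proj₂ (∧-true {find-near p W 3 true} (proj₂ split))

-- Small solutions for every odd nonsquare

-- The three components serve n, 4 n and 16 · 4 ^ f · n. The second fails for n = 3 only, since 12
-- is the one exceptional multiple of 4.
Solutions : ℕ → Set
Solutions n = (n % 8 ≡ 5 ⊎ PSol n ⊎ n ∈ exceptional) × (QSol n ⊎ n ≡ 3) × RSol n

PSign-ᵇ : ∀ r → -ᵇ (not (r ≡ᵇ 3)) ≡ PSign r
PSign-ᵇ 0 = refl
PSign-ᵇ 1 = refl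
PSign-ᵇ 2 = refl
PSign-ᵇ 3 = refl
PSign-ᵇ (suc (suc (suc (suc r)))) = refl

needed⇒solutions : ∀ {n} → Needed n → Solutions n
needed⇒solutions {n} ((b₁ , c₁ , l₁ , J₁) , (b₂ , c₂ , l₂ , J₂) , (b₃ , c₃ , l₃ , J₃)) =
  inj₂ (inj₁ (b₁ , c₁ , l₁ , trans J₁ (PSign-ᵇ (n % 8)))) ,
  inj₁ (b₂ , %8⇒%4 {b₂} c₂ , ≤-trans l₂ (m≤n*m n 2) , J₂) ,
  (b₃ , %8⇒%4 {b₃} c₃ , ≤-trans l₃ (m≤n*m n 8) , J₃)

search : ℕ → ℕ → ℕ → ℕ → Bool → ℕ → Bool
search c k u n s i = (3 * (c + i * k) ≤ᵇ u * n) ∧ isJ 150 s (c + i * k) n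

searchP searchQ searchR solutions-check : ℕ → Bool
searchP n = any (search ((3 * n + 2) % 8) 8 1 n (not (n % 8 ≡ᵇ 3))) (upTo 60)
searchQ n = any (search 3 4 2 n true) (upTo 60)
searchR n = any (search 1 4 8 n true) (upTo 60)
solutions-check n = ((n % 8 ≡ᵇ 5) ∨ any (n ≡ᵇ_) exceptional ∨ searchP n) ∧ (searchQ n ∨ (n ≡ᵇ 3)) ∧ searchR n

search-sound : ∀ c k u {n} s → IsOdd n → any (search c k u n s) (upTo 60) ≡ true → ∃ λ i → 3 * (c + i * k) ≤ u * n × J (c + i * k) n ≡ -ᵇ s
search-sound c k u {n} s o e with any-true {f = search c k u n s} (upTo 60) e
... | i , _ , ei with ∧-true {3 * (c + i * k) ≤ᵇ u * n} ei
...   | e₁ , e₂ = i , ≤ᵇ-sound e₁ , isJ-sound 150 s (c + i * k) o e₂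

solutions-check-sound : ∀ {n} → IsOdd n → solutions-check n ≡ true → Solutions n
solutions-check-sound {n} o e with ∧-true {(n % 8 ≡ᵇ 5) ∨ any (n ≡ᵇ_) exceptional ∨ searchP n} e
... | eP , e′ with ∧-true {searchQ n ∨ (n ≡ᵇ 3)} e′
...   | eQ , eR = P (∨-true {n % 8 ≡ᵇ 5} eP) , Q (∨-true {searchQ n} eQ) , R
  where
  P : (n % 8 ≡ᵇ 5) ≡ true ⊎ (any (n ≡ᵇ_) exceptional ∨ searchP n) ≡ true → n % 8 ≡ 5 ⊎ PSol n ⊎ n ∈ exceptional
  P (inj₁ e) = inj₁ (≡ᵇ-sound e)
  P (inj₂ e) with ∨-true {any (n ≡ᵇ_) exceptional} e
  ... | inj₁ e′ = let (x , x∈ , ex) = any-true {f = n ≡ᵇ_} exceptional e′ in inj₂ (inj₂ (subst (_∈ exceptional) (sym (≡ᵇ-sound {n} {x} ex)) x∈))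
  ... | inj₂ e′ with search-sound ((3 * n + 2) % 8) 8 1 (not (n % 8 ≡ᵇ 3)) o e′
  ...   | i , le , Jb = inj₂ (inj₁ ((3 * n + 2) % 8 + i * 8 , trans ([m+kn]%n≡m%n ((3 * n + 2) % 8) i 8) (m%n%n≡m%n (3 * n + 2) 8) , subst (3 * ((3 * n + 2) % 8 + i * 8) ≤_) (+-identityʳ n) le , trans Jb (PSign-ᵇ (n % 8))))
  Q : searchQ n ≡ true ⊎ (n ≡ᵇ 3) ≡ true → QSol n ⊎ n ≡ 3
  Q (inj₁ e) = let (i , le , Jb) = search-sound 3 4 2 true o e in inj₁ (3 + i * 4 , [m+kn]%n≡m%n 3 i 4 , le , Jb)
  Q (inj₂ e) = inj₂ (≡ᵇ-sound e)
  R : RSol n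
  R = let (i , le , Jb) = search-sound 1 4 8 true o eR in 1 + i * 4 , [m+kn]%n≡m%n 1 i 4 , le , Jb

-- Squarefree parts and the remaining finite cases

SquareFree : ℕ → Set
SquareFree t = ∀ q → Prime q → ¬ q * q ∣ t

squarefree-part : ∀ n → 0 < n → ∃₂ λ s t → n ≡ s * s * t × SquareFree t
squarefree-part = <-rec (λ n → 0 < n → ∃₂ λ s t → n ≡ s * s * t × SquareFree t) step
  where
  step : ∀ n → (∀ {m} → m < n → 0 < m → ∃₂ λ s t → m ≡ s * s * t × SquareFree t) → 0 < n → ∃₂ λ s t → n ≡ s * s * t × SquareFree t
  step n rec n>0 with anyUpTo? (λ q → (2 ≤? q) ×-dec (q * q ∣? n)) (suc n)
  ... | no none = 1 , n , sym (+-identityʳ n) , λ q pr q²∣n →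
          none (q , s≤s (≤-trans (m≤m*n q q {{prime⇒nonZero pr}}) (∣⇒≤ {{>-nonZero n>0}} q²∣n)) , nonTrivial⇒n>1 q {{prime⇒nonTrivial pr}} , q²∣n)
  ... | yes (q , _ , 2≤q , divides m e) = let (s , t , m≡ , sf) = rec m<n m>0 in
          q * s , t , trans e (trans (cong (_* (q * q)) m≡) (lem s t q)) , sf
    where
    lem : ∀ s t q → s * s * t * (q * q) ≡ q * s * (q * s) * t
    lem = solve-∀
    m>0 : 0 < m
    m>0 = n≢0⇒n>0 (λ { refl → contradiction e (>⇒≢ n>0) })
    m<n : m < n
    m<n = subst (m <_) (sym e) (m<m*n m (q * q) {{>-nonZero m>0}} (≤-trans 2≤q (m≤m*n q q {{>-nonZero (≤-trans (s≤s z≤n) 2≤q)}})))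

products : List ℕ → List ℕ
products []       = 1 ∷ []
products (q ∷ qs) = products qs ++ map (q *_) (products qs)

∈-products : ∀ qs t → 0 < t → (∀ q → Prime q → q ∣ t → q ∈ qs) → SquareFree t → t ∈ products qs
∈-products [] (suc zero) _ _ _ = here refl
∈-products [] t@(suc (suc _)) _ h _ with prime-divisor t (s≤s (s≤s z≤n))
... | p , pr , p∣t with h p pr p∣t
...   | ()
∈-products (q ∷ qs) t t>0 h sf with q ∣? t
... | no q∤t = ∈-++⁺ˡ (∈-products qs t t>0 (λ q′ pr d → tail-∈ q′ d (h q′ pr d)) sf)
  where
  tail-∈ : ∀ q′ → q′ ∣ t → q′ ∈ q ∷ qs → q′ ∈ qs
  tail-∈ q′ d (here refl) = contradiction d q∤t
  tail-∈ q′ d (there m) = m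
... | yes (divides u e) = ∈-++⁺ʳ (products qs) (subst (_∈ map (q *_) (products qs)) (sym (trans e (*-comm u q)))
        (∈-map⁺ (q *_) (∈-products qs u u>0 (λ q′ pr d → tail-∈ q′ pr d (h q′ pr (∣-trans d u∣t))) (λ q′ pr d → sf q′ pr (∣-trans d u∣t)))))
  where
  u∣t : u ∣ t
  u∣t = divides q (trans e (*-comm u q))
  u>0 : 0 < u
  u>0 = n≢0⇒n>0 (λ { refl → contradiction e (>⇒≢ t>0) })
  tail-∈ : ∀ q′ → Prime q′ → q′ ∣ u → q′ ∈ q ∷ qs → q′ ∈ qs
  tail-∈ q′ pr (divides v e′) (here refl) = contradiction (divides v (trans e (trans (cong (_* q′) e′) (*-assoc v q′ q′)))) (sf q′ pr)
  tail-∈ q′ pr d (there m) = m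

smallPrimes : List ℕ
smallPrimes = 3 ∷ 5 ∷ 7 ∷ 11 ∷ 13 ∷ 17 ∷ 19 ∷ 23 ∷ []

small-prime-check : ℕ → Bool
small-prime-check q = smallDivisor q ∨ (q ≤ᵇ 2) ∨ any (q ≡ᵇ_) smallPrimes

small-prime : ∀ {q} → Prime q → IsOdd q → q < 29 → q ∈ smallPrimes
small-prime {q} pr o q<29 with ∨-true {smallDivisor q} (allFrom-sound small-prime-check 0 29 refl q z≤n q<29)
... | inj₁ e = contradiction pr (smallDivisor-sound e)
... | inj₂ e with ∨-true {q ≤ᵇ 2} e
...   | inj₁ e′ = contradiction (≤ᵇ-sound {q} e′) (tiny pr o)
  where
  tiny : ∀ {q} → Prime q → IsOdd q → ¬ q ≤ 2
  tiny pr (isOdd zero) _ = ¬prime[1] pr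
  tiny pr (isOdd (suc h)) (s≤s (s≤s le)) = contradiction (subst (_≤ 0) (+-suc h h) le) λ ()
...   | inj₂ e′ = let (x , x∈ , ex) = any-true {f = q ≡ᵇ_} smallPrimes e′ in subst (_∈ smallPrimes) (sym (≡ᵇ-sound {q} {x} ex)) x∈

IsOdd⇒>0 : ∀ {n} → IsOdd n → 0 < n
IsOdd⇒>0 (isOdd h) = s≤s z≤n

-- The y of symbol -1 feeds `Win-full`, whose window of length t fits only for s ≥ 24; the odd s up
-- to 23 are solved directly. The value t = 1 is the case of squares.
smooth-check : ℕ → Bool
smooth-check t = (t ≡ᵇ 1) ∨ (any (λ y → isJ 150 true y t) (upTo 60) ∧ allFrom (λ s → (s % 2 ≡ᵇ 0) ∨ solutions-check (s * s * t)) 1 23)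

cofactor-check : ℕ → Bool
cofactor-check p = allFrom (λ w → (w % 2 ≡ᵇ 0) ∨ (w ≡ᵇ p) ∨ solutions-check (p * w)) 1 32

even-absurd : ∀ {n} {A : Set} → IsOdd n → (n % 2 ≡ᵇ 0) ≡ true → A
even-absurd {n} o e = contradiction (trans (sym (IsOdd⇒Odd o)) (≡ᵇ-sound {n % 2} {0} e)) λ ()

abstract
  smooth-checked : ∀ {t} → IsOdd t → t ∈ products smallPrimes → t ≢ 1 →
                   (∃ λ y → J y t ≡ -1ℤ) × (∀ {s} → IsOdd s → s < 24 → Solutions (s * s * t))
  smooth-checked {t} ot t∈ t≢1 =
    [ (λ e → contradiction (≡ᵇ-sound e) t≢1) , use ]′
    (∨-true {t ≡ᵇ 1} (not-false (any-false {f = not ∘ smooth-check} (products smallPrimes) refl t∈)))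
    where
    A B : Bool
    A = any (λ y → isJ 150 true y t) (upTo 60)
    B = allFrom (λ s → (s % 2 ≡ᵇ 0) ∨ solutions-check (s * s * t)) 1 23
    use : (A ∧ B) ≡ true → (∃ λ y → J y t ≡ -1ℤ) × (∀ {s} → IsOdd s → s < 24 → Solutions (s * s * t))
    use e =
      (let (y , _ , ey) = any-true {f = λ y → isJ 150 true y t} (upTo 60) (proj₁ (∧-true {A} {B} e)) in y , isJ-sound 150 true y ot ey) ,
      λ {s} os s<24 → [ even-absurd os , solutions-check-sound (IsOdd-* (IsOdd-* os os) ot) ]′
        (∨-true {s % 2 ≡ᵇ 0} (allFrom-sound (λ s → (s % 2 ≡ᵇ 0) ∨ solutions-check (s * s * t)) 1 23 (proj₂ (∧-true {A} {B} e)) s (IsOdd⇒>0 os) s<24))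

  cofactor-checked : ∀ {p w} → IsOdd p → IsOdd w → p ∈ sparse → w < 33 → w ≢ p → Solutions (p * w)
  cofactor-checked {p} {w} op ow p∈ w<33 w≢p =
    [ even-absurd ow , [ (λ e → contradiction (≡ᵇ-sound {w} {p} e) w≢p) , solutions-check-sound (IsOdd-* op ow) ]′ ∘ ∨-true {w ≡ᵇ p} ]′
    (∨-true {w % 2 ≡ᵇ 0} (allFrom-sound (λ w → (w % 2 ≡ᵇ 0) ∨ (w ≡ᵇ p) ∨ solutions-check (p * w)) 1 32
      (not-false (any-false {f = not ∘ cofactor-check} sparse refl p∈)) w (IsOdd⇒>0 ow) w<33))

J-squares : ∀ {b s u} → IsOdd s → IsOdd u → Coprime b s → J b (s * s * u) ≡ J b u
J-squares {b} {s} {u} os ou cop = begin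
  J b (s * s * u)                ≡⟨ J-*ʳ b (IsOdd-* os os) ou ⟩
  J b (s * s) ℤ.* J b u          ≡⟨ cong (ℤ._* J b u) (trans (J-*ʳ b os os) (IsSign-square (J-isSign os cop))) ⟩
  1ℤ ℤ.* J b u                   ≡⟨ ℤ.*-identityˡ _ ⟩
  J b u                          ∎
  where open ≡-Reasoning

Cong1-∤ : ∀ {A b q} → Cong A b 1 → Prime q → q ∣ A → ¬ q ∣ b
Cong1-∤ {A} {b} {q} c pr q∣A q∣b = prime∤1 pr (Cong0⇒∣ (Cong-trans (Cong-sym (Cong-∣ q∣A c)) (∣⇒Cong0 q∣b)))

all-hyp⇒needed : ∀ {n} → (∀ c s → c < 8 → Hyp n c s) → Needed n
all-hyp⇒needed {n} h = h _ _ (m%n<n (3 * n + 2) 8) , h 3 true (s≤s (s≤s (s≤s (s≤s z≤n)))) , h 5 true (s≤s (s≤s (s≤s (s≤s (s≤s (s≤s z≤n))))))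

solutions-smooth : ∀ {s t} → IsOdd s → IsOdd t → t ≢ 1 → t ∈ products smallPrimes → Solutions (s * s * t)
solutions-smooth {s} {t} os ot t≢1 t∈ with s <? 24
... | yes s<24 = proj₂ (smooth-checked ot t∈ t≢1) os s<24
... | no s≥24 with coprime-part t s (IsOdd⇒>0 os)
...   | j , cop , j∣s , pj = needed⇒solutions (all-hyp⇒needed (hyp-window ot 2≤t (IsOdd-∣ j∣s os) cop red win le))
  where
  2≤t : 2 ≤ t
  2≤t = ≤∧≢⇒< (IsOdd⇒>0 ot) (λ e → t≢1 (sym e))
  win : Win t t
  win = Win-full ot λ where
    false → 1 , J-1 ot
    true  → proj₁ (smooth-checked ot t∈ t≢1)
  -- Primes of s outside t divide j and so cannot divide b; those dividing t are kept away from b by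
  -- J b t ≠ 0.
  red : ∀ b → Cong j b 1 → IsSign (J b t) → J b (s * s * t) ≡ J b t
  red b c sg = J-squares os ot (coprime-by-primes (IsOdd⇒>0 os) λ q pr q∣b q∣s → case pj q pr q∣s of λ where
    (inj₁ q∣j) → Cong1-∤ c pr q∣j q∣b
    (inj₂ q∣t) → prime∤1 pr (subst (q ∣_) (J-coprime ot sg (q∣b , q∣t)) ∣-refl))
  le : 24 * (j * t) ≤ s * s * t
  le = ≤-trans (≤-reflexive (sym (*-assoc 24 j t))) (*-monoˡ-≤ t (*-mono-≤ (≮⇒≥ s≥24) (∣⇒≤ {{IsOdd-nonZero os}} j∣s)))

-- The part j of s prime to p is at most s / p, which saves a factor p and pays for a window of full
-- length p; the factor 24 is absorbed by p ≥ 29.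
solutions-prime-∣ : ∀ {s t p} → IsOdd s → IsOdd t → IsOdd p → Prime p → 29 ≤ p → ¬ p ∣ t → p ∣ s → Solutions (s * s * (p * t))
solutions-prime-∣ {s} {t} {p} os ot op pr 29≤p p∤t (divides s′ s≡) with coprime-part p s (IsOdd⇒>0 os)
... | j , cop , j∣s , pj = needed⇒solutions (all-hyp⇒needed (hyp-window op (≤-trans (s≤s (s≤s z≤n)) 29≤p) (IsOdd-* ot (IsOdd-∣ j∣s os)) copA red (Win-prime op pr) le))
  where
  copA : Coprime (t * j) p
  copA = coprime-∣ pr (λ d → case euclidsLemma t j pr d of λ where
    (inj₁ p∣t) → p∤t p∣t
    (inj₂ p∣j) → prime∤1 pr (subst (p ∣_) (cop (p∣j , ∣-refl)) ∣-refl))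
  red : ∀ b → Cong (t * j) b 1 → IsSign (J b p) → J b (s * s * (p * t)) ≡ J b p
  red b c sg = trans (J-squares os (IsOdd-* op ot) copbs) (trans (J-*ʳ b op ot) (trans (cong (J b p ℤ.*_) (trans (J-cong {b} {1} ot (Cong-∣ (m∣m*n j) c)) (J-1 ot))) (ℤ.*-identityʳ _)))
    where
    copbs : Coprime b s
    copbs = coprime-by-primes (IsOdd⇒>0 os) λ q prq q∣b q∣s → case pj q prq q∣s of λ where
      (inj₁ q∣j) → Cong1-∤ c prq (∣n⇒∣m*n t q∣j) q∣b
      (inj₂ q∣p) → prime∤1 prq (subst (q ∣_) (J-coprime op sg (q∣b , q∣p)) ∣-refl)
  s′>0 : 0 < s′
  s′>0 = n≢0⇒n>0 (λ { refl → contradiction s≡ (>⇒≢ (IsOdd⇒>0 os)) })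
  j≤s′ : j ≤ s′
  j≤s′ = ∣⇒≤ {{>-nonZero s′>0}} (coprime-divisor cop (subst (j ∣_) (trans s≡ (*-comm s′ p)) j∣s))
  le : 24 * (t * j * p) ≤ s * s * (p * t)
  le = begin
    24 * (t * j * p)       ≤⟨ *-monoʳ-≤ 24 (*-monoˡ-≤ p (*-monoʳ-≤ t j≤s′)) ⟩
    24 * (t * s′ * p)      ≡⟨ cong (24 *_) (trans (*-assoc t s′ p) (cong (t *_) (sym s≡))) ⟩
    24 * (t * s)           ≤⟨ *-monoˡ-≤ (t * s) (≤-trans (m≤n+m 24 5) 29≤p) ⟩
    p * (t * s)            ≤⟨ m≤n*m (p * (t * s)) s {{IsOdd-nonZero os}} ⟩
    s * (p * (t * s))      ≡⟨ lem s p t ⟩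
    s * s * (p * t)        ∎
    where
    open ≤-Reasoning
    lem : ∀ s p t → s * (p * (t * s)) ≡ s * s * (p * t)
    lem = solve-∀

solutions-prime-∤ : ∀ {w p} → IsOdd w → IsOdd p → Prime p → 29 ≤ p → ¬ p ∣ w → Solutions (p * w)
solutions-prime-∤ {w} {p} ow op pr 29≤p p∤w with Win-dense op pr 29≤p
... | inj₂ win = needed⇒solutions (all-hyp⇒needed (hyp-window op (≤-trans (s≤s (s≤s z≤n)) 29≤p) ow (coprime-∣ pr p∤w) red win le))
  where
  red : ∀ b → Cong w b 1 → IsSign (J b p) → J b (p * w) ≡ J b p
  red b c sg = trans (J-*ʳ b op ow) (trans (cong (J b p ℤ.*_) (trans (J-cong {b} {1} ow c) (J-1 ow))) (ℤ.*-identityʳ _))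
  le : 24 * (w * (p / 24)) ≤ p * w
  le = ≤-trans (≤-reflexive (lem w (p / 24))) (*-monoˡ-≤ w (m/n*n≤m p 24))
    where
    lem : ∀ w N → 24 * (w * N) ≡ N * 24 * w
    lem = solve-∀
... | inj₁ p∈ with w <? 33
...   | no w≥33 = needed⇒solutions (needed-sparse op ow (≮⇒≥ w≥33) p∈ p∤w)
...   | yes w<33 = cofactor-checked op ow p∈ w<33 (λ e → p∤w (∣-reflexive (sym e)))

solutions : ∀ {n} → IsOdd n → ¬ IsPerfectSquare n → Solutions n
solutions {n} on nsq with squarefree-part n (IsOdd⇒>0 on)
... | s , t , refl , sf with anyUpTo? (λ p → (29 ≤? p) ×-dec (prime? p) ×-dec (p ∣? t)) (suc t)
...   | no none = solutions-smooth os ot t≢1 (∈-products smallPrimes t (IsOdd⇒>0 ot) (λ q pr q∣t → small-prime pr (IsOdd-∣ q∣t ot) (≰⇒> (λ 29≤q → none (q , s≤s (∣⇒≤ {{IsOdd-nonZero ot}} q∣t) , 29≤q , pr , q∣t)))) sf)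
  where
  os : IsOdd s
  os = IsOdd-*ˡ s s (IsOdd-*ˡ (s * s) t on)
  ot : IsOdd t
  ot = IsOdd-*ˡ t (s * s) (subst IsOdd (*-comm (s * s) t) on)
  t≢1 : t ≢ 1
  t≢1 e = nsq (s , trans (cong (s * s *_) e) (*-identityʳ (s * s)))
...   | yes (p , _ , 29≤p , pr , divides t′ t≡) = subst Solutions (sym n≡) (split (p ∣? s))
  where
  ot : IsOdd t
  ot = IsOdd-*ˡ t (s * s) (subst IsOdd (*-comm (s * s) t) on)
  os : IsOdd s
  os = IsOdd-*ˡ s s (IsOdd-*ˡ (s * s) t on)
  t≡′ : t ≡ p * t′
  t≡′ = trans t≡ (*-comm t′ p)
  n≡ : s * s * t ≡ s * s * (p * t′)
  n≡ = cong (s * s *_) t≡′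
  op : IsOdd p
  op = IsOdd-*ˡ p t′ (subst IsOdd t≡′ ot)
  ot′ : IsOdd t′
  ot′ = IsOdd-*ˡ t′ p (subst IsOdd t≡ ot)
  p∤t′ : ¬ p ∣ t′
  p∤t′ (divides u e) = sf p pr (divides u (trans t≡ (trans (cong (_* p) e) (*-assoc u p p))))
  split : Dec (p ∣ s) → Solutions (s * s * (p * t′))
  split (yes p∣s) = solutions-prime-∣ os ot′ op pr 29≤p p∤t′ p∣s
  split (no p∤s) = subst Solutions (lem p s t′) (solutions-prime-∤ (IsOdd-* (IsOdd-* os os) ot′) op pr 29≤p λ d → case euclidsLemma (s * s) t′ pr d of λ where
    (inj₁ p∣ss) → case euclidsLemma s s pr p∣ss of λ where
      (inj₁ p∣s) → p∤s p∣s
      (inj₂ p∣s) → p∤s p∣s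
    (inj₂ p∣t′) → p∤t′ p∣t′)
    where
    lem : ∀ p s t → p * (s * s * t) ≡ s * s * (p * t)
    lem = solve-∀

-- Powers of 2 and the classification of all nonsquares

4-part : ∀ q → 0 < q → ∃₂ λ f n → IsOdd n × (q ≡ 4 ^ f * n ⊎ q ≡ 2 * (4 ^ f * n))
4-part = <-rec (λ q → 0 < q → ∃₂ λ f n → IsOdd n × (q ≡ 4 ^ f * n ⊎ q ≡ 2 * (4 ^ f * n))) step
  where
  step : ∀ q → (∀ {r} → r < q → 0 < r → ∃₂ λ f n → IsOdd n × (r ≡ 4 ^ f * n ⊎ r ≡ 2 * (4 ^ f * n))) → 0 < q →
         ∃₂ λ f n → IsOdd n × (q ≡ 4 ^ f * n ⊎ q ≡ 2 * (4 ^ f * n))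
  step q rec q>0 with parity q
  ... | oddP h = 0 , odd h , isOdd h , inj₁ (sym (+-identityʳ (odd h)))
  ... | evenP k with rec {k} (m<m+n k k>0) k>0
    where
    k>0 : 0 < k
    k>0 = n≢0⇒n>0 (λ { refl → contradiction q>0 λ () })
  ...   | f , n , on , inj₁ e = f , n , on , inj₂ (trans (cong₂ _+_ e e) (lem (4 ^ f * n)))
    where
    lem : ∀ x → x + x ≡ 2 * x
    lem = solve-∀
  ...   | f , n , on , inj₂ e = suc f , n , on , inj₁ (trans (cong₂ _+_ e e) (lem (4 ^ f) n))
    where
    lem : ∀ x n → 2 * (x * n) + 2 * (x * n) ≡ 4 * x * n
    lem = solve-∀

square-4* : ∀ {n} → IsPerfectSquare n → IsPerfectSquare (4 * n)
square-4* (k , e) = 2 * k , trans (cong (4 *_) e) (lem k)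
  where
  lem : ∀ k → 4 * (k * k) ≡ 2 * k * (2 * k)
  lem = solve-∀

square-4^ : ∀ f {n} → IsPerfectSquare n → IsPerfectSquare (4 ^ f * n)
square-4^ zero    {n} sq = subst IsPerfectSquare (sym (+-identityʳ n)) sq
square-4^ (suc f) {n} sq = subst IsPerfectSquare (sym (*-assoc 4 (4 ^ f) n)) (square-4* (square-4^ f sq))

numerator-2mod4 : ∀ h → 2 * odd h ∉ exceptional → IsNumerator (2 * odd h)
numerator-2mod4 h ∉exc with parity h
-- Here m = 8 k + 2. Below 50, where b = 16 is too large, 2, 26 and 42 have explicit pairs, while
-- 10, 18 and 34 are exceptional.
... | evenP 0 = numerator 1 0 refl refl
... | evenP 1 = contradiction (there (there (there (here refl)))) ∉exc
... | evenP 2 = contradiction (there (there (there (there (there (there (here refl))))))) ∉exc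
... | evenP 3 = numerator 1 8 refl refl
... | evenP 4 = contradiction (there (there (there (there (there (there (there (there (there (there (here refl))))))))))) ∉exc
... | evenP 5 = numerator 9 8 refl refl
... | evenP (suc (suc (suc (suc (suc (suc g)))))) = subst IsNumerator (lem g) (numerator-2mod8 g)
  where
  lem : ∀ g → 50 + g * 8 ≡ 2 * suc (6 + g + (6 + g) + (6 + g + (6 + g)))
  lem = solve-∀
... | oddP 0 = contradiction (there (here refl)) ∉exc
... | oddP (suc g) = subst IsNumerator (lem g) (numerator-6mod8 g)
  where
  lem : ∀ g → 14 + g * 8 ≡ 2 * suc (suc (suc g + suc g) + suc (suc g + suc g))
  lem = solve-∀

numerator-0mod16 : ∀ q → 0 < q → ¬ IsPerfectSquare (16 * q) → IsNumerator (16 * q)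
numerator-0mod16 q q>0 nsq with 4-part q q>0
... | f , n , on , inj₁ refl = subst IsNumerator (sym (*-assoc 4 4 (4 ^ f * n)))
        (numerator-16 f on (proj₂ (proj₂ (solutions on λ sq → nsq (subst IsPerfectSquare (sym (*-assoc 4 4 (4 ^ f * n))) (square-4* (square-4* (square-4^ f sq))))))))
... | f , n , on , inj₂ refl = subst IsNumerator (lem (4 ^ f * n)) (numerator-32 f on)
  where
  lem : ∀ x → 4 * (8 * x) ≡ 16 * (2 * x)
  lem = solve-∀

numerator-odd′ : ∀ {n} → IsOdd n → ¬ IsPerfectSquare n → n ∉ exceptional → IsNumerator n
numerator-odd′ {n} on nsq ∉exc with n % 8 ≟ 5
... | yes e = subst IsNumerator (sym (%⇒≡ n 8 5 e)) (numerator-5mod8 (n / 8))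
... | no n≢5 with proj₁ (solutions on nsq)
...   | inj₁ e = contradiction e n≢5
...   | inj₂ (inj₁ sol) = numerator-odd on n≢5 sol
...   | inj₂ (inj₂ ∈exc) = contradiction ∈exc ∉exc

numerator-even : ∀ k → 0 < k → ¬ IsPerfectSquare (2 * k) → 2 * k ∉ exceptional → IsNumerator (2 * k)
numerator-even k k>0 nsq ∉exc with parity k
... | oddP h = numerator-2mod4 h ∉exc
... | evenP l with parity l
...   | oddP h = subst IsNumerator (lem (odd h)) (fourfold (proj₁ (proj₂ (solutions (isOdd h) λ sq → nsq (subst IsPerfectSquare (lem (odd h)) (square-4* sq))))))
  where
  lem : ∀ l → 4 * l ≡ 2 * (l + l)
  lem = solve-∀
  fourfold : QSol (odd h) ⊎ odd h ≡ 3 → IsNumerator (4 * odd h)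
  fourfold (inj₁ sol) = numerator-4n (isOdd h) sol
  fourfold (inj₂ e) = contradiction (subst (λ z → 2 * (z + z) ∈ exceptional) (sym e) (there (there (there (there (here refl)))))) ∉exc
...   | evenP g with parity g
...     | oddP h = subst IsNumerator (lem h) (numerator-8mod16 h)
  where
  lem : ∀ h → 8 + h * 16 ≡ 2 * (suc (h + h) + suc (h + h) + (suc (h + h) + suc (h + h)))
  lem = solve-∀
...     | evenP q = subst IsNumerator (lem q) (numerator-0mod16 q (n≢0⇒n>0 λ { refl → contradiction k>0 λ () }) λ sq → nsq (subst IsPerfectSquare (lem q) sq))
  where
  lem : ∀ q → 16 * q ≡ 2 * (q + q + (q + q) + (q + q + (q + q)))
  lem = solve-∀

nonsquare-numerator : ∀ m → m ≥ 1 → ¬ IsPerfectSquare m → m ∉ exceptional → IsNumerator m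
nonsquare-numerator m m≥1 nsq ∉exc with parity m
... | oddP h = numerator-odd′ (isOdd h) nsq ∉exc
... | evenP k = subst IsNumerator (sym (lem k)) (numerator-even k (n≢0⇒n>0 λ { refl → contradiction m≥1 λ () })
                  (λ sq → nsq (subst IsPerfectSquare (sym (lem k)) sq)) (λ m∈ → ∉exc (subst (_∈ exceptional) (sym (lem k)) m∈)))
  where
  lem : ∀ k → k + k ≡ 2 * k
  lem = solve-∀

square? : ∀ m → Dec (IsPerfectSquare m)
square? m with anyUpTo? (λ k → m ≟ k * k) (suc m)
... | yes (k , _ , e) = yes (k , e)
... | no none = no λ where
  (zero , e)      → none (0 , s≤s z≤n , e)
  (k@(suc _) , e) → none (k , s≤s (subst (k ≤_) (sym e) (m≤m*n k k)) , e)

theorem2p7 : (m : ℕ) → m ≥ 1 →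
    ((¬ IsNumerator m) ⇔ (IsPerfectSquare m ⊎ m ∈ exceptional))
theorem2p7 m m≥1 = mk⇔ to [ square-not-numerator m , exceptional-not-numerator m ]′
  where
  to : ¬ IsNumerator m → IsPerfectSquare m ⊎ m ∈ exceptional
  to ¬num with square? m | m ∈? exceptional
  ... | yes sq | _       = inj₁ sq
  ... | no _   | yes m∈  = inj₂ m∈
  ... | no nsq | no m∉   = contradiction (nonsquare-numerator m m≥1 nsq m∉) ¬num
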